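{- For every $\Delta$ there exists $L=L(\Delta)$ such that the following holds for every $n$. Let $q\in[0,1]$, let $H$ be a $q$-sparse graph on $n$ vertices, let $p=Lq$, and let $F$ be a tree with maximum degree $\Delta$ (of any size, possibly depending on $n$). Then \[ N(H,F) < \mathbb{E}_pX_F. \]
   Context: All graphs are simple. A copy of a graph $J$ in a graph $G$ is an unlabeled subgraph of $G$ isomorphic to $J$, and $N(G,J)$ denotes the number of copies of $J$ in $G$. $G_{n,p}$ is the Erdős–Rényi random graph on $n$ vertices, and $\mathbb{E}_pX_J:=\mathbb{E}\,N(G_{n,p},J)=N(K_n,J)p^{e_J}$, where $e_J$ is the number of edges of $J$. A graph $H$ on $n$ vertices (i.e. a subgraph of $K_n$) is $q$-sparse if $\mathbb{E}_qX_I\ge 1$ for every subgraph $I\subseteq H$.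
   Formalization: Here q is rational rather than real, and q > 0, Δ ≥ 1 and |V(F)| ≤ n are assumed; in the cases excluded by these three conditions both sides are equal, so the strict inequality fails. Assumes q > 0, Δ ≥ 1 and that F has at most n vertices, since otherwise both sides are equal and the strict inequality fails; q is taken rational, from which the case of real q follows by replacing L with 2L. -}

module Defs where

open import Data.Bool using (Bool; true; false; T; T?; _∨_; _∧_; not)
import Data.Bool.Properties as BoolP
open import Data.Nat as ℕ using (ℕ; zero; suc; _<?_)
open import Data.Fin using (Fin; toℕ)
import Data.Fin.Properties as FinP
open import Data.List using (List; []; _∷_; length; filter; map; concatMap; allFin; deduplicate)
open import Data.Bool.ListAction using (any; all)
open import Data.Vec as Vec using (Vec; tabulate; lookup)
import Data.Vec.Properties as VecP
open import Data.Product using (Σ; _×_; _,_; ∃)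
import Data.Product.Properties as ProdP
open import Data.Integer using (+_)
open import Data.Rational as ℚ using (ℚ; 1ℚ; _/_)
open import Relation.Binary.PropositionalEquality using (_≡_; refl) renaming (sym to sym≡)
open import Data.Empty using (⊥; ⊥-elim)
open import Relation.Nullary using (Dec; yes; no; does)
open import Function.Definitions using (Injective)

record Graph (m : ℕ) : Set where
  field
    adj  : Fin m → Fin m → Bool
    sym  : ∀ i j → adj i j ≡ adj j i
    irr  : ∀ i → adj i i ≡ false
open Graph public

K : (n : ℕ) → Graph n
K n = record { adj = λ i j → not (does (i FinP.≟ j)) ; sym = symK ; irr = irrK }
  where
  symK : ∀ i j → not (does (i FinP.≟ j)) ≡ not (does (j FinP.≟ i))
  symK i j with i FinP.≟ j | j FinP.≟ i
  ... | yes _ | yes _ = refl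
  ... | no _  | no _  = refl
  ... | yes p | no ¬q = ⊥-elim (¬q (sym≡ p))
  ... | no ¬p | yes q = ⊥-elim (¬p (sym≡ q))
  irrK : ∀ i → not (does (i FinP.≟ i)) ≡ false
  irrK i with i FinP.≟ i
  ... | yes _ = refl
  ... | no ¬p = ⊥-elim (¬p refl)

v : ∀ {m} → Graph m → ℕ
v {m} _ = m

pairs : ∀ m → List (Fin m × Fin m)
pairs m = concatMap (λ i → map (i ,_) (allFin m)) (allFin m)

e : ∀ {m} → Graph m → ℕ
e {m} G = length (filter (λ { (i , j) → T? (adj G i j) }) (filter (λ { (i , j) → toℕ i <? toℕ j }) (pairs m)))

deg : ∀ {m} → Graph m → Fin m → ℕ
deg {m} G x = length (filter (λ y → T? (adj G x y)) (allFin m))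

HasMaxDegree : ∀ {m} → Graph m → ℕ → Set
HasMaxDegree {m} G Δ = (∀ x → deg G x ℕ.≤ Δ) × Σ (Fin m) (λ x → deg G x ≡ Δ)

data Walk {m} (G : Graph m) : Fin m → Fin m → Set where
  here : ∀ {x} → Walk G x x
  step : ∀ {x y z} → T (adj G x y) → Walk G y z → Walk G x z

Connected : ∀ {m} → Graph m → Set
Connected {m} G = ∀ (x y : Fin m) → Walk G x y

HasCycle : ∀ {m} → Graph m → Set
HasCycle {m} G =
  Σ ℕ λ k → Σ (Fin (3 ℕ.+ k) → Fin m) λ c →
    Injective _≡_ _≡_ c ×
    (∀ (i j : Fin (3 ℕ.+ k)) → suc (toℕ i) ≡ toℕ j → T (adj G (c i) (c j))) ×
    T (adj G (c (Data.Fin.fromℕ (2 ℕ.+ k))) (c Data.Fin.zero))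

Acyclic : ∀ {m} → Graph m → Set
Acyclic G = HasCycle G → ⊥

IsTree : ∀ {m} → Graph m → Set
IsTree {m} G = (1 ℕ.≤ m) × Connected G × Acyclic G

-- Counting copies: N(G , J) = number of subgraphs of G isomorphic to J.
-- A subgraph of G isomorphic to J is exactly the image (vertex set, edge set)
-- of an injective edge-preserving map J → G; we count distinct images.

allMaps : ∀ n m → List (Vec (Fin n) m)
allMaps n zero = Vec.[] ∷ []
allMaps n (suc m) = concatMap (λ x → map (x Vec.∷_) (allMaps n m)) (allFin n)

isEmbedding : ∀ {m n} → Graph m → Graph n → Vec (Fin n) m → Bool
isEmbedding {m} J G f =
  all (λ { (i , j) → (does (i FinP.≟ j) ∨ not (does (lookup f i FinP.≟ lookup f j)))
                     ∧ (not (adj J i j) ∨ adj G (lookup f i) (lookup f j)) })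
      (pairs m)

Subgraph : ℕ → Set
Subgraph n = Vec Bool n × Vec (Vec Bool n) n

image : ∀ {m n} → Graph m → Vec (Fin n) m → Subgraph n
image {m} J f =
  tabulate (λ x → any (λ i → does (lookup f i FinP.≟ x)) (allFin m)) ,
  tabulate (λ x → tabulate (λ y → any (λ { (i , j) → adj J i j ∧
        (does (lookup f i FinP.≟ x) ∧ does (lookup f j FinP.≟ y)) }) (pairs m)))

subgraph-≟ : ∀ {n} (a b : Subgraph n) → Dec (a ≡ b)
subgraph-≟ = ProdP.≡-dec (VecP.≡-dec BoolP._≟_) (VecP.≡-dec (VecP.≡-dec BoolP._≟_))

copies : ∀ {m n} → Graph n → Graph m → List (Subgraph n)
copies {m} {n} G J =
  deduplicate subgraph-≟ (map (image J) (filter (λ f → T? (isEmbedding J G f)) (allMaps n m)))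

N : ∀ {m n} → Graph n → Graph m → ℕ
N G J = length (copies G J)

ℕ→ℚ : ℕ → ℚ
ℕ→ℚ k = + k / 1

_^ℚ_ : ℚ → ℕ → ℚ
x ^ℚ zero = 1ℚ
x ^ℚ suc k = x ℚ.* (x ^ℚ k)

EX : (n : ℕ) → ℚ → ∀ {m} → Graph m → ℚ
EX n p J = ℕ→ℚ (N (K n) J) ℚ.* (p ^ℚ e J)

_⊆G_ : ∀ {m n} → Graph m → Graph n → Set
_⊆G_ {m} {n} I H = Σ (Fin m → Fin n) λ f →
  Injective _≡_ _≡_ f × (∀ i j → T (adj I i j) → T (adj H (f i) (f j)))

Sparse : ℚ → ∀ {n} → Graph n → Set
Sparse q {n} H = ∀ {m} (I : Graph m) → I ⊆G H → 1ℚ ℚ.≤ EX n q I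

-- Write m = ℓ + 1 for the number of vertices of F and d = n q. Take T disjoint copies of F in H and, for every vertex u of F,
-- s_u further neighbours of each vertex in the role of u. Their union I is a subgraph of H, and counting its images in K_n gives
-- E_q X_I ≤ (4 n d^ℓ ∏_u (4 d / s_u)^{s_u} / T)^T, so sparsity forces T to be small.
--
-- Let k = ⌊d⌋ + 1 and classify the embeddings of F in H by the degrees of the image vertices in units of M, a multiple of (Δ + 1) k.
-- For a class with levels t_u one can take s_u = c k t_u, and a maximal family of T disjoint members then satisfies
-- T 2^{(Δ+1) k Σt} ≤ 4 n d^ℓ. Every member of the class meets the family, and extending an embedding of F vertex by vertex shows
-- that the class has at most T m² (2M)^ℓ 2^{Δ Σt} members. The loss 2^{Δ Σt} is beaten by the bound on T (after taking k-th roots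
-- when k ≥ 2), with a factor 2^{-Σt} to spare, and summing over all t leaves at most n (L d)^ℓ embeddings. Comparing with
-- n^m ≤ 4^m n(n-1)…(n-m+1) and dividing by the number of automorphisms of F gives the theorem.
--
-- An edge between two of the chosen vertices could be used at both its ends. To avoid this, the neighbours above and below a vertex
-- in the order of Fin n are treated separately, so that every vertex has two levels.
module Submission where

open import Defs
open import Data.Bool using (Bool; true; false; T; T?; _∨_; _∧_; not)
open import Data.Bool.ListAction using (any)
open import Data.Bool.Properties using (T-∧; ∨-comm)
open import Data.Empty using (⊥; ⊥-elim)
open import Data.Unit using (⊤; tt)
open import Data.Maybe using (Maybe; just; nothing)
open import Data.Fin as Fin using (Fin; zero; suc; toℕ; fromℕ)
import Data.Fin.Properties as FinP
open import Data.List as List using (List; []; _∷_; [_]; _++_; length; filter; map; concatMap; allFin; deduplicate; take; cartesianProductWith)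
open import Data.List.Properties using (length-++; length-map; length-take; length-tabulate)
open import Data.List.Membership.Propositional using (_∈_; _∉_; lose; find)
open import Data.List.Membership.Propositional.Properties
open import Data.List.Relation.Unary.All as All using (All; []; _∷_)
import Data.List.Relation.Unary.All.Properties as AllP
open import Data.List.Relation.Unary.Any as Any using (Any; here; there; any?)
import Data.List.Relation.Unary.Any.Properties as AnyP
open import Data.List.Relation.Unary.AllPairs using ([]; _∷_)
open import Data.List.Relation.Unary.Unique.Propositional using (Unique)
import Data.List.Relation.Unary.Unique.Propositional.Properties as Uniq
import Data.List.Relation.Unary.Unique.DecPropositional.Properties as UniqDec
open import Data.Vec as Vec using (Vec; []; _∷_; lookup; tabulate; _[_]≔_)
import Data.Vec.Properties as VecP
open import Data.Nat using (ℕ; _≤_)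
open import Data.Nat.ListAction using (sum)
open import Data.Nat.DivMod using (_%_; _/_; m/n*n≤m; m≡m%n+[m/n]*n; m%n<n; m/n≤m)
open import Data.Nat.Combinatorics.Base using (_P′_)
import Data.Product.Properties as ProdP
open import Data.Sum using (_⊎_; inj₁; inj₂)
open import Function using (_∘_; id; case_of_)
open import Function.Bundles using (Equivalence)
open import Relation.Binary.PropositionalEquality as ≡ using (_≡_; _≢_; refl; cong; cong₂; subst; trans)
open import Relation.Nullary using (Dec; yes; no; does; ¬_; ¬?)
import Data.Integer as ℤ
import Data.Integer.Properties as ℤP
import Data.Rational.Properties as QP
open import Relation.Binary.Definitions using (tri<; tri≈; tri>)
open import Data.Nat.Solver using (module +-*-Solver)
import Data.Rational.Unnormalised as Qᵘ
import Data.Rational.Unnormalised.Properties as QᵘP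
open import Data.Product using (Σ; ∃; _×_; _,_; proj₁; proj₂)
import Data.Rational as Q

-- Sparsity does not bound the maximum degree of `H`, so counting embeddings vertex by vertex with
-- one degree bound is hopeless. The stars make large degrees expensive: with s ≥ 8k, the expected
-- number of ways to place s leaves at a given vertex is at most (4d/s)^s ≤ 2^(-s). The T copies are
-- disjoint and interchangeable, so their count carries a factor 1/T!; after a T-th root this is
-- what bounds T linearly.
--
-- The scale k reconciles two regimes. Extending an embedding costs about (Ck)^ℓ in both. If d < 1
-- then k = 1, and the factor d^ℓ must come from the bound on T. If d ≥ 1 then k is comparable to d,
-- the extensions already use up d^ℓ, and T should be at most about n C^ℓ 2^(-w) with w = (Δ+1)Σt.
-- The bound on T still has d^ℓ in it, but its saving is 2^(-kw); since d^ℓ ≤ 2^(kℓ), a k-th root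
-- leaves only 2^ℓ.
--
-- The tree may have as many as n vertices, so only losses of the form C^ℓ are affordable. The
-- number of classes is far beyond that, hence the spare geometric factor.

module TreeCopies where

  open import Data.Nat
  open import Data.Nat.Properties
  open import Data.Rational using (ℚ; 0ℚ; 1ℚ)

  private variable
    A : Set
    m n ℓ : ℕ

  -- Finite lists and sums

  -- Stated for a relation because many later matchings are found by case analysis: an edge matched
  -- with either of its orientations, an embedding with the automorphism it factors through. The
  -- induction removes the partner of the head from `ys`.
  pigeonhole : ∀ {A B : Set} (R : A → B → Set) {xs : List A} {ys : List B} →
    Unique xs →
    (∀ {x} → x ∈ xs → ∃ λ y → y ∈ ys × R x y) →
    (∀ {x x′ y} → x ∈ xs → x′ ∈ xs → R x y → R x′ y → x ≡ x′) →
    length xs ≤ length ys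
  pigeonhole R {[]} _ _ _ = z≤n
  pigeonhole R {x ∷ xs} {ys} (x≢ ∷ uniq) total inj with total (here refl)
  ... | y , y∈ , Rxy with ∈-∃++ y∈
  ... | as , bs , refl = begin
    suc (length xs)                ≤⟨ s≤s (pigeonhole R uniq total′ λ p q → inj (there p) (there q)) ⟩
    suc (length (as ++ bs))        ≡⟨ cong suc (length-++ as) ⟩
    suc (length as + length bs)    ≡⟨ +-suc (length as) (length bs) ⟨
    length as + suc (length bs)    ≡⟨ length-++ as ⟨
    length (as ++ y ∷ bs)          ∎
    where
    open ≤-Reasoning
    skip : ∀ {z} → z ∈ as ++ y ∷ bs → z ≢ y → z ∈ as ++ bs
    skip z∈ z≢y with ∈-++⁻ as z∈
    ... | inj₁ z∈as         = ∈-++⁺ˡ z∈as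
    ... | inj₂ (here z≡y)   = ⊥-elim (z≢y z≡y)
    ... | inj₂ (there z∈bs) = ∈-++⁺ʳ as z∈bs
    total′ : ∀ {x′} → x′ ∈ xs → ∃ λ y′ → y′ ∈ as ++ bs × R x′ y′
    total′ x′∈ with total (there x′∈)
    ... | z , z∈ , Rx′z = z , skip z∈ z≢y , Rx′z
      where
      z≢y : z ≢ y
      z≢y refl = All.lookup x≢ x′∈ (inj (here refl) (there x′∈) Rxy Rx′z)

  unique-⊆⇒length≤ : ∀ {A : Set} {xs ys : List A} → Unique xs → (∀ {x} → x ∈ xs → x ∈ ys) → length xs ≤ length ys
  unique-⊆⇒length≤ uniq sub = pigeonhole _≡_ uniq (λ x∈ → _ , sub x∈ , refl) (λ _ _ p q → trans p (≡.sym q))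

  unique-⇔⇒length≡ : ∀ {A : Set} {xs ys : List A} → Unique xs → Unique ys →
    (∀ {x} → x ∈ xs → x ∈ ys) → (∀ {x} → x ∈ ys → x ∈ xs) → length xs ≡ length ys
  unique-⇔⇒length≡ ux uy p q = ≤-antisym (unique-⊆⇒length≤ ux p) (unique-⊆⇒length≤ uy q)

  unique-map : ∀ {A B : Set} {f : A → B} {xs} → (∀ {x y} → x ∈ xs → y ∈ xs → f x ≡ f y → x ≡ y) → Unique xs → Unique (map f xs)
  unique-map {xs = []} _ [] = []
  unique-map {f = f} {x ∷ xs} inj (x≢ ∷ uniq) =
    All.tabulate (λ fy∈ fx≡ → case ∈-map⁻ f fy∈ of λ { (y , y∈ , refl) → All.lookup x≢ y∈ (inj (here refl) (there y∈) fx≡) })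
    ∷ unique-map (λ p q → inj (there p) (there q)) uniq

  length-allFin : ∀ n → length (allFin n) ≡ n
  length-allFin n = length-tabulate id

  unique⇒length≤ : ∀ {n} {xs : List (Fin n)} → Unique xs → length xs ≤ n
  unique⇒length≤ {n} uniq = ≤-trans (unique-⊆⇒length≤ uniq (λ {x} _ → ∈-allFin x)) (≤-reflexive (length-allFin n))

  ∑ : ∀ {A : Set} → List A → (A → ℕ) → ℕ
  ∑ xs g = sum (map g xs)

  ∑-mono : ∀ {A : Set} (xs : List A) {g h : A → ℕ} → (∀ {x} → x ∈ xs → g x ≤ h x) → ∑ xs g ≤ ∑ xs h
  ∑-mono []       p = z≤n
  ∑-mono (x ∷ xs) p = +-mono-≤ (p (here refl)) (∑-mono xs (p ∘ there))

  ∑-cong : ∀ {A : Set} (xs : List A) {g h : A → ℕ} → (∀ x → g x ≡ h x) → ∑ xs g ≡ ∑ xs h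
  ∑-cong []       eq = refl
  ∑-cong (x ∷ xs) eq = cong₂ _+_ (eq x) (∑-cong xs eq)

  ∑-const : ∀ {A : Set} (xs : List A) c → ∑ xs (λ _ → c) ≡ length xs * c
  ∑-const []       c = refl
  ∑-const (x ∷ xs) c = cong (c +_) (∑-const xs c)

  ∑-bound : ∀ {A : Set} (xs : List A) {g : A → ℕ} c → (∀ {x} → x ∈ xs → g x ≤ c) → ∑ xs g ≤ length xs * c
  ∑-bound xs c p = ≤-trans (∑-mono xs p) (≤-reflexive (∑-const xs c))

  +-interchange : ∀ a b c d → (a + b) + (c + d) ≡ (a + c) + (b + d)
  +-interchange a b c d = begin
    (a + b) + (c + d) ≡⟨ +-assoc a b (c + d) ⟩
    a + (b + (c + d)) ≡⟨ cong (a +_) (+-assoc b c d) ⟨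
    a + (b + c + d)   ≡⟨ cong (λ t → a + (t + d)) (+-comm b c) ⟩
    a + (c + b + d)   ≡⟨ cong (a +_) (+-assoc c b d) ⟩
    a + (c + (b + d)) ≡⟨ +-assoc a c (b + d) ⟨
    (a + c) + (b + d) ∎
    where open ≡.≡-Reasoning

  ∑-+ : ∀ {A : Set} (xs : List A) (g h : A → ℕ) → ∑ xs (λ x → g x + h x) ≡ ∑ xs g + ∑ xs h
  ∑-+ []       g h = refl
  ∑-+ (x ∷ xs) g h = trans (cong (g x + h x +_) (∑-+ xs g h)) (+-interchange (g x) (h x) (∑ xs g) (∑ xs h))

  ∑-*ʳ : ∀ {A : Set} (xs : List A) (g : A → ℕ) c → ∑ xs (λ x → g x * c) ≡ ∑ xs g * c
  ∑-*ʳ []       g c = refl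
  ∑-*ʳ (x ∷ xs) g c = trans (cong (g x * c +_) (∑-*ʳ xs g c)) (≡.sym (*-distribʳ-+ c (g x) (∑ xs g)))

  ∑-swap : ∀ {A B : Set} (xs : List A) (ys : List B) (g : A → B → ℕ) →
    ∑ xs (λ x → ∑ ys (g x)) ≡ ∑ ys (λ y → ∑ xs (λ x → g x y))
  ∑-swap []       ys g = ≡.sym (trans (∑-const ys 0) (*-zeroʳ (length ys)))
  ∑-swap (x ∷ xs) ys g = trans (cong (∑ ys (g x) +_) (∑-swap xs ys g)) (≡.sym (∑-+ ys (g x) (λ y → ∑ xs (λ z → g z y))))

  pairsOf : ∀ {A B : Set} → List A → (A → List B) → List (A × B)
  pairsOf xs g = concatMap (λ x → map (x ,_) (g x)) xs

  ∈-pairsOf⁺ : ∀ {A B : Set} {xs : List A} {g : A → List B} {x y} → x ∈ xs → y ∈ g x → (x , y) ∈ pairsOf xs g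
  ∈-pairsOf⁺ {g = g} (here refl) y∈ = ∈-++⁺ˡ (∈-map⁺ _ y∈)
  ∈-pairsOf⁺ {xs = z ∷ _} {g = g} (there x∈) y∈ = ∈-++⁺ʳ (map (z ,_) (g z)) (∈-pairsOf⁺ x∈ y∈)

  ∈-pairsOf⁻ : ∀ {A B : Set} (xs : List A) {g : A → List B} {x y} → (x , y) ∈ pairsOf xs g → x ∈ xs × y ∈ g x
  ∈-pairsOf⁻ (z ∷ xs) {g} xy∈ with ∈-++⁻ (map (z ,_) (g z)) xy∈
  ... | inj₁ p with ∈-map⁻ (z ,_) p
  ...   | _ , y∈ , refl = here refl , y∈
  ∈-pairsOf⁻ (z ∷ xs) {g} xy∈ | inj₂ p with ∈-pairsOf⁻ xs p
  ...   | x∈ , y∈ = there x∈ , y∈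

  pairsOf-unique : ∀ {A B : Set} {xs : List A} {g : A → List B} → Unique xs → (∀ {x} → x ∈ xs → Unique (g x)) → Unique (pairsOf xs g)
  pairsOf-unique {xs = []}     []          ug = []
  pairsOf-unique {xs = z ∷ xs} {g} (z≢ ∷ ux) ug =
    Uniq.++⁺ (Uniq.map⁺ (cong proj₂) (ug (here refl))) (pairsOf-unique ux (ug ∘ there)) disjoint
    where
    disjoint : ∀ {p} → p ∈ map (z ,_) (g z) × p ∈ pairsOf xs g → ⊥
    disjoint (p∈ , p∈′) with ∈-map⁻ (z ,_) p∈
    ... | _ , _ , refl = All.lookup z≢ (proj₁ (∈-pairsOf⁻ xs p∈′)) refl

  length-concatMap : ∀ {A B : Set} (xs : List A) (f : A → List B) → length (concatMap f xs) ≡ ∑ xs (length ∘ f)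
  length-concatMap []       f = refl
  length-concatMap (x ∷ xs) f = trans (length-++ (f x)) (cong (length (f x) +_) (length-concatMap xs f))

  length-pairsOf : ∀ {A B : Set} (xs : List A) (g : A → List B) → length (pairsOf xs g) ≡ ∑ xs (length ∘ g)
  length-pairsOf []       g = refl
  length-pairsOf (x ∷ xs) g = trans (length-++ (map (x ,_) (g x)))
    (cong₂ _+_ (length-map (x ,_) (g x)) (length-pairsOf xs g))

  module _ {A B : Set} (_≟_ : (x y : B) → Dec (x ≡ y)) (f : A → B) (xs : List A) where

    fibre : B → List A
    fibre c = filter (λ x → f x ≟ c) xs

    values : List B
    values = deduplicate _≟_ (map f xs)

    values-unique : Unique values
    values-unique = UniqDec.deduplicate-! _≟_ (map f xs)

    ∈-values⁻ : ∀ {c} → c ∈ values → ∃ λ x → x ∈ xs × f x ≡ c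
    ∈-values⁻ c∈ with ∈-map⁻ f (∈-deduplicate⁻ _≟_ (map f xs) c∈)
    ... | x , x∈ , c≡ = x , x∈ , ≡.sym c≡

    ∈-values⁺ : ∀ {x} → x ∈ xs → f x ∈ values
    ∈-values⁺ x∈ = ∈-deduplicate⁺ _≟_ (∈-map⁺ f x∈)

    -- Double counting: the pairs of a value and a member of its fibre correspond one to one to
    -- `xs`.
    values-* : Unique xs → ∀ a → (∀ {x} → x ∈ xs → length (fibre (f x)) ≡ a) → length values * a ≡ length xs
    values-* ux a fibre≡a = trans (≡.sym lengthTotal) (≤-antisym
      (pigeonhole (λ p x → f x ≡ proj₁ p × proj₂ p ≡ x) {ys = xs}
        (pairsOf-unique values-unique (λ _ → Uniq.filter⁺ (λ x → f x ≟ _) ux))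
        (λ {p} p∈ → let (_ , x∈) = ∈-pairsOf⁻ values p∈ ; (x∈xs , fx≡) = ∈-filter⁻ (λ x → f x ≟ proj₁ p) {xs = xs} x∈ in
          proj₂ p , x∈xs , fx≡ , refl)
        (λ { _ _ (refl , refl) (refl , refl) → refl }))
      (pigeonhole (λ x p → x ≡ proj₂ p) {ys = pairsOf values fibre} ux
        (λ {x} x∈ → (f x , x) , ∈-pairsOf⁺ {g = fibre} (∈-values⁺ x∈) (∈-filter⁺ (λ y → f y ≟ f x) x∈ refl) , refl)
        (λ { _ _ refl refl → refl })))
      where
      lengthTotal : length (pairsOf values fibre) ≡ length values * a
      lengthTotal = trans (length-pairsOf values fibre) (go values (λ c∈ → c∈))
        where
        go : ∀ cs → (∀ {c} → c ∈ cs → c ∈ values) → ∑ cs (length ∘ fibre) ≡ length cs * a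
        go []       _   = refl
        go (c ∷ cs) sub with ∈-values⁻ (sub (here refl))
        ... | x , x∈ , refl = cong₂ _+_ (fibre≡a x∈) (go cs (sub ∘ there))

  -- The form in which copies are bounded from above: `f` is the image of an embedding, and `code`
  -- is any record of the embedding from which that image can be recovered.
  length-deduplicate-≤ : ∀ {A B C : Set} (_≟_ : (x y : B) → Dec (x ≡ y)) (f : A → B) (code : A → C) (xs : List A) (ys : List C) →
    (∀ {x} → x ∈ xs → code x ∈ ys) →
    (∀ {x y} → x ∈ xs → y ∈ xs → code x ≡ code y → f x ≡ f y) →
    length (deduplicate _≟_ (map f xs)) ≤ length ys
  length-deduplicate-≤ _≟_ f code xs ys code∈ determines = pigeonhole
    (λ b c → ∃ λ x → x ∈ xs × f x ≡ b × code x ≡ c)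
    (values-unique _≟_ f xs)
    (λ b∈ → let (x , x∈ , fx≡b) = ∈-values⁻ _≟_ f xs b∈ in code x , code∈ x∈ , x , x∈ , fx≡b , refl)
    (λ { _ _ (x , x∈ , refl , refl) (y , y∈ , refl , cy≡cx) → determines x∈ y∈ (≡.sym cy≡cx) })

  concatMap-unique : ∀ {A B : Set} {xs : List A} {g : A → List B} → Unique xs → (∀ x → Unique (g x)) →
    (∀ {x x′ y} → y ∈ g x → y ∈ g x′ → x ≡ x′) → Unique (concatMap g xs)
  concatMap-unique {xs = []} [] _ _ = []
  concatMap-unique {xs = z ∷ xs} {g} (z≢ ∷ ux) ug inj =
    Uniq.++⁺ (ug z) (concatMap-unique ux ug inj) disjoint
    where
    disjoint : ∀ {y} → y ∈ g z × y ∈ concatMap g xs → ⊥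
    disjoint (y∈ , y∈′) with find (∈-concatMap⁻ g {xs} y∈′)
    ... | x , x∈ , y∈gx = All.lookup z≢ x∈ (inj y∈ y∈gx)

  length-cartesianProductWith : ∀ {A B C : Set} (f : A → B → C) xs ys →
    length (cartesianProductWith f xs ys) ≡ length xs * length ys
  length-cartesianProductWith f []       ys = refl
  length-cartesianProductWith f (x ∷ xs) ys = trans (length-++ (map (f x) ys))
    (cong₂ _+_ (length-map (f x) ys) (length-cartesianProductWith f xs ys))

  ∑-map : ∀ {A B : Set} (h : A → B) (g : B → ℕ) xs → ∑ (map h xs) g ≡ ∑ xs (g ∘ h)
  ∑-map h g []       = refl
  ∑-map h g (x ∷ xs) = cong (g (h x) +_) (∑-map h g xs)

  ∑-++ : ∀ {A : Set} (xs ys : List A) (g : A → ℕ) → ∑ (xs ++ ys) g ≡ ∑ xs g + ∑ ys g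
  ∑-++ []       ys g = refl
  ∑-++ (x ∷ xs) ys g = trans (cong (g x +_) (∑-++ xs ys g)) (≡.sym (+-assoc (g x) _ _))

  ∑-⊆ : ∀ {A : Set} {xs ys : List A} (g : A → ℕ) → Unique xs → (∀ {x} → x ∈ xs → x ∈ ys) → ∑ xs g ≤ ∑ ys g
  ∑-⊆ {xs = []} g _ _ = z≤n
  ∑-⊆ {xs = x ∷ xs} g (x≢ ∷ uniq) sub with ∈-∃++ (sub (here refl))
  ... | as , bs , refl = begin
    g x + ∑ xs g             ≤⟨ +-monoʳ-≤ (g x) (∑-⊆ g uniq sub′) ⟩
    g x + ∑ (as ++ bs) g     ≡⟨ insert as ⟩
    ∑ (as ++ x ∷ bs) g       ∎
    where
    open ≤-Reasoning
    insert : ∀ cs → g x + ∑ (cs ++ bs) g ≡ ∑ (cs ++ x ∷ bs) g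
    insert []       = refl
    insert (c ∷ cs) = trans (≡.sym (+-assoc (g x) (g c) _)) (trans (cong (_+ ∑ (cs ++ bs) g) (+-comm (g x) (g c)))
      (trans (+-assoc (g c) (g x) _) (cong (g c +_) (insert cs))))
    sub′ : ∀ {z} → z ∈ xs → z ∈ as ++ bs
    sub′ z∈ with ∈-++⁻ as (sub (there z∈))
    ... | inj₁ z∈as         = ∈-++⁺ˡ z∈as
    ... | inj₂ (here refl)  = ⊥-elim (All.lookup x≢ z∈ refl)
    ... | inj₂ (there z∈bs) = ∈-++⁺ʳ as z∈bs

  ∑-pairsOf : ∀ {A B : Set} (xs : List A) (h : A → List B) (g : A → ℕ) →
    ∑ (pairsOf xs h) (g ∘ proj₁) ≡ ∑ xs (λ x → length (h x) * g x)
  ∑-pairsOf []       h g = refl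
  ∑-pairsOf (x ∷ xs) h g = trans (∑-++ (map (x ,_) (h x)) _ (g ∘ proj₁)) (cong₂ _+_
    (trans (∑-map (x ,_) (g ∘ proj₁) (h x)) (∑-const (h x) (g x)))
    (∑-pairsOf xs h g))

  ∑-concatMap : ∀ {A B : Set} (f : A → List B) (g : B → ℕ) xs → ∑ (concatMap f xs) g ≡ ∑ xs (λ x → ∑ (f x) g)
  ∑-concatMap f g []       = refl
  ∑-concatMap f g (x ∷ xs) = trans (∑-++ (f x) (concatMap f xs) g) (cong (∑ (f x) g +_) (∑-concatMap f g xs))

  ∑-tabulate : ∀ {A : Set} (f : Fin m → A) (g : A → ℕ) → ∑ (List.tabulate f) g ≡ Vec.sum (tabulate (g ∘ f))
  ∑-tabulate {zero}  f g = refl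
  ∑-tabulate {suc m} f g = cong (g (f zero) +_) (∑-tabulate (f ∘ suc) g)

  ∑-lookup : ∀ (s : Vec ℕ m) → ∑ (allFin m) (lookup s) ≡ Vec.sum s
  ∑-lookup s = trans (∑-tabulate id (lookup s)) (cong Vec.sum (VecP.tabulate∘lookup s))

  -- Twice the tail satisfies the same hypothesis with the same X, so by induction the tail is at
  -- most X, like the head.
  ∑-geometric : ∀ N (g : Fin N → ℕ) X → (∀ x → g x * 2 ^ toℕ x ≤ X) → ∑ (allFin N) g ≤ 2 * X
  ∑-geometric zero    g X _     = z≤n
  ∑-geometric (suc N) g X bound = begin
    g zero + ∑ (List.tabulate suc) g      ≤⟨ +-mono-≤ (≤-trans (≤-reflexive (≡.sym (*-identityʳ (g zero)))) (bound zero)) tail≤ ⟩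
    X + X                                 ≡⟨ cong (X +_) (+-identityʳ X) ⟨
    2 * X                                 ∎
    where
    open ≤-Reasoning
    tail≤ : ∑ (List.tabulate suc) g ≤ X
    tail≤ = *-cancelʳ-≤ _ _ 2 (begin
      ∑ (List.tabulate suc) g * 2                 ≡⟨ cong (_* 2) (trans (∑-tabulate suc g) (≡.sym (∑-tabulate id (g ∘ suc)))) ⟩
      ∑ (allFin N) (g ∘ suc) * 2                  ≡⟨ ∑-*ʳ (allFin N) (g ∘ suc) 2 ⟨
      ∑ (allFin N) (λ x → g (suc x) * 2)          ≤⟨ ∑-geometric N (λ x → g (suc x) * 2) X (λ x → ≤-trans (≤-reflexive (*-assoc (g (suc x)) 2 _)) (bound (suc x))) ⟩
      2 * X                                       ≡⟨ *-comm 2 X ⟩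
      X * 2                                       ∎)

  vec-ext : ∀ {A : Set} {xs ys : Vec A n} → (∀ i → lookup xs i ≡ lookup ys i) → xs ≡ ys
  vec-ext {xs = []}     {[]}     _  = refl
  vec-ext {xs = x ∷ xs} {y ∷ ys} eq = cong₂ _∷_ (eq zero) (vec-ext (eq ∘ suc))

  -- Natural number inequalities

  -- Bernoulli's inequality (1 - 1/(n+1))^m ≥ 1 - m/(n+1) without denominators, where r = n + 1 - m.
  bernoulli : ∀ n m r → m + r ≡ suc n → suc n ^ m * r ≤ n ^ m * suc n
  bernoulli n zero    r eq = *-monoʳ-≤ 1 (≤-reflexive eq)
  bernoulli n (suc m) r eq = begin
    suc n * suc n ^ m * r     ≡⟨ solve 3 (λ a b c → a :* b :* c := b :* (a :* c)) refl (suc n) (suc n ^ m) r ⟩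
    suc n ^ m * (suc n * r)   ≤⟨ *-monoʳ-≤ (suc n ^ m) cross ⟩
    suc n ^ m * (n * suc r)   ≡⟨ solve 3 (λ a b c → a :* (b :* c) := b :* (a :* c)) refl (suc n ^ m) n (suc r) ⟩
    n * (suc n ^ m * suc r)   ≤⟨ *-monoʳ-≤ n (bernoulli n m (suc r) (trans (+-suc m r) eq)) ⟩
    n * (n ^ m * suc n)       ≡⟨ *-assoc n (n ^ m) (suc n) ⟨
    n * n ^ m * suc n         ∎
    where
    open ≤-Reasoning
    open +-*-Solver
    r≤n : r ≤ n
    r≤n = ≤-trans (m≤n+m r m) (≤-reflexive (suc-injective eq))
    cross : suc n * r ≤ n * suc r
    cross = ≤-trans (+-monoˡ-≤ (n * r) r≤n) (≤-reflexive (≡.sym (*-suc n r)))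

  [1+n]^m≤2n^m : ∀ n m → m + m ≤ suc n → suc n ^ m ≤ 2 * n ^ m
  [1+n]^m≤2n^m n m m+m≤ = *-cancelʳ-≤ (suc n ^ m) (2 * n ^ m) (suc n) (begin
    suc n ^ m * suc n    ≤⟨ *-monoʳ-≤ (suc n ^ m) 1+n≤2r ⟩
    suc n ^ m * (2 * r)  ≡⟨ solve 2 (λ a b → a :* (con 2 :* b) := con 2 :* (a :* b)) refl (suc n ^ m) r ⟩
    2 * (suc n ^ m * r)  ≤⟨ *-monoʳ-≤ 2 (bernoulli n m r m+r≡) ⟩
    2 * (n ^ m * suc n)  ≡⟨ *-assoc 2 (n ^ m) (suc n) ⟨
    2 * n ^ m * suc n    ∎)
    where
    open ≤-Reasoning
    open +-*-Solver
    r : ℕ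
    r = suc n ∸ m
    m+r≡ : m + r ≡ suc n
    m+r≡ = m+[n∸m]≡n (≤-trans (m≤m+n m m) m+m≤)
    1+n≤2r : suc n ≤ 2 * r
    1+n≤2r = begin
      suc n        ≡⟨ m+r≡ ⟨
      m + r        ≤⟨ +-monoˡ-≤ r (+-cancelˡ-≤ m _ _ (≤-trans m+m≤ (≤-reflexive (≡.sym m+r≡)))) ⟩
      r + r        ≡⟨ cong (r +_) (+-identityʳ r) ⟨
      2 * r        ∎

  -- Replaces (1 + 1/n)^n < e. Bernoulli gives the factor 2 while m is at most (n+1)/2, so the
  -- exponent is cut into two halves.
  [1+n]^m≤4n^m : ∀ n m → m ≤ n → suc n ^ m ≤ 4 * n ^ m
  [1+n]^m≤4n^m n m m≤n = begin
    suc n ^ m                  ≡⟨ cong (suc n ^_) (⌊n/2⌋+⌈n/2⌉≡n m) ⟨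
    suc n ^ (h + h′)           ≡⟨ ^-distribˡ-+-* (suc n) h h′ ⟩
    suc n ^ h * suc n ^ h′     ≤⟨ *-mono-≤ ([1+n]^m≤2n^m n h h+h≤) ([1+n]^m≤2n^m n h′ h′+h′≤) ⟩
    2 * n ^ h * (2 * n ^ h′)   ≡⟨ solve 2 (λ a b → con 2 :* a :* (con 2 :* b) := con 4 :* (a :* b)) refl (n ^ h) (n ^ h′) ⟩
    4 * (n ^ h * n ^ h′)       ≡⟨ cong (4 *_) (^-distribˡ-+-* n h h′) ⟨
    4 * n ^ (h + h′)           ≡⟨ cong (λ k → 4 * n ^ k) (⌊n/2⌋+⌈n/2⌉≡n m) ⟩
    4 * n ^ m                  ∎
    where
    open ≤-Reasoning
    open +-*-Solver
    h h′ : ℕ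
    h  = ⌊ m /2⌋
    h′ = ⌈ m /2⌉
    h+h≤ : h + h ≤ suc n
    h+h≤ = ≤-trans (+-monoʳ-≤ h (⌊n/2⌋≤⌈n/2⌉ m)) (≤-trans (≤-reflexive (⌊n/2⌋+⌈n/2⌉≡n m)) (m≤n⇒m≤1+n m≤n))
    h′+h′≤ : h′ + h′ ≤ suc n
    h′+h′≤ = ≤-trans (+-monoʳ-≤ h′ (⌊n/2⌋≤⌈n/2⌉ (suc m))) (≤-trans (≤-reflexive (⌊n/2⌋+⌈n/2⌉≡n (suc m))) (s≤s m≤n))

  -- `_P′_` unfolds at its smallest factor; the induction on n needs the largest one split off.
  P′-shift : ∀ n m → suc n P′ suc m ≡ suc n * (n P′ m)
  P′-shift n zero    = refl
  P′-shift n (suc m) = begin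
    (n ∸ m) * (suc n P′ suc m)     ≡⟨ cong ((n ∸ m) *_) (P′-shift n m) ⟩
    (n ∸ m) * (suc n * (n P′ m))   ≡⟨ solve 3 (λ a b c → a :* (b :* c) := b :* (a :* c)) refl (n ∸ m) (suc n) (n P′ m) ⟩
    suc n * ((n ∸ m) * (n P′ m))   ∎
    where
    open ≡.≡-Reasoning
    open +-*-Solver

  nP′n≡n! : ∀ n → n P′ n ≡ n !
  nP′n≡n! zero    = refl
  nP′n≡n! (suc n) = trans (P′-shift n n) (cong (suc n *_) (nP′n≡n! n))

  -- Each factor split off the falling factorial lowers the base of the remaining power by one, at a
  -- cost of 4. For m = n it is the weak Stirling bound `n^n≤4^n*n!`.
  n^m≤4^m*nP′m : ∀ n m → m ≤ n → n ^ m ≤ 4 ^ m * (n P′ m)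
  n^m≤4^m*nP′m n       zero    _         = ≤-refl
  n^m≤4^m*nP′m (suc n) (suc m) (s≤s m≤n) = begin
    suc n * suc n ^ m                 ≤⟨ *-monoʳ-≤ (suc n) ([1+n]^m≤4n^m n m m≤n) ⟩
    suc n * (4 * n ^ m)               ≤⟨ *-monoʳ-≤ (suc n) (*-monoʳ-≤ 4 (n^m≤4^m*nP′m n m m≤n)) ⟩
    suc n * (4 * (4 ^ m * (n P′ m)))  ≡⟨ solve 3 (λ a b c → a :* (con 4 :* (b :* c)) := (con 4 :* b) :* (a :* c)) refl (suc n) (4 ^ m) (n P′ m) ⟩
    4 * 4 ^ m * (suc n * (n P′ m))    ≡⟨ cong (4 * 4 ^ m *_) (P′-shift n m) ⟨
    4 ^ suc m * (suc n P′ suc m)      ∎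
    where
    open ≤-Reasoning
    open +-*-Solver

  n^n≤4^n*n! : ∀ n → n ^ n ≤ 4 ^ n * n !
  n^n≤4^n*n! n = subst (λ k → n ^ n ≤ 4 ^ n * k) (nP′n≡n! n) (n^m≤4^m*nP′m n n ≤-refl)

  ^-cancelˡ-≤ : ∀ k x y → x ^ suc k ≤ y ^ suc k → x ≤ y
  ^-cancelˡ-≤ k x y le = ≮⇒≥ (λ y<x → <⇒≱ (^-monoˡ-< (suc k) y<x) le)

  -- The first two terms of the binomial expansion; they match the two summands in the recursion of
  -- `picks`.
  ^-first-terms : ∀ n s → n ^ suc s + suc s * n ^ s ≤ suc n ^ suc s
  ^-first-terms n zero    = ≤-reflexive (solve 1 (λ a → a :* con 1 :+ con 1 := (con 1 :+ a) :* con 1) refl n)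
    where open +-*-Solver
  ^-first-terms n (suc s) = begin
    n * n ^ suc s + suc (suc s) * n ^ suc s   ≤⟨ m≤m+n _ (suc s * n ^ s) ⟩
    n * n ^ suc s + suc (suc s) * n ^ suc s + suc s * n ^ s
      ≡⟨ solve 3 (λ a b c → a :* (a :* c) :+ (con 1 :+ b) :* (a :* c) :+ b :* c := (con 1 :+ a) :* (a :* c :+ b :* c)) refl n (suc s) (n ^ s) ⟩
    suc n * (n ^ suc s + suc s * n ^ s)       ≤⟨ *-monoʳ-≤ (suc n) (^-first-terms n s) ⟩
    suc n * suc n ^ suc s                     ∎
    where
    open ≤-Reasoning
    open +-*-Solver

  ^-*-distrib : ∀ x y k → (x * y) ^ k ≡ x ^ k * y ^ k
  ^-*-distrib x y zero    = refl
  ^-*-distrib x y (suc k) = trans (cong (x * y *_) (^-*-distrib x y k))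
    (solve 4 (λ a b c d → a :* b :* (c :* d) := a :* c :* (b :* d)) refl x y (x ^ k) (y ^ k))
    where open +-*-Solver

  n<2^n : ∀ n → n < 2 ^ n
  n<2^n zero    = s≤s z≤n
  n<2^n (suc n) = begin
    suc (suc n)      ≤⟨ s≤s (n<2^n n) ⟩
    suc (2 ^ n)      ≤⟨ +-monoˡ-≤ (2 ^ n) (m^n>0 2 n) ⟩
    2 ^ n + 2 ^ n    ≡⟨ cong (2 ^ n +_) (+-identityʳ (2 ^ n)) ⟨
    2 ^ suc n        ∎
    where open ≤-Reasoning

  -- Trees

  adj-sym : ∀ (G : Graph m) {x y} → T (adj G x y) → T (adj G y x)
  adj-sym G {x} {y} = subst T (sym G x y)

  adj-irr : ∀ (G : Graph m) {x} → ¬ T (adj G x x)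
  adj-irr G {x} = subst T (irr G x)

  edges : Graph m → List (Fin m × Fin m)
  edges {m} G = filter (λ p → T? (adj G (proj₁ p) (proj₂ p)))
    (filter (λ p → toℕ (proj₁ p) <? toℕ (proj₂ p)) (pairs m))

  ∈-pairs : ∀ (i j : Fin m) → (i , j) ∈ pairs m
  ∈-pairs i j = ∈-pairsOf⁺ (∈-allFin i) (∈-allFin j)

  pairs-unique : ∀ m → Unique (pairs m)
  pairs-unique m = pairsOf-unique (Uniq.allFin⁺ m) (λ _ → Uniq.allFin⁺ m)

  ∈-edges⁺ : ∀ (G : Graph m) {i j} → toℕ i < toℕ j → T (adj G i j) → (i , j) ∈ edges G
  ∈-edges⁺ G {i} {j} i<j ij = ∈-filter⁺ _ (∈-filter⁺ _ (∈-pairs i j) i<j) ij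

  ∈-edges⁻ : ∀ (G : Graph m) {i j} → (i , j) ∈ edges G → toℕ i < toℕ j × T (adj G i j)
  ∈-edges⁻ {m} G ij∈ with ∈-filter⁻ (λ p → T? (adj G (proj₁ p) (proj₂ p))) {xs = filter (λ p → toℕ (proj₁ p) <? toℕ (proj₂ p)) (pairs m)} ij∈
  ... | ij∈′ , ij = proj₂ (∈-filter⁻ (λ p → toℕ (proj₁ p) <? toℕ (proj₂ p)) {xs = pairs m} ij∈′) , ij

  edges-unique : ∀ (G : Graph m) → Unique (edges G)
  edges-unique {m} G = Uniq.filter⁺ _ (Uniq.filter⁺ _ (pairs-unique m))

  e≡length-edges : ∀ (G : Graph m) → e G ≡ length (edges G)
  e≡length-edges G = refl

  neighbours : Graph m → Fin m → List (Fin m)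
  neighbours {m} G x = filter (λ y → T? (adj G x y)) (allFin m)

  ∈-neighbours⁺ : ∀ (G : Graph m) {x y} → T (adj G x y) → y ∈ neighbours G x
  ∈-neighbours⁺ G {x} {y} xy = ∈-filter⁺ (λ z → T? (adj G x z)) (∈-allFin y) xy

  ∈-neighbours⁻ : ∀ (G : Graph m) {x y} → y ∈ neighbours G x → T (adj G x y)
  ∈-neighbours⁻ {m} G {x} y∈ = proj₂ (∈-filter⁻ (λ z → T? (adj G x z)) {xs = allFin m} y∈)

  neighbours-unique : ∀ (G : Graph m) x → Unique (neighbours G x)
  neighbours-unique {m} G x = Uniq.filter⁺ _ (Uniq.allFin⁺ m)

  -- The vertex list is an index so that, once an edge closes the path, `List.lookup` is the
  -- injective map demanded by `HasCycle`.
  data Path {m} (G : Graph m) : Fin m → List (Fin m) → Fin m → Set where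
    stop : ∀ {a} → Path G a [ a ] a
    cons : ∀ {a b c l} → T (adj G a c) → a ∉ l → Path G c l b → Path G a (a ∷ l) b

  path-snoc : ∀ {G : Graph m} {a b x l} → Path G a l b → T (adj G b x) → x ∉ l → Path G a (l ++ [ x ]) x
  path-snoc stop bx x∉ = cons bx (λ { (here refl) → x∉ (here refl) }) stop
  path-snoc {x = x} (cons {a} {l = l} ac a∉ p) bx x∉ = cons ac a∉′ (path-snoc p bx (x∉ ∘ there))
    where
    a∉′ : a ∉ l ++ [ x ]
    a∉′ a∈ with ∈-++⁻ l a∈
    ... | inj₁ a∈l         = a∉ a∈l
    ... | inj₂ (here refl) = x∉ (here refl)

  path-unique : ∀ {G : Graph m} {a b l} → Path G a l b → Unique l
  path-unique stop          = [] ∷ []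
  path-unique (cons _ a∉ p) = AllP.¬Any⇒All¬ _ a∉ ∷ path-unique p

  path-head : ∀ {G : Graph m} {a b x l} → Path G a (x ∷ l) b → x ≡ a
  path-head stop         = refl
  path-head (cons _ _ _) = refl

  path-last : ∀ {G : Graph m} {a b x l} → Path G a (x ∷ l) b → List.lookup (x ∷ l) (fromℕ (length l)) ≡ b
  path-last stop = refl
  path-last {l = _ ∷ _} (cons _ _ p) = path-last p

  path-step : ∀ {G : Graph m} {a b l} → Path G a l b → ∀ (i j : Fin (length l)) → suc (toℕ i) ≡ toℕ j →
    T (adj G (List.lookup l i) (List.lookup l j))
  path-step stop zero zero ()
  path-step {G = G} (cons {l = _ ∷ _} ac _ p) zero (suc zero) _ = subst (λ z → T (adj G _ z)) (≡.sym (path-head p)) ac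
  path-step (cons _ _ p) (suc i) (suc j) eq = path-step p i j (suc-injective eq)

  lookup-injective : ∀ {A : Set} {xs : List A} → Unique xs → ∀ {i j} → List.lookup xs i ≡ List.lookup xs j → i ≡ j
  lookup-injective (_ ∷ _)  {zero}  {zero}  _  = refl
  lookup-injective (x≢ ∷ _) {zero}  {suc j} eq = ⊥-elim (All.lookup x≢ (∈-lookup j) eq)
  lookup-injective (x≢ ∷ _) {suc i} {zero}  eq = ⊥-elim (All.lookup x≢ (∈-lookup i) (≡.sym eq))
  lookup-injective (_ ∷ u)  {suc i} {suc j} eq = cong suc (lookup-injective u eq)

  path⇒cycle : ∀ {G : Graph m} {a b x y z l} → Path G a (x ∷ y ∷ z ∷ l) b → T (adj G b a) → HasCycle G
  path⇒cycle {G = G} {x = x} {y} {z} {l} p ba = length l , List.lookup (x ∷ y ∷ z ∷ l) , lookup-injective (path-unique p) , path-step p ,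
    ≡.subst₂ (λ u w → T (adj G u w)) (≡.sym (path-last p)) (≡.sym (path-head p)) ba

  -- Orders in which a tree grows from r one leaf at a time, newest vertex first.
  data Grown {m} (G : Graph m) (r : Fin m) : List (Fin m) → Set where
    root : Grown G r [ r ]
    grow : ∀ {x p xs} → Grown G r xs → x ∉ xs → p ∈ xs → T (adj G p x) →
           (∀ {y} → y ∈ xs → T (adj G y x) → y ≡ p) → Grown G r (x ∷ xs)

  grown-unique : ∀ {G : Graph m} {r xs} → Grown G r xs → Unique xs
  grown-unique root              = [] ∷ []
  grown-unique (grow g x∉ _ _ _) = AllP.¬Any⇒All¬ _ x∉ ∷ grown-unique g

  root∈grown : ∀ {G : Graph m} {r xs} → Grown G r xs → r ∈ xs
  root∈grown root             = here refl
  root∈grown (grow g _ _ _ _) = there (root∈grown g)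

  path-between : ∀ {G : Graph m} {r xs a b} → Grown G r xs → a ∈ xs → b ∈ xs →
    ∃ λ l → Path G a l b × (∀ {z} → z ∈ l → z ∈ xs)
  path-between root (here refl) (here refl) = _ , stop , id
  path-between (grow g _ _ _ _) (here refl) (here refl) = _ , stop , λ { (here refl) → here refl }
  path-between {G = G} (grow g x∉ p∈ px _) (here refl) (there b∈) with path-between g p∈ b∈
  ... | l , path , sub = _ , cons (adj-sym G px) (x∉ ∘ sub) path , λ { (here refl) → here refl ; (there z∈) → there (sub z∈) }
  path-between {G = G} (grow g x∉ p∈ px _) (there a∈) (here refl) with path-between g a∈ p∈
  ... | l , path , sub = _ , path-snoc path px (x∉ ∘ sub) , λ z∈ → case ∈-++⁻ l z∈ of λ
    { (inj₁ z∈l) → there (sub z∈l) ; (inj₂ (here refl)) → here refl }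
  path-between (grow g _ _ _ _) (there a∈) (there b∈) with path-between g a∈ b∈
  ... | l , path , sub = l , path , there ∘ sub

  -- If x had two neighbours p and y in the grown part, the path from p to y inside that part would
  -- close to a cycle through x.
  unique-attachment : ∀ {G : Graph m} {r xs x p y} → Acyclic G → Grown G r xs → x ∉ xs →
    p ∈ xs → T (adj G p x) → y ∈ xs → T (adj G y x) → y ≡ p
  unique-attachment {G = G} {x = x} {p} {y} acyclic g x∉ p∈ px y∈ yx with y FinP.≟ p
  ... | yes y≡p = y≡p
  ... | no y≢p with path-between g p∈ y∈
  ...   | _ , stop , _ = ⊥-elim (y≢p refl)
  ...   | _ , cons pc p∉ stop , sub =
          ⊥-elim (acyclic (path⇒cycle {G = G} {a = x} {y} {x} {p} {y} {[]} (cons (adj-sym G px) (x∉ ∘ sub) (cons pc p∉ stop)) yx))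
  ...   | _ , cons pc p∉ (cons cd c∉ q) , sub =
          ⊥-elim (acyclic (path⇒cycle (cons (adj-sym G px) (x∉ ∘ sub) (cons pc p∉ (cons cd c∉ q))) yx))

  _∈?_ : ∀ (x : Fin m) (xs : List (Fin m)) → Dec (x ∈ xs)
  x ∈? xs = any? (x FinP.≟_) xs

  crossing : ∀ {G : Graph m} {xs a b} → Walk G a b → a ∈ xs → b ∉ xs →
    ∃ λ p → ∃ λ x → p ∈ xs × x ∉ xs × T (adj G p x)
  crossing here a∈ b∉ = ⊥-elim (b∉ a∈)
  crossing {xs = xs} (step {a} {c} ac w) a∈ b∉ with c ∈? xs
  ... | yes c∈ = crossing w c∈ b∉
  ... | no c∉  = a , c , a∈ , c∉ , ac

  -- Each new vertex costs one unit of fuel. With none left the list would hold more than m distinct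
  -- vertices. A missing vertex always yields a crossing edge, because the walk to it leaves the
  -- grown part somewhere.
  grow-fully : ∀ {G : Graph m} {r xs} → IsTree G → Grown G r xs → ∀ fuel → suc m ≤ fuel + length xs →
    ∃ λ ys → Grown G r ys × (∀ y → y ∈ ys)
  grow-fully _ g zero lt = ⊥-elim (<⇒≱ lt (unique⇒length≤ (grown-unique g)))
  grow-fully {r = r} {xs} tree@(_ , connected , acyclic) g (suc fuel) lt with FinP.all? (_∈? xs)
  ... | yes all∈ = xs , g , all∈
  ... | no ¬all∈ with FinP.¬∀⟶∃¬ _ _ (_∈? xs) ¬all∈
  ...   | y , y∉ with crossing (connected r y) (root∈grown g) y∉
  ...     | p , x , p∈ , x∉ , px = grow-fully tree
              (grow g x∉ p∈ px (unique-attachment acyclic g x∉ p∈ px)) fuel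
              (≤-trans lt (≤-reflexive (≡.sym (+-suc fuel _))))

  tree-order : ∀ {G : Graph m} → IsTree G → ∀ r → ∃ λ xs → Grown G r xs × (∀ y → y ∈ xs)
  tree-order {m} tree r = grow-fully tree root m (≤-reflexive (+-comm 1 m))

  spanning-length : ∀ {G : Graph m} {r xs} → Grown G r xs → (∀ y → y ∈ xs) → length xs ≡ m
  spanning-length g all∈ =
    trans (unique-⇔⇒length≡ (grown-unique g) (Uniq.allFin⁺ _) (λ {x} _ → ∈-allFin x) (λ {x} _ → all∈ x)) (length-allFin _)

  links : ∀ {G : Graph m} {r xs} → Grown G r xs → List (Fin m × Fin m)
  links root                     = []
  links (grow {x} {p} g _ _ _ _) = (x , p) ∷ links g

  length-links : ∀ {G : Graph m} {r xs} (g : Grown G r xs) → length xs ≡ suc (length (links g))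
  length-links root             = refl
  length-links (grow g _ _ _ _) = cong suc (length-links g)

  links⊆ : ∀ {G : Graph m} {r xs} (g : Grown G r xs) {x p} → (x , p) ∈ links g → x ∈ xs × p ∈ xs
  links⊆ (grow g _ p∈ _ _) (here refl) = here refl , there p∈
  links⊆ (grow g _ _ _ _)  (there q∈)  = let (x∈ , p∈) = links⊆ g q∈ in there x∈ , there p∈

  links-unique : ∀ {G : Graph m} {r xs} (g : Grown G r xs) → Unique (links g)
  links-unique root = []
  links-unique (grow g x∉ _ _ _) = All.tabulate (λ { q∈ refl → x∉ (proj₁ (links⊆ g q∈)) }) ∷ links-unique g

  links-adj : ∀ {G : Graph m} {r xs} (g : Grown G r xs) {x p} → (x , p) ∈ links g → T (adj G p x)
  links-adj (grow g _ _ px _) (here refl) = px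
  links-adj (grow g _ _ _ _)  (there q∈)  = links-adj g q∈

  links-asym : ∀ {G : Graph m} {r xs} (g : Grown G r xs) {x p} → (x , p) ∈ links g → (p , x) ∉ links g
  links-asym (grow g x∉ p∈ _ _) (here refl) (here refl) = x∉ p∈
  links-asym (grow g x∉ p∈ _ _) (here refl) (there q∈)  = x∉ (proj₂ (links⊆ g q∈))
  links-asym (grow g x∉ p∈ _ _) (there q∈)  (here refl) = x∉ (proj₂ (links⊆ g q∈))
  links-asym (grow g x∉ p∈ _ _) (there q∈)  (there q∈′) = links-asym g q∈ q∈′

  links-complete : ∀ {G : Graph m} {r xs} (g : Grown G r xs) {x y} → x ∈ xs → y ∈ xs → T (adj G x y) →
    (x , y) ∈ links g ⊎ (y , x) ∈ links g
  links-complete {G = G} root (here refl) (here refl) xy = ⊥-elim (adj-irr G xy)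
  links-complete {G = G} (grow g _ _ _ _) (here refl) (here refl) xy = ⊥-elim (adj-irr G xy)
  links-complete {G = G} (grow g _ _ _ only) (here refl) (there y∈) xy with only y∈ (adj-sym G xy)
  ... | refl = inj₁ (here refl)
  links-complete (grow g _ _ _ only) (there x∈) (here refl) xy with only x∈ xy
  ... | refl = inj₂ (here refl)
  links-complete (grow g _ _ _ _) (there x∈) (there y∈) xy with links-complete g x∈ y∈ xy
  ... | inj₁ q∈ = inj₁ (there q∈)
  ... | inj₂ q∈ = inj₂ (there q∈)

  SamePair : ∀ {A : Set} → A × A → A × A → Set
  SamePair p q = p ≡ q ⊎ p ≡ (proj₂ q , proj₁ q)

  -- `edges` and `links` both record every edge exactly once, the former directed by vertex index,
  -- the latter from child to parent; so they match up to reversal, and there is one link for each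
  -- vertex but the root.
  e-tree : ∀ {F : Graph (suc m)} → IsTree F → e F ≡ m
  e-tree {m} {F} tree with tree-order tree zero
  ... | xs , g , all∈ = trans (≤-antisym
      (pigeonhole SamePair {ys = links g} (edges-unique F) toLink
        (λ p∈ q∈ → λ
          { (inj₁ refl) (inj₁ refl) → refl
          ; (inj₁ refl) (inj₂ refl) → ⊥-elim (<-asym (proj₁ (∈-edges⁻ F p∈)) (proj₁ (∈-edges⁻ F q∈)))
          ; (inj₂ refl) (inj₁ refl) → ⊥-elim (<-asym (proj₁ (∈-edges⁻ F p∈)) (proj₁ (∈-edges⁻ F q∈)))
          ; (inj₂ refl) (inj₂ refl) → refl }))
      (pigeonhole SamePair {ys = edges F} (links-unique g) toEdge
        (λ p∈ q∈ → λ
          { (inj₁ refl) (inj₁ refl) → refl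
          ; (inj₁ refl) (inj₂ refl) → ⊥-elim (links-asym g p∈ q∈)
          ; (inj₂ refl) (inj₁ refl) → ⊥-elim (links-asym g p∈ q∈)
          ; (inj₂ refl) (inj₂ refl) → refl })))
      (suc-injective (trans (≡.sym (length-links g)) (spanning-length g all∈)))
    where
    toLink : ∀ {p} → p ∈ edges F → ∃ λ q → q ∈ links g × SamePair p q
    toLink {i , j} p∈ with links-complete g (all∈ i) (all∈ j) (proj₂ (∈-edges⁻ F p∈))
    ... | inj₁ q∈ = _ , q∈ , inj₁ refl
    ... | inj₂ q∈ = _ , q∈ , inj₂ refl
    toEdge : ∀ {p} → p ∈ links g → ∃ λ q → q ∈ edges F × SamePair p q
    toEdge {x , p} q∈ with <-cmp (toℕ x) (toℕ p)
    ... | tri< x<p _ _ = _ , ∈-edges⁺ F x<p (adj-sym F (links-adj g q∈)) , inj₁ refl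
    ... | tri≈ _ x≡p _ = ⊥-elim (adj-irr F (subst (λ z → T (adj F p z)) (FinP.toℕ-injective x≡p) (links-adj g q∈)))
    ... | tri> _ _ p<x = _ , ∈-edges⁺ F p<x (links-adj g q∈) , inj₂ refl

  -- Embeddings and copies

  T-ext : ∀ {x y} → (T x → T y) → (T y → T x) → x ≡ y
  T-ext {false} {false} _ _ = refl
  T-ext {true}  {true}  _ _ = refl
  T-ext {false} {true}  _ g = ⊥-elim (g tt)
  T-ext {true}  {false} f _ = ⊥-elim (f tt)

  ∈-allMaps : ∀ (f : Vec (Fin n) m) → f ∈ allMaps n m
  ∈-allMaps []       = here refl
  ∈-allMaps {n} {suc m} (x ∷ f) = ∈-concatMap⁺ (λ y → map (y ∷_) (allMaps n m))
    (lose (∈-allFin x) (∈-map⁺ (x ∷_) (∈-allMaps f)))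

  allMaps-unique : ∀ n m → Unique (allMaps n m)
  allMaps-unique n zero    = [] ∷ []
  allMaps-unique n (suc m) = concatMap-unique (Uniq.allFin⁺ n)
    (λ x → Uniq.map⁺ VecP.∷-injectiveʳ (allMaps-unique n m)) sameHead
    where
    sameHead : ∀ {x x′ : Fin n} {f} → f ∈ map (x ∷_) (allMaps n m) → f ∈ map (x′ ∷_) (allMaps n m) → x ≡ x′
    sameHead {x} {x′} f∈ f∈′ with ∈-map⁻ (x ∷_) f∈ | ∈-map⁻ (x′ ∷_) f∈′
    ... | _ , _ , refl | _ , _ , eq = VecP.∷-injectiveˡ eq

  record Embedding {m n} (J : Graph m) (G : Graph n) (f : Vec (Fin n) m) : Set where
    constructor mkEmbedding
    field
      injective : ∀ {i j} → lookup f i ≡ lookup f j → i ≡ j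
      edge      : ∀ {i j} → T (adj J i j) → T (adj G (lookup f i) (lookup f j))
  open Embedding

  private
    →⇒T : ∀ x y → (T x → T y) → T (not x ∨ y)
    →⇒T false y _ = tt
    →⇒T true  y f = f tt

    T⇒→ : ∀ x y → T (not x ∨ y) → T x → T y
    T⇒→ true y t _ = t

    ←⇒T : ∀ {P R : Set} (p : Dec P) (r : Dec R) → (R → P) → T (does p ∨ not (does r))
    ←⇒T (yes _) _       _ = tt
    ←⇒T (no _)  (no _)  _ = tt
    ←⇒T (no ¬p) (yes r) f = ⊥-elim (¬p (f r))

    T⇒← : ∀ {P R : Set} (p : Dec P) (r : Dec R) → T (does p ∨ not (does r)) → R → P
    T⇒← (yes p) _      _ _ = p
    T⇒← (no _)  (no ¬r) _ r = ⊥-elim (¬r r)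

    does⇒ : ∀ {P : Set} (p : Dec P) → T (does p) → P
    does⇒ (yes p) _ = p

    ⇒does : ∀ {P : Set} (p : Dec P) → P → T (does p)
    ⇒does (yes _) _ = tt
    ⇒does (no ¬p) p = ¬p p

  isEmbedding⇒ : ∀ (J : Graph m) (G : Graph n) f → T (isEmbedding J G f) → Embedding J G f
  isEmbedding⇒ {m} J G f t = mkEmbedding
    (λ {i} {j} → T⇒← (i FinP.≟ j) (lookup f i FinP.≟ lookup f j) (proj₁ (at i j)))
    (λ {i} {j} → T⇒→ (adj J i j) (adj G (lookup f i) (lookup f j)) (proj₂ (at i j)))
    where
    at : ∀ i j → T (does (i FinP.≟ j) ∨ not (does (lookup f i FinP.≟ lookup f j))) ×
                 T (not (adj J i j) ∨ adj G (lookup f i) (lookup f j))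
    at i j = Equivalence.to T-∧ (All.lookup (AllP.all⁺ _ (pairs m) t) (∈-pairs i j))

  ⇒isEmbedding : ∀ (J : Graph m) (G : Graph n) f → Embedding J G f → T (isEmbedding J G f)
  ⇒isEmbedding {m} J G f emb = AllP.all⁻ _ (All.tabulate {xs = pairs m} λ {p} _ → at (proj₁ p) (proj₂ p))
    where
    at : ∀ i j → T ((does (i FinP.≟ j) ∨ not (does (lookup f i FinP.≟ lookup f j))) ∧
                    (not (adj J i j) ∨ adj G (lookup f i) (lookup f j)))
    at i j = Equivalence.from T-∧
      (←⇒T (i FinP.≟ j) (lookup f i FinP.≟ lookup f j) (injective emb) , →⇒T _ _ (edge emb))

  embeddings : Graph m → Graph n → List (Vec (Fin n) m)
  embeddings {m} {n} J G = filter (λ f → T? (isEmbedding J G f)) (allMaps n m)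

  ∈-embeddings⁺ : ∀ {J : Graph m} {G : Graph n} {f} → Embedding J G f → f ∈ embeddings J G
  ∈-embeddings⁺ {J = J} {G} {f} emb = ∈-filter⁺ (λ g → T? (isEmbedding J G g)) (∈-allMaps f) (⇒isEmbedding J G f emb)

  ∈-embeddings⁻ : ∀ {J : Graph m} {G : Graph n} {f} → f ∈ embeddings J G → Embedding J G f
  ∈-embeddings⁻ {m} {n} {J} {G} {f} f∈ =
    isEmbedding⇒ J G f (proj₂ (∈-filter⁻ (λ g → T? (isEmbedding J G g)) {xs = allMaps n m} f∈))

  embeddings-unique : ∀ (J : Graph m) (G : Graph n) → Unique (embeddings J G)
  embeddings-unique J G = Uniq.filter⁺ _ (allMaps-unique _ _)

  Covers : Vec (Fin n) m → Fin n → Set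
  Covers f x = ∃ λ i → lookup f i ≡ x

  CoversEdge : Graph m → Vec (Fin n) m → Fin n → Fin n → Set
  CoversEdge J f x y = ∃ λ i → ∃ λ j → T (adj J i j) × lookup f i ≡ x × lookup f j ≡ y

  private
    vertexBit : Vec (Fin n) m → Fin n → Bool
    vertexBit {m = m} f x = any (λ i → does (lookup f i FinP.≟ x)) (allFin m)

    vertexBit⇒ : ∀ (f : Vec (Fin n) m) x → T (vertexBit f x) → Covers f x
    vertexBit⇒ {m = m} f x t with find (AnyP.any⁻ _ (allFin m) t)
    ... | i , _ , fi = i , does⇒ (lookup f i FinP.≟ x) fi

    ⇒vertexBit : ∀ (f : Vec (Fin n) m) x → Covers f x → T (vertexBit f x)
    ⇒vertexBit f x (i , fi) = AnyP.any⁺ _ (lose (∈-allFin i) (⇒does (lookup f i FinP.≟ x) fi))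

    edgeBit : Graph m → Vec (Fin n) m → Fin n → Fin n → Bool
    edgeBit J f x y = lookup (lookup (proj₂ (image J f)) x) y

    edgeBit≡ : ∀ (J : Graph m) (f : Vec (Fin n) m) x y → edgeBit J f x y ≡
      any (λ p → adj J (proj₁ p) (proj₂ p) ∧ (does (lookup f (proj₁ p) FinP.≟ x) ∧ does (lookup f (proj₂ p) FinP.≟ y))) (pairs m)
    edgeBit≡ J f x y = trans (cong (λ r → lookup r y) (VecP.lookup∘tabulate _ x)) (VecP.lookup∘tabulate _ y)

    edgeBit⇒ : ∀ (J : Graph m) (f : Vec (Fin n) m) x y → T (edgeBit J f x y) → CoversEdge J f x y
    edgeBit⇒ {m} J f x y t with find (AnyP.any⁻ _ (pairs m) (subst T (edgeBit≡ J f x y) t))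
    ... | (i , j) , _ , bits with Equivalence.to T-∧ bits
    ...   | ij , bits′ with Equivalence.to T-∧ bits′
    ...     | fi , fj = i , j , ij , does⇒ (lookup f i FinP.≟ x) fi , does⇒ (lookup f j FinP.≟ y) fj

    ⇒edgeBit : ∀ (J : Graph m) (f : Vec (Fin n) m) x y → CoversEdge J f x y → T (edgeBit J f x y)
    ⇒edgeBit J f x y (i , j , ij , fi , fj) = subst T (≡.sym (edgeBit≡ J f x y)) (AnyP.any⁺ _
      (lose (∈-pairs i j) (Equivalence.from T-∧ (ij , Equivalence.from T-∧
        (⇒does (lookup f i FinP.≟ x) fi , ⇒does (lookup f j FinP.≟ y) fj)))))

  image-vertices : ∀ {J : Graph m} {f g : Vec (Fin n) m} → image J f ≡ image J g → ∀ {x} → Covers f x → Covers g x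
  image-vertices {J = J} {f} {g} eq {x} c = vertexBit⇒ g x (subst T bit≡ (⇒vertexBit f x c))
    where
    bit≡ : vertexBit f x ≡ vertexBit g x
    bit≡ = trans (≡.sym (VecP.lookup∘tabulate _ x)) (trans (cong (λ s → lookup (proj₁ s) x) eq) (VecP.lookup∘tabulate _ x))

  image-edges : ∀ {J : Graph m} {f g : Vec (Fin n) m} → image J f ≡ image J g →
    ∀ {x y} → CoversEdge J f x y → CoversEdge J g x y
  image-edges {J = J} {f} {g} eq {x} {y} c =
    edgeBit⇒ J g x y (subst T (cong (λ s → lookup (lookup (proj₂ s) x) y) eq) (⇒edgeBit J f x y c))

  image-ext : ∀ {J : Graph m} {f g : Vec (Fin n) m} →
    (∀ {x} → Covers f x → Covers g x) → (∀ {x} → Covers g x → Covers f x) →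
    (∀ {x y} → CoversEdge J f x y → CoversEdge J g x y) → (∀ {x y} → CoversEdge J g x y → CoversEdge J f x y) →
    image J f ≡ image J g
  image-ext {J = J} {f} {g} v⊆ v⊇ e⊆ e⊇ = cong₂ _,_
    (VecP.tabulate-cong λ x → T-ext (⇒vertexBit g x ∘ v⊆ ∘ vertexBit⇒ f x) (⇒vertexBit f x ∘ v⊇ ∘ vertexBit⇒ g x))
    (vec-ext λ x → vec-ext λ y → T-ext (⇒edgeBit J g x y ∘ e⊆ ∘ edgeBit⇒ J f x y) (⇒edgeBit J f x y ∘ e⊇ ∘ edgeBit⇒ J g x y))

  idVec : Vec (Fin m) m
  idVec = tabulate id

  -- The number of automorphisms, written as the fibre of `image` over the identity so that it has
  -- the shape of the fibres it is compared with.
  aut : Graph m → ℕ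
  aut J = length (fibre subgraph-≟ (image J) (embeddings J J) (image J idVec))

  module _ {m n} (J : Graph m) (G : Graph n) where

    private
      fibreOf : Vec (Fin n) m → List (Vec (Fin n) m)
      fibreOf g₀ = fibre subgraph-≟ (image J) (embeddings J G) (image J g₀)

      automorphisms : List (Vec (Fin m) m)
      automorphisms = fibre subgraph-≟ (image J) (embeddings J J) (image J idVec)

      ∈-auts⁻ : ∀ {α} → α ∈ automorphisms → Embedding J J α × image J α ≡ image J idVec
      ∈-auts⁻ α∈ = let (α∈′ , eq) = ∈-filter⁻ (λ f → subgraph-≟ (image J f) (image J idVec)) {xs = embeddings J J} α∈ in
        ∈-embeddings⁻ α∈′ , eq

      ∈-fibre⁻ : ∀ {g₀ g} → g ∈ fibreOf g₀ → Embedding J G g × image J g ≡ image J g₀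
      ∈-fibre⁻ {g₀} g∈ = let (g∈′ , eq) = ∈-filter⁻ (λ f → subgraph-≟ (image J f) (image J g₀)) {xs = embeddings J G} g∈ in
        ∈-embeddings⁻ g∈′ , eq

      lookup-id : ∀ (i : Fin m) → lookup idVec i ≡ i
      lookup-id = VecP.lookup∘tabulate id

    -- The embeddings with a given image are the composites of one of them with the automorphisms of J.
    module _ {g₀ : Vec (Fin n) m} (emb₀ : Embedding J G g₀) where

      private
        Composite : Vec (Fin m) m → Vec (Fin n) m → Set
        Composite α g = ∀ i → lookup g i ≡ lookup g₀ (lookup α i)

        compose : ∀ {α} → α ∈ automorphisms → ∃ λ g → g ∈ fibreOf g₀ × Composite α g
        compose {α} α∈ with ∈-auts⁻ α∈
        ... | embα , imα = g , ∈-filter⁺ (λ f → subgraph-≟ (image J f) (image J g₀))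
            (∈-embeddings⁺ embg) (image-ext {J = J} {g} {g₀} v⊆ v⊇ e⊆ e⊇) , at
          where
          g : Vec (Fin n) m
          g = Vec.map (lookup g₀) α
          at : Composite α g
          at i = VecP.lookup-map i (lookup g₀) α
          embg : Embedding J G g
          embg = mkEmbedding
            (λ {i} {j} eq → injective embα (injective emb₀ (trans (≡.sym (at i)) (trans eq (at j)))))
            (λ {i} {j} ij → ≡.subst₂ (λ x y → T (adj G x y)) (≡.sym (at i)) (≡.sym (at j)) (edge emb₀ (edge embα ij)))
          v⊆ : ∀ {x} → Covers g x → Covers g₀ x
          v⊆ (i , refl) = lookup α i , ≡.sym (at i)
          v⊇ : ∀ {x} → Covers g₀ x → Covers g x
          v⊇ (i , refl) with image-vertices {J = J} {idVec} {α} (≡.sym imα) (i , lookup-id i)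
          ... | i′ , refl = i′ , at i′
          e⊆ : ∀ {x y} → CoversEdge J g x y → CoversEdge J g₀ x y
          e⊆ (i , j , ij , refl , refl) = lookup α i , lookup α j , edge embα ij , ≡.sym (at i) , ≡.sym (at j)
          e⊇ : ∀ {x y} → CoversEdge J g₀ x y → CoversEdge J g x y
          e⊇ (i , j , ij , refl , refl) with image-edges {J = J} {idVec} {α} (≡.sym imα) (i , j , ij , lookup-id i , lookup-id j)
          ... | i′ , j′ , ij′ , refl , refl = i′ , j′ , ij′ , at i′ , at j′

        factor : ∀ {g} → g ∈ fibreOf g₀ → ∃ λ α → α ∈ automorphisms × Composite α g
        factor {g} g∈ with ∈-fibre⁻ {g₀} g∈
        ... | embg , img = α , ∈-filter⁺ (λ f → subgraph-≟ (image J f) (image J idVec))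
            (∈-embeddings⁺ embα) (image-ext {J = J} {α} {idVec} (λ {x} _ → x , lookup-id x) v⊇ e⊆ e⊇) , λ i → ≡.sym (at i)
          where
          -- The automorphism sends i to the vertex that `g₀` places where `g` places i.
          position : ∀ i → Covers g₀ (lookup g i)
          position i = image-vertices {J = J} {g} {g₀} img (i , refl)
          α : Vec (Fin m) m
          α = tabulate (proj₁ ∘ position)
          at : ∀ i → lookup g₀ (lookup α i) ≡ lookup g i
          at i = trans (cong (lookup g₀) (VecP.lookup∘tabulate (proj₁ ∘ position) i)) (proj₂ (position i))
          back : ∀ {i x} → lookup g i ≡ lookup g₀ x → lookup α i ≡ x
          back {i} eq = injective emb₀ (trans (at i) eq)
          embα : Embedding J J α
          embα = mkEmbedding
            (λ {i} {j} eq → injective embg (trans (≡.sym (at i)) (trans (cong (lookup g₀) eq) (at j))))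
            (λ {i} {j} ij → case image-edges {J = J} {g} {g₀} img (i , j , ij , refl , refl) of λ
              { (i′ , j′ , ij′ , i≡ , j≡) → ≡.subst₂ (λ x y → T (adj J x y)) (≡.sym (back (≡.sym i≡))) (≡.sym (back (≡.sym j≡))) ij′ })
          v⊇ : ∀ {x} → Covers idVec x → Covers α x
          v⊇ {x} _ with image-vertices {J = J} {g₀} {g} (≡.sym img) (x , refl)
          ... | i , eq = i , back eq
          e⊆ : ∀ {x y} → CoversEdge J α x y → CoversEdge J idVec x y
          e⊆ {x} {y} (i , j , ij , refl , refl) = x , y , edge embα ij , lookup-id x , lookup-id y
          e⊇ : ∀ {x y} → CoversEdge J idVec x y → CoversEdge J α x y
          e⊇ (i , j , ij , refl , refl) with image-edges {J = J} {g₀} {g} (≡.sym img) (i , j , ij , refl , refl)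
          ... | i′ , j′ , ij′ , i≡ , j≡ = i′ , j′ , ij′ , trans (back i≡) (≡.sym (lookup-id i)) , trans (back j≡) (≡.sym (lookup-id j))

      length-fibre : length (fibreOf g₀) ≡ aut J
      length-fibre = ≤-antisym
        (pigeonhole (λ g α → Composite α g) {ys = automorphisms} (Uniq.filter⁺ _ (embeddings-unique J G)) factor
          (λ _ _ c c′ → vec-ext λ i → trans (c i) (≡.sym (c′ i))))
        (pigeonhole Composite {ys = fibreOf g₀} (Uniq.filter⁺ _ (embeddings-unique J J)) compose
          (λ _ _ c c′ → vec-ext λ i → injective emb₀ (trans (≡.sym (c i)) (c′ i))))

    -- Reduces copies to embeddings. The factor `aut J` does not depend on the host, so it cancels
    -- when `H` is compared with `K n`.
    N*aut : N G J * aut J ≡ length (embeddings J G)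
    N*aut = values-* subgraph-≟ (image J) (embeddings J G) (embeddings-unique J G) (aut J)
      (λ g∈ → length-fibre (∈-embeddings⁻ g∈))

  -- Embeddings into the complete graph

  injections : ∀ n m → List (Vec (Fin n) m)
  injections n zero    = [ [] ]
  injections n (suc m) = map (λ p → proj₂ p ∷ proj₁ p)
    (pairsOf (injections n m) (λ xs → filter (λ x → ¬? (any? (x FinP.≟_) (Vec.toList xs))) (allFin n)))

  injections-unique : ∀ n m → Unique (injections n m)
  injections-unique n zero    = [] ∷ []
  injections-unique n (suc m) = Uniq.map⁺ (λ { refl → refl })
    (pairsOf-unique (injections-unique n m) (λ _ → Uniq.filter⁺ _ (Uniq.allFin⁺ n)))

  lookup∈toList : ∀ {A : Set} (xs : Vec A m) i → lookup xs i ∈ Vec.toList xs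
  lookup∈toList (x ∷ xs) zero    = here refl
  lookup∈toList (x ∷ xs) (suc i) = there (lookup∈toList xs i)

  ∈-injections : ∀ n m {f} → f ∈ injections n m → ∀ {i j} → lookup f i ≡ lookup f j → i ≡ j
  ∈-injections n (suc m) f∈ with ∈-map⁻ _ f∈
  ... | (xs , x) , p∈ , refl with ∈-pairsOf⁻ (injections n m) p∈
  ...   | xs∈ , x∈ = inj
    where
    x∉ : x ∉ Vec.toList xs
    x∉ = proj₂ (∈-filter⁻ (λ y → ¬? (any? (y FinP.≟_) (Vec.toList xs))) {xs = allFin n} x∈)
    inj : ∀ {i j} → lookup (x ∷ xs) i ≡ lookup (x ∷ xs) j → i ≡ j
    inj {zero}  {zero}  _  = refl
    inj {zero}  {suc j} eq = ⊥-elim (x∉ (subst (_∈ Vec.toList xs) (≡.sym eq) (lookup∈toList xs j)))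
    inj {suc i} {zero}  eq = ⊥-elim (x∉ (subst (_∈ Vec.toList xs) eq (lookup∈toList xs i)))
    inj {suc i} {suc j} eq = cong suc (∈-injections n m xs∈ eq)

  length-injections : ∀ n m → n P′ m ≤ length (injections n m)
  length-injections n zero    = ≤-refl
  length-injections n (suc m) = begin
    (n ∸ m) * (n P′ m)                         ≡⟨ *-comm (n ∸ m) (n P′ m) ⟩
    (n P′ m) * (n ∸ m)                         ≤⟨ *-monoˡ-≤ (n ∸ m) (length-injections n m) ⟩
    length (injections n m) * (n ∸ m)          ≡⟨ ∑-const (injections n m) (n ∸ m) ⟨
    ∑ (injections n m) (λ _ → n ∸ m)           ≤⟨ ∑-mono (injections n m) (λ {xs} _ → fresh-many xs) ⟩
    ∑ (injections n m) (length ∘ fresh)        ≡⟨ length-pairsOf (injections n m) fresh ⟨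
    length (pairsOf (injections n m) fresh)    ≡⟨ length-map _ (pairsOf (injections n m) fresh) ⟨
    length (injections n (suc m))              ∎
    where
    open ≤-Reasoning
    fresh : Vec (Fin n) m → List (Fin n)
    fresh xs = filter (λ x → ¬? (any? (x FinP.≟_) (Vec.toList xs))) (allFin n)
    fresh-many : ∀ xs → n ∸ m ≤ length (fresh xs)
    fresh-many xs = m≤n+o⇒m∸n≤o n m (begin
      n                                            ≡⟨ length-allFin n ⟨
      length (allFin n)                            ≤⟨ unique-⊆⇒length≤ (Uniq.allFin⁺ n) split ⟩
      length (Vec.toList xs ++ fresh xs)           ≡⟨ length-++ (Vec.toList xs) ⟩
      length (Vec.toList xs) + length (fresh xs)   ≡⟨ cong (_+ length (fresh xs)) (VecP.length-toList xs) ⟩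
      m + length (fresh xs)                        ∎)
      where
      split : ∀ {x} → x ∈ allFin n → x ∈ Vec.toList xs ++ fresh xs
      split {x} x∈ with any? (x FinP.≟_) (Vec.toList xs)
      ... | yes x∈xs = ∈-++⁺ˡ x∈xs
      ... | no x∉xs  = ∈-++⁺ʳ (Vec.toList xs) (∈-filter⁺ (λ y → ¬? (any? (y FinP.≟_) (Vec.toList xs))) x∈ x∉xs)

  embeddings-complete : ∀ (J : Graph m) → n P′ m ≤ length (embeddings J (K n))
  embeddings-complete {m} {n} J = ≤-trans (length-injections n m)
    (unique-⊆⇒length≤ {ys = embeddings J (K n)} (injections-unique n m) λ f∈ → ∈-embeddings⁺ {J = J} {K n} (mkEmbedding (∈-injections n m f∈)
      (λ {i} {j} ij → distinct (λ eq → adj-irr J (subst (λ z → T (adj J i z)) (≡.sym (∈-injections n m f∈ eq)) ij)))))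
    where
    distinct : ∀ {x y : Fin n} → x ≢ y → T (adj (K n) x y)
    distinct {x} {y} x≢y with x FinP.≟ y
    ... | yes x≡y = x≢y x≡y
    ... | no _    = tt

  -- Counting embeddings of a tree with prescribed degrees

  -- A vertex is the parent in at most Δ links, since its children are distinct neighbours. This is
  -- where the maximum degree of F enters the count.
  parent-sum≤ : ∀ {F : Graph m} {Δ} → (∀ x → deg F x ≤ Δ) → ∀ {r xs} (g : Grown F r xs) (κ : Fin m → ℕ) →
    ∑ (links g) (κ ∘ proj₂) ≤ Δ * ∑ (allFin m) κ
  parent-sum≤ {m} {F} {Δ} deg≤ g κ = begin
    ∑ (links g) (κ ∘ proj₂)                                ≡⟨ ∑-map flip (κ ∘ proj₁) (links g) ⟨
    ∑ (map flip (links g)) (κ ∘ proj₁)                     ≤⟨ ∑-⊆ (κ ∘ proj₁) (Uniq.map⁺ (λ { refl → refl }) (links-unique g)) sub ⟩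
    ∑ (pairsOf (allFin m) (neighbours F)) (κ ∘ proj₁)      ≡⟨ ∑-pairsOf (allFin m) (neighbours F) κ ⟩
    ∑ (allFin m) (λ x → deg F x * κ x)                     ≤⟨ ∑-mono (allFin m) (λ {x} _ → *-monoˡ-≤ (κ x) (deg≤ x)) ⟩
    ∑ (allFin m) (λ x → Δ * κ x)                           ≡⟨ ∑-cong (allFin m) (λ x → *-comm Δ (κ x)) ⟩
    ∑ (allFin m) (λ x → κ x * Δ)                           ≡⟨ ∑-*ʳ (allFin m) κ Δ ⟩
    ∑ (allFin m) κ * Δ                                     ≡⟨ *-comm _ Δ ⟩
    Δ * ∑ (allFin m) κ                                     ∎
    where
    open ≤-Reasoning
    flip : Fin m × Fin m → Fin m × Fin m
    flip p = proj₂ p , proj₁ p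
    sub : ∀ {p} → p ∈ map flip (links g) → p ∈ pairsOf (allFin m) (neighbours F)
    sub p∈ with ∈-map⁻ flip p∈
    ... | (x , p) , q∈ , refl = ∈-pairsOf⁺ (∈-allFin p) (∈-neighbours⁺ F (links-adj g q∈))

  module _ {m n} {F : Graph m} (H : Graph n) (c : ℕ) (κ : Fin m → ℕ) {r : Fin m} (w : Fin n) where

    private
      -- The guard keeps the branching uniform: a partial map that has reached a vertex of too large
      -- degree gets no extension, and no embedding of the class is lost by this.
      choices : Fin m → Vec (Fin n) m → List (Fin n)
      choices p h with deg H (lookup h p) ≤? c * 2 ^ κ p
      ... | yes _ = neighbours H (lookup h p)
      ... | no _  = []

      length-choices : ∀ p h → length (choices p h) ≤ c * 2 ^ κ p
      length-choices p h with deg H (lookup h p) ≤? c * 2 ^ κ p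
      ... | yes le = le
      ... | no _   = z≤n

      ∈-choices : ∀ p h {y} → deg H (lookup h p) ≤ c * 2 ^ κ p → T (adj H (lookup h p) y) → y ∈ choices p h
      ∈-choices p h le py with deg H (lookup h p) ≤? c * 2 ^ κ p
      ... | yes _ = ∈-neighbours⁺ H py
      ... | no ¬le = ⊥-elim (¬le le)

    -- Partial embeddings defined on the grown part; the other entries are junk.
    extensions : ∀ {xs} → Grown F r xs → List (Vec (Fin n) m)
    extensions root = [ Vec.replicate m w ]
    extensions (grow {x} {p} g _ _ _ _) = concatMap (λ h → map (λ y → h [ x ]≔ y) (choices p h)) (extensions g)

    length-extensions : ∀ {xs} (g : Grown F r xs) →
      length (extensions g) ≤ c ^ length (links g) * 2 ^ ∑ (links g) (κ ∘ proj₂)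
    length-extensions root = ≤-refl
    length-extensions (grow {x} {p} g _ _ _ _) = begin
      length (concatMap (λ h → map (λ y → h [ x ]≔ y) (choices p h)) (extensions g))
        ≡⟨ length-concatMap (extensions g) _ ⟩
      ∑ (extensions g) (λ h → length (map (λ y → h [ x ]≔ y) (choices p h)))
        ≤⟨ ∑-bound (extensions g) (c * 2 ^ κ p) (λ {h} _ → ≤-trans (≤-reflexive (length-map _ (choices p h))) (length-choices p h)) ⟩
      length (extensions g) * (c * 2 ^ κ p)
        ≤⟨ *-monoˡ-≤ (c * 2 ^ κ p) (length-extensions g) ⟩
      c ^ length (links g) * 2 ^ s * (c * 2 ^ κ p)
        ≡⟨ solve 4 (λ a b d f → a :* b :* (d :* f) := d :* a :* (f :* b)) refl (c ^ length (links g)) (2 ^ s) c (2 ^ κ p) ⟩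
      c * c ^ length (links g) * (2 ^ κ p * 2 ^ s)
        ≡⟨ cong (c * c ^ length (links g) *_) (^-distribˡ-+-* 2 (κ p) s) ⟨
      c * c ^ length (links g) * 2 ^ (κ p + s) ∎
      where
      open ≤-Reasoning
      open +-*-Solver
      s : ℕ
      s = ∑ (links g) (κ ∘ proj₂)

    extensions-complete : ∀ {f} → Embedding F H f → lookup f r ≡ w → (∀ u → deg H (lookup f u) ≤ c * 2 ^ κ u) →
      ∀ {xs} (g : Grown F r xs) → ∃ λ h → h ∈ extensions g × (∀ {x} → x ∈ xs → lookup h x ≡ lookup f x)
    extensions-complete emb fr≡w deg≤ root =
      _ , here refl , λ { (here refl) → trans (VecP.lookup-replicate r w) (≡.sym fr≡w) }
    extensions-complete {f} emb fr≡w deg≤ (grow {x} {p} {xs} g x∉ p∈ px _) with extensions-complete emb fr≡w deg≤ g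
    ... | h , h∈ , agree = h [ x ]≔ lookup f x ,
        ∈-concatMap⁺ (λ h → map (λ y → h [ x ]≔ y) (choices p h)) (lose h∈ (∈-map⁺ _
          (∈-choices p h (subst (λ z → deg H z ≤ _) (≡.sym (agree p∈)) (deg≤ p))
            (subst (λ z → T (adj H z (lookup f x))) (≡.sym (agree p∈)) (Embedding.edge emb px))))) ,
        agree′
      where
      agree′ : ∀ {y} → y ∈ x ∷ xs → lookup (h [ x ]≔ lookup f x) y ≡ lookup f y
      agree′ (here refl) = VecP.lookup∘update x h _
      agree′ (there y∈)  = trans (VecP.lookup∘update′ (λ { refl → x∉ y∈ }) h _) (agree y∈)

  -- The root r is arbitrary because two embeddings may meet at any vertex of F. Each of the ℓ steps
  -- multiplies the count by the degree bound at the parent, and `parent-sum≤` adds up the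
  -- exponents.
  count-rooted : ∀ {F : Graph (suc ℓ)} {H : Graph n} {Δ} → IsTree F → (∀ x → deg F x ≤ Δ) → ∀ c κ r w {fs} → Unique fs →
    (∀ {f} → f ∈ fs → Embedding F H f × lookup f r ≡ w × (∀ u → deg H (lookup f u) ≤ c * 2 ^ κ u)) →
    length fs ≤ c ^ ℓ * 2 ^ (Δ * ∑ (allFin (suc ℓ)) κ)
  count-rooted {ℓ} {n} {F} {H} {Δ} tree deg≤ c κ r w {fs} uniq props with tree-order tree r
  ... | xs , g , all∈ = begin
    length fs                                             ≤⟨ unique-⊆⇒length≤ uniq sub ⟩
    length (extensions H c κ w g)                         ≤⟨ length-extensions H c κ w g ⟩
    c ^ length (links g) * 2 ^ ∑ (links g) (κ ∘ proj₂)    ≡⟨ cong (λ k → c ^ k * 2 ^ ∑ (links g) (κ ∘ proj₂)) length≡ℓ ⟩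
    c ^ ℓ * 2 ^ ∑ (links g) (κ ∘ proj₂)                   ≤⟨ *-monoʳ-≤ (c ^ ℓ) (^-monoʳ-≤ 2 (parent-sum≤ deg≤ g κ)) ⟩
    c ^ ℓ * 2 ^ (Δ * ∑ (allFin (suc ℓ)) κ)                ∎
    where
    open ≤-Reasoning
    length≡ℓ : length (links g) ≡ ℓ
    length≡ℓ = suc-injective (trans (≡.sym (length-links g)) (spanning-length g all∈))
    sub : ∀ {f} → f ∈ fs → f ∈ extensions H c κ w g
    sub f∈ with props f∈
    ... | emb , fr , degs with extensions-complete H c κ w emb fr degs g
    ...   | h , h∈ , agree = subst (_∈ extensions H c κ w g) (vec-ext (λ x → agree (all∈ x))) h∈

  -- Counting partial functions

  -- A partial function Fin n → A is encoded as a Vec (Maybe A) n; picks lists those with exactly s defined values, all in D.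
  picks : List A → (n s : ℕ) → List (Vec (Maybe A) n)
  picks D zero    zero    = [ [] ]
  picks D zero    (suc s) = []
  picks D (suc n) zero    = map (nothing ∷_) (picks D n zero)
  picks D (suc n) (suc s) = map (nothing ∷_) (picks D n (suc s)) ++ cartesianProductWith (λ v d → just d ∷ v) (picks D n s) D

  -- The length is binom(n,s) |D|^s and the bound is binom(n,s) ≤ n^s / s!. The recursion is
  -- Pascal's.
  length-picks : ∀ (D : List A) n s → s ! * length (picks D n s) ≤ (n * length D) ^ s
  length-picks D zero    zero    = ≤-refl
  length-picks D zero    (suc s) = ≤-trans (≤-reflexive (*-zeroʳ (suc s !))) z≤n
  length-picks D (suc n) zero    = ≤-trans (≤-reflexive (cong (1 *_) (length-map _ (picks D n zero)))) (length-picks D n zero)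
  length-picks D (suc n) (suc s) = begin
    suc s ! * length (picks D (suc n) (suc s))
      ≡⟨ cong (suc s ! *_) (trans (length-++ (map _ (picks D n (suc s))))
           (cong₂ _+_ (length-map _ (picks D n (suc s))) (length-cartesianProductWith _ (picks D n s) D))) ⟩
    suc s ! * (length (picks D n (suc s)) + length (picks D n s) * d)
      ≡⟨ solve 5 (λ σ f x y z → (σ :* f) :* (x :+ y :* z) := (σ :* f) :* x :+ (σ :* z) :* (f :* y)) refl (suc s) (s !) _ _ d ⟩
    suc s ! * length (picks D n (suc s)) + suc s * d * (s ! * length (picks D n s))
      ≤⟨ +-mono-≤ (length-picks D n (suc s)) (*-monoʳ-≤ (suc s * d) (length-picks D n s)) ⟩
    (n * d) ^ suc s + suc s * d * (n * d) ^ s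
      ≡⟨ cong₂ (λ x y → x + suc s * d * y) (^-*-distrib n d (suc s)) (^-*-distrib n d s) ⟩
    n ^ suc s * d ^ suc s + suc s * d * (n ^ s * d ^ s)
      ≡⟨ solve 5 (λ x y σ z w → x :* (z :* w) :+ σ :* z :* (y :* w) := (x :+ σ :* y) :* (z :* w)) refl (n ^ suc s) (n ^ s) (suc s) d (d ^ s) ⟩
    (n ^ suc s + suc s * n ^ s) * d ^ suc s
      ≤⟨ *-monoˡ-≤ (d ^ suc s) (^-first-terms n s) ⟩
    suc n ^ suc s * d ^ suc s
      ≡⟨ ^-*-distrib (suc n) d (suc s) ⟨
    (suc n * d) ^ suc s ∎
    where
    open ≤-Reasoning
    open +-*-Solver
    d : ℕ
    d = length D

  support : Vec (Maybe A) n → List (Fin n)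
  support []            = []
  support (nothing ∷ v) = map suc (support v)
  support (just _ ∷ v)  = zero ∷ map suc (support v)

  support-unique : ∀ (v : Vec (Maybe A) n) → Unique (support v)
  support-unique []            = []
  support-unique (nothing ∷ v) = Uniq.map⁺ FinP.suc-injective (support-unique v)
  support-unique (just _ ∷ v)  =
    All.tabulate (λ { x∈ refl → case ∈-map⁻ suc x∈ of λ { (_ , _ , ()) } }) ∷ Uniq.map⁺ FinP.suc-injective (support-unique v)

  ∈-support⁺ : ∀ (v : Vec (Maybe A) n) {x d} → lookup v x ≡ just d → x ∈ support v
  ∈-support⁺ (nothing ∷ v) {suc x} eq = ∈-map⁺ suc (∈-support⁺ v eq)
  ∈-support⁺ (just _ ∷ v)  {zero}  eq = here refl
  ∈-support⁺ (just _ ∷ v)  {suc x} eq = there (∈-map⁺ suc (∈-support⁺ v eq))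

  ∈-support⁻ : ∀ (v : Vec (Maybe A) n) {x} → x ∈ support v → ∃ λ d → lookup v x ≡ just d
  ∈-support⁻ (nothing ∷ v) x∈ with ∈-map⁻ suc x∈
  ... | _ , x∈′ , refl = ∈-support⁻ v x∈′
  ∈-support⁻ (just d ∷ v) (here refl) = d , refl
  ∈-support⁻ (just _ ∷ v) (there x∈) with ∈-map⁻ suc x∈
  ... | _ , x∈′ , refl = ∈-support⁻ v x∈′

  ∈-picks : ∀ {D : List A} (v : Vec (Maybe A) n) → (∀ {x d} → lookup v x ≡ just d → d ∈ D) →
    v ∈ picks D n (length (support v))
  ∈-picks [] _ = here refl
  ∈-picks {n = suc n} {D} (nothing ∷ v) in-D
    rewrite length-map {B = Fin (suc n)} suc (support v)
    with length (support v) | ∈-picks v (λ {x} → in-D {suc x})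
  ... | zero  | v∈ = ∈-map⁺ _ v∈
  ... | suc s | v∈ = ∈-++⁺ˡ (∈-map⁺ _ v∈)
  ∈-picks {n = suc n} {D} (just d ∷ v) in-D
    rewrite length-map {B = Fin (suc n)} suc (support v)
    = ∈-++⁺ʳ (map (nothing ∷_) (picks D n (suc (length (support v)))))
        (∈-cartesianProductWith⁺ (λ u d → just d ∷ u) (∈-picks v (λ {x} → in-D {suc x})) (in-D {zero} refl))

  ∈-picks-domain : ∀ {D : List A} {ys : List (Fin n)} (v : Vec (Maybe A) n) → Unique ys →
    (∀ {x} → x ∈ ys → ∃ λ d → lookup v x ≡ just d) → (∀ {x d} → lookup v x ≡ just d → x ∈ ys × d ∈ D) →
    v ∈ picks D n (length ys)
  ∈-picks-domain {n = n} {D = D} {ys} v uniq defined inside = subst (λ s → v ∈ picks D n s)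
    (unique-⇔⇒length≡ (support-unique v) uniq
      (λ x∈ → proj₁ (inside (proj₂ (∈-support⁻ v x∈)))) (λ x∈ → ∈-support⁺ v (proj₂ (defined x∈))))
    (∈-picks v (λ eq → proj₂ (inside eq)))

  mark : List (Fin n) → Fin n → Maybe ⊤
  mark S x with x ∈? S
  ... | yes _ = just tt
  ... | no _  = nothing

  -- Sets are partial functions to `⊤`, so that `picks` counts both the leaf sets and the codes
  -- built from them. As a set, a star does not remember the order of its leaves.
  indicator : List (Fin n) → Vec (Maybe ⊤) n
  indicator S = tabulate (mark S)

  lookup-indicator : ∀ {S : List (Fin n)} {x} → x ∈ S → lookup (indicator S) x ≡ just tt
  lookup-indicator {S = S} {x} x∈ = trans (VecP.lookup∘tabulate (mark S) x) marked
    where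
    marked : mark S x ≡ just tt
    marked with x ∈? S
    ... | yes _ = refl
    ... | no x∉ = ⊥-elim (x∉ x∈)

  indicator-sound : ∀ {S : List (Fin n)} {x d} → lookup (indicator S) x ≡ just d → x ∈ S
  indicator-sound {S = S} {x} {d} eq = marked (trans (≡.sym (VecP.lookup∘tabulate (mark S) x)) eq)
    where
    marked : mark S x ≡ just d → x ∈ S
    marked eq with x ∈? S
    ... | yes x∈ = x∈

  indicator∈picks : ∀ {S : List (Fin n)} → Unique S → indicator S ∈ picks [ tt ] n (length S)
  indicator∈picks {S = S} uniq = ∈-picks-domain (indicator S) uniq (λ x∈ → tt , lookup-indicator x∈)
    (λ eq → indicator-sound eq , here refl)

  starLists : ∀ n → Vec ℕ m → List (Vec (Vec (Maybe ⊤) n) m)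
  starLists n []       = [ [] ]
  starLists n (s ∷ ss) = cartesianProductWith _∷_ (picks [ tt ] n s) (starLists n ss)

  ∈-starLists : ∀ (s : Vec ℕ m) {σ : Vec (Vec (Maybe ⊤) n) m} → (∀ u → lookup σ u ∈ picks [ tt ] n (lookup s u)) → σ ∈ starLists n s
  ∈-starLists []       {[]}    _   = here refl
  ∈-starLists (s ∷ ss) {x ∷ σ} σ∈ = ∈-cartesianProductWith⁺ _∷_ (σ∈ zero) (∈-starLists ss (σ∈ ∘ suc))

  -- With q = a/b and nq ≤ k, binom(n,s) q^s ≤ (4nq/s)^s ≤ (4k/s)^s ≤ 2^(-s). The threshold 8k is
  -- the 4 of the factorial bound times the 2 to be saved per leaf.
  pick-weight : ∀ {a b k} s → 1 ≤ k → n * a ≤ k * b → s ≡ 0 ⊎ 8 * k ≤ s →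
    2 ^ s * length (picks [ tt ] n s) * a ^ s ≤ b ^ s
  pick-weight {n} s _ _ (inj₁ refl) = begin
    (length (picks [ tt ] n 0) + 0) * 1      ≡⟨ *-identityʳ _ ⟩
    length (picks [ tt ] n 0) + 0            ≤⟨ length-picks [ tt ] n 0 ⟩
    1                                        ∎
    where open ≤-Reasoning
  -- From k ≥ 1 follows 8 ≤ s, which rules out s = 0, so that `s ^ s` can be cancelled.
  pick-weight s 1≤k _ (inj₂ 8k≤s) with ≤-trans (*-monoʳ-≤ 8 1≤k) 8k≤s
  pick-weight {n} {a} {b} {k} s@(suc _) 1≤k na≤kb (inj₂ 8k≤s) | _ = *-cancelˡ-≤ (s ^ s) {{m^n≢0 s s}} (begin
    s ^ s * (2 ^ s * c * a ^ s)              ≤⟨ *-monoˡ-≤ (2 ^ s * c * a ^ s) (n^n≤4^n*n! s) ⟩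
    4 ^ s * s ! * (2 ^ s * c * a ^ s)        ≡⟨ solve 5 (λ x y z w t → x :* y :* (z :* w :* t) := x :* z :* t :* (y :* w)) refl (4 ^ s) (s !) (2 ^ s) c (a ^ s) ⟩
    4 ^ s * 2 ^ s * a ^ s * (s ! * c)        ≤⟨ *-monoʳ-≤ (4 ^ s * 2 ^ s * a ^ s) (length-picks [ tt ] n s) ⟩
    4 ^ s * 2 ^ s * a ^ s * (n * 1) ^ s      ≡⟨ cong (λ t → 4 ^ s * 2 ^ s * a ^ s * t ^ s) (*-identityʳ n) ⟩
    4 ^ s * 2 ^ s * a ^ s * n ^ s            ≡⟨ cong (λ t → t * a ^ s * n ^ s) (^-*-distrib 4 2 s) ⟨
    8 ^ s * a ^ s * n ^ s                    ≡⟨ trans (*-assoc (8 ^ s) _ _) (cong (8 ^ s *_) (trans (*-comm (a ^ s) (n ^ s)) (≡.sym (^-*-distrib n a s)))) ⟩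
    8 ^ s * (n * a) ^ s                      ≡⟨ ^-*-distrib 8 (n * a) s ⟨
    (8 * (n * a)) ^ s                        ≤⟨ ^-monoˡ-≤ s (≤-trans (*-monoʳ-≤ 8 na≤kb) (≤-trans (≤-reflexive (≡.sym (*-assoc 8 k b))) (*-monoˡ-≤ b 8k≤s))) ⟩
    (s * b) ^ s                              ≡⟨ ^-*-distrib s b s ⟩
    s ^ s * b ^ s                            ∎)
    where
    open ≤-Reasoning
    open +-*-Solver
    c : ℕ
    c = length (picks [ tt ] n s)

  star-weight : ∀ {a b k} (s : Vec ℕ m) → 1 ≤ k → n * a ≤ k * b → (∀ u → lookup s u ≡ 0 ⊎ 8 * k ≤ lookup s u) →
    2 ^ Vec.sum s * length (starLists n s) * a ^ Vec.sum s ≤ b ^ Vec.sum s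
  star-weight [] _ _ _ = ≤-refl
  star-weight {n = n} {a} {b} {k} (s ∷ ss) 1≤k na≤kb sizes = begin
    2 ^ (s + Σs) * length (starLists n (s ∷ ss)) * a ^ (s + Σs)
      ≡⟨ cong (λ t → 2 ^ (s + Σs) * t * a ^ (s + Σs)) (length-cartesianProductWith _∷_ (picks [ tt ] n s) (starLists n ss)) ⟩
    2 ^ (s + Σs) * (c * cs) * a ^ (s + Σs)
      ≡⟨ cong₂ (λ x y → x * (c * cs) * y) (^-distribˡ-+-* 2 s Σs) (^-distribˡ-+-* a s Σs) ⟩
    2 ^ s * 2 ^ Σs * (c * cs) * (a ^ s * a ^ Σs)
      ≡⟨ solve 6 (λ x y z w t u → x :* y :* (z :* w) :* (t :* u) := x :* z :* t :* (y :* w :* u)) refl (2 ^ s) (2 ^ Σs) c cs (a ^ s) (a ^ Σs) ⟩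
    2 ^ s * c * a ^ s * (2 ^ Σs * cs * a ^ Σs)
      ≤⟨ *-mono-≤ (pick-weight {n} {a} {b} {k} s 1≤k na≤kb (sizes zero)) (star-weight {n = n} {a} {b} {k} ss 1≤k na≤kb (sizes ∘ suc)) ⟩
    b ^ s * b ^ Σs
      ≡⟨ ^-distribˡ-+-* b s Σs ⟨
    b ^ (s + Σs) ∎
    where
    open ≤-Reasoning
    open +-*-Solver
    Σs c cs : ℕ
    Σs = Vec.sum ss
    c  = length (picks [ tt ] n s)
    cs = length (starLists n ss)

  -- One piece of a code: the images of the non-root vertices of a tree, and a set of further neighbours for each of its vertices.
  Piece : ℕ → ℕ → Set
  Piece n ℓ = Vec (Fin n) ℓ × Vec (Vec (Maybe ⊤) n) (suc ℓ)

  pieces : ∀ n → Vec ℕ (suc ℓ) → List (Piece n ℓ)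
  pieces {ℓ} n s = cartesianProductWith _,_ (allMaps n ℓ) (starLists n s)

  length-allMaps : ∀ n m → length (allMaps n m) ≡ n ^ m
  length-allMaps n zero    = refl
  length-allMaps n (suc m) = begin
    length (allMaps n (suc m))                                      ≡⟨ length-concatMap (allFin n) _ ⟩
    ∑ (allFin n) (λ x → length (map {B = Vec (Fin n) (suc m)} (x ∷_) (allMaps n m)))
      ≡⟨ ∑-cong (allFin n) (λ x → trans (length-map _ (allMaps n m)) (length-allMaps n m)) ⟩
    ∑ (allFin n) (λ _ → n ^ m)                                      ≡⟨ ∑-const (allFin n) (n ^ m) ⟩
    length (allFin n) * n ^ m                                       ≡⟨ cong (_* n ^ m) (length-allFin n) ⟩
    n * n ^ m                                                       ∎
    where open ≡.≡-Reasoning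

  -- If the number of codes with T pieces allows for the expected number of copies to be at least 1, then T is small.
  codes-bound : ∀ {a b k} (s : Vec ℕ (suc ℓ)) T → 1 ≤ k → 1 ≤ b → n * a ≤ k * b →
    (∀ u → lookup s u ≡ 0 ⊎ 8 * k ≤ lookup s u) →
    b ^ (T * (ℓ + Vec.sum s)) ≤ length (picks (pieces n s) n T) * a ^ (T * (ℓ + Vec.sum s)) →
    T * 2 ^ Vec.sum s * b ^ ℓ ≤ 4 * n * (n * a) ^ ℓ
  codes-bound s zero _ _ _ _ _ = z≤n
  codes-bound {ℓ} {n} {a} {b@(suc _)} {k} s T@(suc t) 1≤k _ na≤kb sizes enough =
    *-cancelʳ-≤ _ _ (b ^ Σs) {{m^n≢0 b Σs}} (begin
      T * 2 ^ Σs * b ^ ℓ * b ^ Σs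
        ≡⟨ solve 4 (λ x y z w → x :* y :* z :* w := x :* (z :* w) :* y) refl T (2 ^ Σs) (b ^ ℓ) (b ^ Σs) ⟩
      T * (b ^ ℓ * b ^ Σs) * 2 ^ Σs
        ≡⟨ cong (λ x → T * x * 2 ^ Σs) (^-distribˡ-+-* b ℓ Σs) ⟨
      T * b ^ E * 2 ^ Σs
        ≤⟨ *-monoˡ-≤ (2 ^ Σs) root-bound ⟩
      4 * (n * (n ^ ℓ * P)) * a ^ E * 2 ^ Σs
        ≡⟨ cong (λ x → 4 * (n * (n ^ ℓ * P)) * x * 2 ^ Σs) (^-distribˡ-+-* a ℓ Σs) ⟩
      4 * (n * (n ^ ℓ * P)) * (a ^ ℓ * a ^ Σs) * 2 ^ Σs
        ≡⟨ solve 6 (λ x y z w t u → con 4 :* (x :* (y :* z)) :* (w :* t) :* u := con 4 :* x :* (y :* w) :* (u :* z :* t)) refl n (n ^ ℓ) P (a ^ ℓ) (a ^ Σs) (2 ^ Σs) ⟩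
      4 * n * (n ^ ℓ * a ^ ℓ) * (2 ^ Σs * P * a ^ Σs)
        ≤⟨ *-monoʳ-≤ (4 * n * (n ^ ℓ * a ^ ℓ)) (star-weight {n = n} {a} {b} {k} s 1≤k na≤kb sizes) ⟩
      4 * n * (n ^ ℓ * a ^ ℓ) * b ^ Σs
        ≡⟨ cong (λ x → 4 * n * x * b ^ Σs) (^-*-distrib n a ℓ) ⟨
      4 * n * (n * a) ^ ℓ * b ^ Σs ∎)
    where
    open ≤-Reasoning
    open +-*-Solver
    Σs E P c : ℕ
    Σs = Vec.sum s
    E  = ℓ + Σs
    P  = length (starLists n s)
    c  = length (picks (pieces n s) n T)
    length-pieces : length (pieces n s) ≡ n ^ ℓ * P
    length-pieces = trans (length-cartesianProductWith _,_ (allMaps n ℓ) (starLists n s)) (cong (_* P) (length-allMaps n ℓ))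
    -- The codes are unordered choices of T pieces, hence the factor 1/T!. Since T^T ≤ 4^T T!, both
    -- sides become T-th powers and T itself survives on the left.
    root-bound : T * b ^ E ≤ 4 * (n * (n ^ ℓ * P)) * a ^ E
    root-bound = ^-cancelˡ-≤ t _ _ (begin
      (T * b ^ E) ^ T                                  ≡⟨ ^-*-distrib T (b ^ E) T ⟩
      T ^ T * (b ^ E) ^ T                              ≡⟨ cong (T ^ T *_) (trans (^-*-assoc b E T) (cong (b ^_) (*-comm E T))) ⟩
      T ^ T * b ^ (T * E)                              ≤⟨ *-mono-≤ (n^n≤4^n*n! T) enough ⟩
      4 ^ T * T ! * (c * a ^ (T * E))                  ≡⟨ solve 4 (λ x y z w → x :* y :* (z :* w) := x :* (y :* z) :* w) refl (4 ^ T) (T !) c (a ^ (T * E)) ⟩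
      4 ^ T * (T ! * c) * a ^ (T * E)                  ≤⟨ *-monoˡ-≤ (a ^ (T * E)) (*-monoʳ-≤ (4 ^ T) (length-picks (pieces n s) n T)) ⟩
      4 ^ T * (n * length (pieces n s)) ^ T * a ^ (T * E)
        ≡⟨ cong₂ (λ x y → 4 ^ T * (n * x) ^ T * y) length-pieces (trans (cong (a ^_) (*-comm T E)) (≡.sym (^-*-assoc a E T))) ⟩
      4 ^ T * (n * (n ^ ℓ * P)) ^ T * (a ^ E) ^ T      ≡⟨ cong (_* (a ^ E) ^ T) (^-*-distrib 4 (n * (n ^ ℓ * P)) T) ⟨
      (4 * (n * (n ^ ℓ * P))) ^ T * (a ^ E) ^ T        ≡⟨ ^-*-distrib (4 * (n * (n ^ ℓ * P))) (a ^ E) T ⟨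
      (4 * (n * (n ^ ℓ * P)) * a ^ E) ^ T              ∎)

  -- Disjoint copies with stars attached

  -- Vertex-disjoint copies of F in H together with s_u further edges at the vertex playing the role of u,
  -- each oriented away from that vertex by the asymmetric relation ≺.
  record StarFamily {ℓ n} (F : Graph (suc ℓ)) (H : Graph n) (s : Vec ℕ (suc ℓ))
                    (Φ : List (Vec (Fin n) (suc ℓ))) (_≺_ : Fin n → Fin n → Set) : Set where
    field
      unique      : Unique Φ
      embedded    : ∀ {φ} → φ ∈ Φ → Embedding F H φ
      disjoint    : ∀ {φ ψ} → φ ∈ Φ → ψ ∈ Φ → ∀ {i j} → lookup φ i ≡ lookup ψ j → φ ≡ ψ
      asym        : ∀ {x y} → x ≺ y → ¬ y ≺ x
      star        : Vec (Fin n) (suc ℓ) → Fin (suc ℓ) → List (Fin n)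
      star-unique : ∀ {φ} → φ ∈ Φ → ∀ u → Unique (star φ u)
      star-length : ∀ {φ} → φ ∈ Φ → ∀ u → length (star φ u) ≡ lookup s u
      star-adj    : ∀ {φ} → φ ∈ Φ → ∀ u {y} → y ∈ star φ u → T (adj H (lookup φ u) y)
      star-≺      : ∀ {φ} → φ ∈ Φ → ∀ u {y} → y ∈ star φ u → lookup φ u ≺ y
      star-new    : ∀ {φ} → φ ∈ Φ → ∀ u {u′} → lookup φ u′ ∈ star φ u → ¬ T (adj F u u′)

  injective⇒covers : ∀ {f : Vec (Fin n) n} → (∀ {i j} → lookup f i ≡ lookup f j → i ≡ j) → ∀ x → Covers f x
  injective⇒covers {n} {f} inj x with FinP.any? (λ i → lookup f i FinP.≟ x)
  ... | yes c  = c
  ... | no ¬c = ⊥-elim (<⇒≱ (≤-reflexive (cong suc (trans (≡.sym (length-allFin n)) (≡.sym (length-map (lookup f) (allFin n))))))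
      (unique⇒length≤ {xs = x ∷ map (lookup f) (allFin n)}
        (All.tabulate (λ { y∈ refl → case ∈-map⁻ (lookup f) y∈ of λ { (i , _ , eq) → ¬c (i , ≡.sym eq) } })
         ∷ Uniq.map⁺ inj (Uniq.allFin⁺ n))))

  module StarForest {ℓ n} {F : Graph (suc ℓ)} {H : Graph n} {s : Vec ℕ (suc ℓ)}
                    {Φ : List (Vec (Fin n) (suc ℓ))} {_≺_ : Fin n → Fin n → Set}
                    (fam : StarFamily F H s Φ _≺_) (eF≡ℓ : e F ≡ ℓ) where

    open StarFamily fam

    private
      V : Set
      V = Vec (Fin n) (suc ℓ)

    treeEdges starEdges pieceEdges : V → List (Fin n × Fin n)
    treeEdges φ  = map (λ p → lookup φ (proj₁ p) , lookup φ (proj₂ p)) (edges F)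
    starEdges φ  = map (λ p → lookup φ (proj₁ p) , proj₂ p) (pairsOf (allFin (suc ℓ)) (star φ))
    pieceEdges φ = treeEdges φ ++ starEdges φ

    data PieceEdge (φ : V) (x y : Fin n) : Set where
      tree : ∀ i j → toℕ i < toℕ j → T (adj F i j) → lookup φ i ≡ x → lookup φ j ≡ y → PieceEdge φ x y
      leaf : ∀ u → lookup φ u ≡ x → y ∈ star φ u → PieceEdge φ x y

    ∈-pieceEdges⁻ : ∀ φ {x y} → (x , y) ∈ pieceEdges φ → PieceEdge φ x y
    ∈-pieceEdges⁻ φ xy∈ with ∈-++⁻ (treeEdges φ) xy∈
    ... | inj₁ xy∈′ with ∈-map⁻ _ xy∈′
    ...   | (i , j) , ij∈ , refl = let (i<j , ij) = ∈-edges⁻ F ij∈ in tree i j i<j ij refl refl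
    ∈-pieceEdges⁻ φ xy∈ | inj₂ xy∈′ with ∈-map⁻ _ xy∈′
    ...   | (u , y) , uy∈ , refl = leaf u refl (proj₂ (∈-pairsOf⁻ (allFin (suc ℓ)) uy∈))

    ∈-pieceEdges⁺ : ∀ φ {x y} → PieceEdge φ x y → (x , y) ∈ pieceEdges φ
    ∈-pieceEdges⁺ φ (tree i j i<j ij refl refl) =
      ∈-++⁺ˡ (∈-map⁺ (λ p → lookup φ (proj₁ p) , lookup φ (proj₂ p)) (∈-edges⁺ F i<j ij))
    ∈-pieceEdges⁺ φ (leaf u refl y∈) = ∈-++⁺ʳ (treeEdges φ)
      (∈-map⁺ (λ p → lookup φ (proj₁ p) , proj₂ p) (∈-pairsOf⁺ (∈-allFin u) y∈))

    pieceEdges-unique : ∀ {φ} → φ ∈ Φ → Unique (pieceEdges φ)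
    pieceEdges-unique {φ} φ∈ = Uniq.++⁺
      (Uniq.map⁺ (λ {p} {q} eq → cong₂ _,_ (φ-inj (cong proj₁ eq)) (φ-inj (cong proj₂ eq))) (edges-unique F))
      (Uniq.map⁺ (λ {p} {q} eq → cong₂ _,_ (φ-inj (cong proj₁ eq)) (cong proj₂ eq))
        (pairsOf-unique (Uniq.allFin⁺ (suc ℓ)) (λ {u} _ → star-unique φ∈ u)))
      separate
      where
      φ-inj : ∀ {i j} → lookup φ i ≡ lookup φ j → i ≡ j
      φ-inj = Embedding.injective (embedded φ∈)
      separate : ∀ {p} → p ∈ treeEdges φ × p ∈ starEdges φ → ⊥
      separate (p∈ , p∈′) with ∈-map⁻ _ p∈ | ∈-map⁻ _ p∈′
      ... | (i , j) , ij∈ , refl | (u , y) , uy∈ , eq =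
        star-new φ∈ u (subst (_∈ star φ u) (≡.sym (cong proj₂ eq)) (proj₂ (∈-pairsOf⁻ (allFin (suc ℓ)) uy∈)))
          (subst (λ z → T (adj F z j)) (φ-inj (cong proj₁ eq)) (proj₂ (∈-edges⁻ F ij∈)))

    length-pieceEdges : ∀ {φ} → φ ∈ Φ → length (pieceEdges φ) ≡ ℓ + Vec.sum s
    length-pieceEdges {φ} φ∈ = trans (length-++ (treeEdges φ)) (cong₂ _+_
      (trans (length-map _ (edges F)) (trans (≡.sym (e≡length-edges F)) eF≡ℓ))
      (begin
        length (starEdges φ)                                  ≡⟨ length-map _ (pairsOf (allFin (suc ℓ)) (star φ)) ⟩
        length (pairsOf (allFin (suc ℓ)) (star φ))            ≡⟨ length-pairsOf (allFin (suc ℓ)) (star φ) ⟩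
        ∑ (allFin (suc ℓ)) (length ∘ star φ)                  ≡⟨ ∑-cong (allFin (suc ℓ)) (star-length φ∈) ⟩
        ∑ (allFin (suc ℓ)) (lookup s)                         ≡⟨ ∑-lookup s ⟩
        Vec.sum s                                             ∎))
      where open ≡.≡-Reasoning

    pieceEdge-adj : ∀ {φ x y} → φ ∈ Φ → PieceEdge φ x y → T (adj H x y)
    pieceEdge-adj φ∈ (tree _ _ _ ij refl refl) = Embedding.edge (embedded φ∈) ij
    pieceEdge-adj φ∈ (leaf u refl y∈)          = star-adj φ∈ u y∈

    pieceEdge-source : ∀ {φ x y} → PieceEdge φ x y → Covers φ x
    pieceEdge-source (tree i _ _ _ eq _) = i , eq
    pieceEdge-source (leaf u eq _)       = u , eq

    -- Leaves may themselves be vertices of copies, so an edge could arise in both directions. Two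
    -- tree edges are told apart by the order of their ends in F, a tree edge and a leaf edge by
    -- `star-new`, and two leaf edges by the asymmetry of the orientation.
    pieceEdge-asym : ∀ {φ ψ x y} → φ ∈ Φ → ψ ∈ Φ → PieceEdge φ x y → ¬ PieceEdge ψ y x
    pieceEdge-asym φ∈ ψ∈ (tree i j i<j ij φi φj) (tree i′ j′ i′<j′ _ ψi′ ψj′)
      with disjoint φ∈ ψ∈ (trans φj (≡.sym ψi′))
    ... | refl with Embedding.injective (embedded φ∈) (trans φj (≡.sym ψi′)) | Embedding.injective (embedded φ∈) (trans φi (≡.sym ψj′))
    ...   | refl | refl = <-asym i<j i′<j′
    pieceEdge-asym φ∈ ψ∈ (tree i j i<j ij refl φj) (leaf u ψu x∈) with disjoint φ∈ ψ∈ (trans φj (≡.sym ψu))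
    ... | refl with Embedding.injective (embedded φ∈) (trans φj (≡.sym ψu))
    ...   | refl = star-new φ∈ u x∈ (adj-sym F ij)
    pieceEdge-asym φ∈ ψ∈ (leaf u φu y∈) (tree i j i<j ij refl ψj) with disjoint φ∈ ψ∈ (trans φu (≡.sym ψj))
    ... | refl with Embedding.injective (embedded φ∈) (trans φu (≡.sym ψj))
    ...   | refl = star-new φ∈ u y∈ (adj-sym F ij)
    pieceEdge-asym φ∈ ψ∈ (leaf u refl y∈) (leaf u′ refl x∈) = asym (star-≺ φ∈ u y∈) (star-≺ ψ∈ u′ x∈)

    Oriented : Fin n → Fin n → Set
    Oriented x y = ∃ λ φ → φ ∈ Φ × PieceEdge φ x y

    orientedEdges : List (Fin n × Fin n)
    orientedEdges = concatMap pieceEdges Φ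

    ∈-orientedEdges⁻ : ∀ {x y} → (x , y) ∈ orientedEdges → Oriented x y
    ∈-orientedEdges⁻ xy∈ with find (∈-concatMap⁻ pieceEdges {Φ} xy∈)
    ... | φ , φ∈ , xy∈′ = φ , φ∈ , ∈-pieceEdges⁻ φ xy∈′

    ∈-orientedEdges⁺ : ∀ {x y} → Oriented x y → (x , y) ∈ orientedEdges
    ∈-orientedEdges⁺ (φ , φ∈ , xy) = ∈-concatMap⁺ pieceEdges (lose φ∈ (∈-pieceEdges⁺ φ xy))

    oriented? : ∀ x y → Dec ((x , y) ∈ orientedEdges)
    oriented? x y = any? (ProdP.≡-dec FinP._≟_ FinP._≟_ (x , y)) orientedEdges

    oriented⇒adj : ∀ {x y} → Oriented x y → T (adj H x y)
    oriented⇒adj (_ , φ∈ , xy) = pieceEdge-adj φ∈ xy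

    -- All n vertices are kept, isolated ones included: an embedding in `K n` is then a permutation,
    -- and images can differ only in their edges.
    union : Graph n
    union = record
      { adj = λ x y → does (oriented? x y) ∨ does (oriented? y x)
      ; sym = λ x y → ∨-comm (does (oriented? x y)) (does (oriented? y x))
      ; irr = λ x → irr′ x (oriented? x x)
      }
      where
      irr′ : ∀ x (d : Dec ((x , x) ∈ orientedEdges)) → does d ∨ does d ≡ false
      irr′ x (yes xx∈) = ⊥-elim (adj-irr H (oriented⇒adj (∈-orientedEdges⁻ xx∈)))
      irr′ x (no _)    = refl

    union⁻ : ∀ {x y} → T (adj union x y) → Oriented x y ⊎ Oriented y x
    union⁻ {x} {y} = go (oriented? x y) (oriented? y x)
      where
      go : (d : Dec ((x , y) ∈ orientedEdges)) (d′ : Dec ((y , x) ∈ orientedEdges)) → T (does d ∨ does d′) → Oriented x y ⊎ Oriented y x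
      go (yes xy∈) _         _ = inj₁ (∈-orientedEdges⁻ xy∈)
      go (no _)    (yes yx∈) _ = inj₂ (∈-orientedEdges⁻ yx∈)

    union⁺ : ∀ {x y} → Oriented x y → T (adj union x y)
    union⁺ {x} {y} o = go (oriented? x y)
      where
      go : (d : Dec ((x , y) ∈ orientedEdges)) → T (does d ∨ does (oriented? y x))
      go (yes _)  = tt
      go (no xy∉) = ⊥-elim (xy∉ (∈-orientedEdges⁺ o))

    union⊆H : union ⊆G H
    union⊆H = id , id , λ x y xy → case union⁻ xy of λ
      { (inj₁ o) → oriented⇒adj o ; (inj₂ o) → adj-sym H (oriented⇒adj o) }

    private
      indexedEdges : List (V × (Fin n × Fin n))
      indexedEdges = pairsOf Φ pieceEdges

      SameEdge : V × (Fin n × Fin n) → Fin n × Fin n → Set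
      SameEdge (_ , xy) q = SamePair xy q

    -- No edge is counted twice: the source of a directed edge lies in just one copy, by
    -- disjointness, and the reversed edge is excluded by `pieceEdge-asym`.
    e-union : length Φ * (ℓ + Vec.sum s) ≤ e union
    e-union = begin
      length Φ * (ℓ + Vec.sum s)      ≡⟨ ∑-const Φ (ℓ + Vec.sum s) ⟨
      ∑ Φ (λ _ → ℓ + Vec.sum s)       ≤⟨ ∑-mono Φ (λ φ∈ → ≤-reflexive (≡.sym (length-pieceEdges φ∈))) ⟩
      ∑ Φ (length ∘ pieceEdges)       ≡⟨ length-pairsOf Φ pieceEdges ⟨
      length indexedEdges             ≤⟨ pigeonhole SameEdge {ys = edges union} (pairsOf-unique unique pieceEdges-unique) toEdge same ⟩
      length (edges union)            ≡⟨ e≡length-edges union ⟨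
      e union                         ∎
      where
      open ≤-Reasoning
      toEdge : ∀ {p} → p ∈ indexedEdges → ∃ λ q → q ∈ edges union × SameEdge p q
      toEdge {φ , (x , y)} p∈ with ∈-pairsOf⁻ Φ p∈
      ... | φ∈ , xy∈ with φ , φ∈ , ∈-pieceEdges⁻ φ xy∈ | <-cmp (toℕ x) (toℕ y)
      ...   | o | tri< x<y _ _ = (x , y) , ∈-edges⁺ union x<y (union⁺ o) , inj₁ refl
      ...   | o | tri> _ _ y<x = (y , x) , ∈-edges⁺ union y<x (adj-sym union (union⁺ o)) , inj₂ refl
      ...   | o | tri≈ _ x≡y _ = ⊥-elim (adj-irr H (subst (λ z → T (adj H z y)) (FinP.toℕ-injective x≡y) (oriented⇒adj o)))
      samePiece : ∀ {φ ψ x y z} → φ ∈ Φ → ψ ∈ Φ → PieceEdge φ x y → PieceEdge ψ x z → φ ≡ ψ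
      samePiece φ∈ ψ∈ p q with pieceEdge-source p | pieceEdge-source q
      ... | i , eq | j , eq′ = disjoint φ∈ ψ∈ (trans eq (≡.sym eq′))
      same : ∀ {p p′ q} → p ∈ indexedEdges → p′ ∈ indexedEdges → SameEdge p q → SameEdge p′ q → p ≡ p′
      same {φ , _} {ψ , _} p∈ p′∈ sp sp′ with ∈-pairsOf⁻ Φ p∈ | ∈-pairsOf⁻ Φ p′∈
      ... | φ∈ , xy∈ | ψ∈ , zw∈ = go (∈-pieceEdges⁻ φ xy∈) (∈-pieceEdges⁻ ψ zw∈) sp sp′
        where
        go : ∀ {x y z w q} → PieceEdge φ x y → PieceEdge ψ z w → SamePair (x , y) q → SamePair (z , w) q → (φ , (x , y)) ≡ (ψ , (z , w))
        go p p′ (inj₁ refl) (inj₁ refl) = cong (_, _) (samePiece φ∈ ψ∈ p p′)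
        go p p′ (inj₂ refl) (inj₂ refl) = cong (_, _) (samePiece φ∈ ψ∈ p p′)
        go p p′ (inj₁ refl) (inj₂ refl) = ⊥-elim (pieceEdge-asym φ∈ ψ∈ p p′)
        go p p′ (inj₂ refl) (inj₁ refl) = ⊥-elim (pieceEdge-asym φ∈ ψ∈ p p′)

    private
      PermVec : Set
      PermVec = Vec (Fin n) n

    baseOf : PermVec → V → Fin ℓ → Fin n
    baseOf f φ i = lookup f (lookup φ (suc i))

    starOf : PermVec → V → Fin (suc ℓ) → Vec (Maybe ⊤) n
    starOf f φ u = indicator (map (lookup f) (star φ u))

    -- The image of the root is missing because it is the position at which `codeAt` stores the
    -- piece. Indexing by this position also makes the code forget which member of the family the
    -- piece came from.
    pieceCode : PermVec → V → Piece n ℓ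
    pieceCode f φ = tabulate (baseOf f φ) , tabulate (starOf f φ)

    codeAt : PermVec → Fin n → Maybe (Piece n ℓ)
    codeAt f x with any? (λ φ → lookup f (lookup φ zero) FinP.≟ x) Φ
    ... | yes p = just (pieceCode f (proj₁ (find p)))
    ... | no _  = nothing

    code : PermVec → Vec (Maybe (Piece n ℓ)) n
    code f = tabulate (codeAt f)

    codeAt-just : ∀ f {x d} → codeAt f x ≡ just d → ∃ λ φ → φ ∈ Φ × lookup f (lookup φ zero) ≡ x × d ≡ pieceCode f φ
    codeAt-just f {x} eq with any? (λ φ → lookup f (lookup φ zero) FinP.≟ x) Φ
    ... | yes p with find p | eq
    ...   | φ , φ∈ , root≡x | refl = φ , φ∈ , root≡x , refl

    codeAt-root : ∀ f → (∀ {i j} → lookup f i ≡ lookup f j → i ≡ j) → ∀ {φ} → φ ∈ Φ →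
      codeAt f (lookup f (lookup φ zero)) ≡ just (pieceCode f φ)
    codeAt-root f inj {φ} φ∈ with any? (λ ψ → lookup f (lookup ψ zero) FinP.≟ lookup f (lookup φ zero)) Φ
    ... | no ¬p = ⊥-elim (¬p (lose φ∈ refl))
    ... | yes p with find p
    ...   | ψ , ψ∈ , root≡ = cong (λ χ → just (pieceCode f χ)) (disjoint ψ∈ φ∈ (inj root≡))

    lookup-code : ∀ f x → lookup (code f) x ≡ codeAt f x
    lookup-code f = VecP.lookup∘tabulate (codeAt f)

    code∈ : ∀ f → (∀ {i j} → lookup f i ≡ lookup f j → i ≡ j) → code f ∈ picks (pieces n s) n (length Φ)
    code∈ f inj = subst (λ t → code f ∈ picks (pieces n s) n t) (length-map image₀ Φ)
      (∈-picks-domain (code f) (unique-map roots-distinct unique) defined inside)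
      where
      image₀ : V → Fin n
      image₀ φ = lookup f (lookup φ zero)
      roots-distinct : ∀ {φ ψ} → φ ∈ Φ → ψ ∈ Φ → image₀ φ ≡ image₀ ψ → φ ≡ ψ
      roots-distinct φ∈ ψ∈ eq = disjoint φ∈ ψ∈ (inj eq)
      defined : ∀ {x} → x ∈ map image₀ Φ → ∃ λ d → lookup (code f) x ≡ just d
      defined x∈ with ∈-map⁻ image₀ x∈
      ... | φ , φ∈ , refl = pieceCode f φ , trans (lookup-code f _) (codeAt-root f inj φ∈)
      inside : ∀ {x d} → lookup (code f) x ≡ just d → x ∈ map image₀ Φ × d ∈ pieces n s
      inside {x} eq with codeAt-just f (trans (≡.sym (lookup-code f x)) eq)
      ... | φ , φ∈ , refl , refl = ∈-map⁺ image₀ φ∈ ,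
        ∈-cartesianProductWith⁺ _,_ (∈-allMaps _) (∈-starLists s λ u →
          ≡.subst₂ (λ σ t → σ ∈ picks [ tt ] n t)
            (≡.sym (VecP.lookup∘tabulate (starOf f φ) u)) (trans (length-map (lookup f) (star φ u)) (star-length φ∈ u))
            (indicator∈picks (Uniq.map⁺ inj (star-unique φ∈ u))))

    -- Equal codes need not come from the same copy: the piece of φ under f may be that of another ψ
    -- under g. All pieces have the same shape, so an edge of φ is traded for the corresponding edge
    -- of ψ with the same image.
    transfer : ∀ {f g} → (∀ {i j} → lookup f i ≡ lookup f j → i ≡ j) → code f ≡ code g → ∀ {i j} → Oriented i j →
      ∃ λ i′ → ∃ λ j′ → Oriented i′ j′ × lookup g i′ ≡ lookup f i × lookup g j′ ≡ lookup f j
    transfer {f} {g} inj eq (φ , φ∈ , p)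
      with codeAt-just g (trans (≡.sym (lookup-code g _)) (trans (cong (λ c → lookup c (lookup f (lookup φ zero))) (≡.sym eq))
             (trans (lookup-code f _) (codeAt-root f inj φ∈))))
    ... | ψ , ψ∈ , root≡ , pieces≡ = move p
      where
      agree : ∀ u → lookup g (lookup ψ u) ≡ lookup f (lookup φ u)
      agree zero    = root≡
      agree (suc i) = trans (≡.sym (VecP.lookup∘tabulate (baseOf g ψ) i))
        (trans (cong (λ d → lookup (proj₁ d) i) (≡.sym pieces≡)) (VecP.lookup∘tabulate (baseOf f φ) i))
      stars≡ : ∀ u → starOf f φ u ≡ starOf g ψ u
      stars≡ u = trans (≡.sym (VecP.lookup∘tabulate (starOf f φ) u))
        (trans (cong (λ d → lookup (proj₂ d) u) pieces≡) (VecP.lookup∘tabulate (starOf g ψ) u))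
      move : ∀ {i j} → PieceEdge φ i j →
        ∃ λ i′ → ∃ λ j′ → Oriented i′ j′ × lookup g i′ ≡ lookup f i × lookup g j′ ≡ lookup f j
      move (tree a b a<b ab refl refl) = lookup ψ a , lookup ψ b , (ψ , ψ∈ , tree a b a<b ab refl refl) , agree a , agree b
      move {j = y} (leaf u refl y∈) with ∈-map⁻ (lookup g) (indicator-sound
          (trans (cong (λ σ → lookup σ (lookup f y)) (≡.sym (stars≡ u))) (lookup-indicator (∈-map⁺ (lookup f) y∈))))
      ... | y′ , y′∈ , fy≡gy′ = lookup ψ u , y′ , (ψ , ψ∈ , leaf u refl y′∈) , agree u , ≡.sym fy≡gy′

    transferEdge : ∀ {f g} → (∀ {i j} → lookup f i ≡ lookup f j → i ≡ j) → code f ≡ code g →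
      ∀ {x y} → CoversEdge union f x y → CoversEdge union g x y
    transferEdge inj eq (i , j , ij , refl , refl) with union⁻ ij
    ... | inj₁ o = let (i′ , j′ , o′ , i≡ , j≡) = transfer inj eq o in i′ , j′ , union⁺ o′ , i≡ , j≡
    ... | inj₂ o = let (j′ , i′ , o′ , j≡ , i≡) = transfer inj eq o in i′ , j′ , adj-sym union (union⁺ o′) , i≡ , j≡

    -- The code determines the copy: the vertex set is always everything, and `transfer` in both
    -- directions identifies the edges.
    N-union : N (K n) union ≤ length (picks (pieces n s) n (length Φ))
    N-union = length-deduplicate-≤ subgraph-≟ (image union) code (embeddings union (K n)) _
      (λ {f} f∈ → code∈ f (inj f∈))
      (λ {f} {g} f∈ g∈ eq → image-ext {J = union} {f} {g}
        (λ {x} _ → injective⇒covers {f = g} (inj g∈) x) (λ {x} _ → injective⇒covers {f = f} (inj f∈) x)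
        (transferEdge (inj f∈) eq) (transferEdge (inj g∈) (≡.sym eq)))
      where
      inj : ∀ {f} → f ∈ embeddings union (K n) → ∀ {i j} → lookup f i ≡ lookup f j → i ≡ j
      inj f∈ = Embedding.injective (∈-embeddings⁻ {J = union} {K n} f∈)

  -- Maximal disjoint families

  -- q-sparsity for q = a / b, for spanning subgraphs only and with denominators cleared.
  SparseAt : (a b : ℕ) → Graph n → Set
  SparseAt {n} a b H = ∀ (I : Graph n) → I ⊆G H → b ^ e I ≤ N (K n) I * a ^ e I

  -- Powers of a/b ≤ 1 decrease, so a lower bound for the number of edges of the union is enough to
  -- use sparsity.
  lower-exponent : ∀ {a b c i j} → a ≤ b → 1 ≤ b → i ≤ j → b ^ j ≤ c * a ^ j → b ^ i ≤ c * a ^ i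
  lower-exponent {a} {b@(suc _)} {c} {i} {j} a≤b _ i≤j le = *-cancelʳ-≤ _ _ (b ^ (j ∸ i)) {{m^n≢0 b (j ∸ i)}} (begin
    b ^ i * b ^ (j ∸ i)          ≡⟨ split b ⟨
    b ^ j                        ≤⟨ le ⟩
    c * a ^ j                    ≡⟨ cong (c *_) (split a) ⟩
    c * (a ^ i * a ^ (j ∸ i))    ≡⟨ *-assoc c _ _ ⟨
    c * a ^ i * a ^ (j ∸ i)      ≤⟨ *-monoʳ-≤ (c * a ^ i) (^-monoˡ-≤ (j ∸ i) a≤b) ⟩
    c * a ^ i * b ^ (j ∸ i)      ∎)
    where
    open ≤-Reasoning
    split : ∀ x → x ^ j ≡ x ^ i * x ^ (j ∸ i)
    split x = trans (cong (x ^_) (≡.sym (m+[n∸m]≡n i≤j))) (^-distribˡ-+-* x i (j ∸ i))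

  family-bound : ∀ {a b k} {F : Graph (suc ℓ)} {H : Graph n} {s Φ} {_≺_ : Fin n → Fin n → Set} →
    1 ≤ k → 1 ≤ b → a ≤ b → n * a ≤ k * b → SparseAt a b H → e F ≡ ℓ →
    (∀ u → lookup s u ≡ 0 ⊎ 8 * k ≤ lookup s u) → StarFamily F H s Φ _≺_ →
    length Φ * 2 ^ Vec.sum s * b ^ ℓ ≤ 4 * n * (n * a) ^ ℓ
  family-bound {n = n} {a} {b} {k} {s = s} {Φ} 1≤k 1≤b a≤b na≤kb sparse eF sizes fam =
    codes-bound {n = n} {a} {b} {k} s (length Φ) 1≤k 1≤b na≤kb sizes
      (lower-exponent {c = length (picks (pieces n s) n (length Φ))} a≤b 1≤b e-union
        (≤-trans (sparse union union⊆H) (*-monoˡ-≤ (a ^ e union) N-union)))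
    where open StarForest fam eF

  private
    ∈-take : ∀ {A : Set} k (xs : List A) {x} → x ∈ take k xs → x ∈ xs
    ∈-take k xs = All.lookup (AllP.take⁺ k (All.tabulate id))

  -- Levels and stars for one orientation

  module Orientation {n} (H : Graph n) (_≺_ : Fin n → Fin n → Set) (_≺?_ : ∀ x y → Dec (x ≺ y)) where

    out : Fin n → List (Fin n)
    out x = filter (x ≺?_) (neighbours H x)

    out-unique : ∀ x → Unique (out x)
    out-unique x = Uniq.filter⁺ _ (neighbours-unique H x)

    ∈-out⁻ : ∀ {x y} → y ∈ out x → T (adj H x y) × x ≺ y
    ∈-out⁻ {x} y∈ = let (y∈′ , x≺y) = ∈-filter⁻ (x ≺?_) {xs = neighbours H x} y∈ in ∈-neighbours⁻ H y∈′ , x≺y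

    level : (M : ℕ) .{{_ : NonZero M}} → Fin n → ℕ
    level M x = length (out x) / M

    level≤n : ∀ M .{{_ : NonZero M}} x → level M x ≤ n
    level≤n M x = ≤-trans (m/n≤m (length (out x)) M) (unique⇒length≤ (out-unique x))

    level*M≤ : ∀ M .{{_ : NonZero M}} x → level M x * M ≤ length (out x)
    level*M≤ M x = m/n*n≤m (length (out x)) M

    -- The linear bound M(t+1) is relaxed to M 2^t so that products over the vertices of a tree
    -- depend only on the sum of the levels.
    length-out≤ : ∀ M .{{_ : NonZero M}} x → length (out x) ≤ M * 2 ^ level M x
    length-out≤ M x = begin
      length (out x)                               ≡⟨ m≡m%n+[m/n]*n (length (out x)) M ⟩
      length (out x) % M + level M x * M           ≤⟨ +-monoˡ-≤ _ (<⇒≤ (m%n<n (length (out x)) M)) ⟩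
      suc (level M x) * M                          ≤⟨ *-monoˡ-≤ M (n<2^n (level M x)) ⟩
      2 ^ level M x * M                            ≡⟨ *-comm (2 ^ level M x) M ⟩
      M * 2 ^ level M x                            ∎
      where open ≤-Reasoning

    module _ {ℓ} {F : Graph (suc ℓ)} {Δ} (deg≤ : ∀ x → deg F x ≤ Δ) where

      private
        inF? : ∀ (φ : Vec (Fin n) (suc ℓ)) u y → Dec (Any (λ u′ → lookup φ u′ ≡ y) (neighbours F u))
        inF? φ u y = any? (λ u′ → lookup φ u′ FinP.≟ y) (neighbours F u)

      -- The leaves still allowed at the image of u. Dropping the images of the F-neighbours of u
      -- costs at most Δ leaves and keeps star edges distinct from tree edges.
      new : Vec (Fin n) (suc ℓ) → Fin (suc ℓ) → List (Fin n)
      new φ u = filter (λ y → ¬? (inF? φ u y)) (out (lookup φ u))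

      length-new : ∀ φ u → length (out (lookup φ u)) ≤ length (new φ u) + Δ
      length-new φ u = begin
        length (out (lookup φ u))                                     ≤⟨ unique-⊆⇒length≤ (out-unique (lookup φ u)) split ⟩
        length (new φ u ++ map (lookup φ) (neighbours F u))           ≡⟨ length-++ (new φ u) ⟩
        length (new φ u) + length (map (lookup φ) (neighbours F u))   ≡⟨ cong (length (new φ u) +_) (length-map (lookup φ) (neighbours F u)) ⟩
        length (new φ u) + deg F u                                    ≤⟨ +-monoʳ-≤ (length (new φ u)) (deg≤ u) ⟩
        length (new φ u) + Δ                                          ∎
        where
        open ≤-Reasoning
        split : ∀ {y} → y ∈ out (lookup φ u) → y ∈ new φ u ++ map (lookup φ) (neighbours F u)
        split {y} y∈ with inF? φ u y
        ... | no y∉ = ∈-++⁺ˡ (∈-filter⁺ (λ y → ¬? (inF? φ u y)) y∈ y∉)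
        ... | yes p with find p
        ...   | u′ , u′∈ , refl = ∈-++⁺ʳ (new φ u) (∈-map⁺ (lookup φ) u′∈)

      starFamily : ∀ {s Φ} → (∀ {x y} → x ≺ y → ¬ y ≺ x) → Unique Φ → (∀ {φ} → φ ∈ Φ → Embedding F H φ) →
        (∀ {φ ψ} → φ ∈ Φ → ψ ∈ Φ → ∀ {i j} → lookup φ i ≡ lookup ψ j → φ ≡ ψ) →
        (∀ {φ} → φ ∈ Φ → ∀ u → lookup s u ≤ length (new φ u)) →
        StarFamily F H s Φ _≺_
      starFamily {s} {Φ} ≺-asym uniq emb disj enough = record
        { unique = uniq ; embedded = emb ; disjoint = disj ; asym = ≺-asym
        ; star = star′
        ; star-unique = λ {φ} _ u → Uniq.take⁺ (lookup s u) (Uniq.filter⁺ _ (out-unique (lookup φ u)))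
        ; star-length = λ {φ} φ∈ u → trans (length-take (lookup s u) (new φ u)) (m≤n⇒m⊓n≡m (enough φ∈ u))
        ; star-adj = λ {φ} _ u y∈ → proj₁ (∈-out⁻ (proj₁ (∈-star φ u y∈)))
        ; star-≺ = λ {φ} _ u y∈ → proj₂ (∈-out⁻ (proj₁ (∈-star φ u y∈)))
        ; star-new = λ {φ} _ u y∈ uu′ → proj₂ (∈-star φ u y∈) (lose (∈-neighbours⁺ F uu′) refl)
        }
        where
        star′ : Vec (Fin n) (suc ℓ) → Fin (suc ℓ) → List (Fin n)
        star′ φ u = take (lookup s u) (new φ u)
        ∈-star : ∀ φ u {y} → y ∈ star′ φ u → y ∈ out (lookup φ u) × ¬ Any (λ u′ → lookup φ u′ ≡ y) (neighbours F u)
        ∈-star φ u y∈ = ∈-filter⁻ (λ y → ¬? (inF? φ u y)) {xs = out (lookup φ u)} (∈-take (lookup s u) (new φ u) y∈)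

      -- A vertex of level t has at least tM out-neighbours, so after the loss of Δ it still has
      -- 8(Δ+1)k t usable leaves. A positive multiple of 8k passes the threshold of `pick-weight`;
      -- the factor (Δ+1)k is the saving that must outlast the k-th root and the count of
      -- extensions.
      level-bound : ∀ {a b k M Φ} .{{_ : NonZero M}} (t : Vec ℕ (suc ℓ)) → 1 ≤ k → 1 ≤ b → a ≤ b → n * a ≤ k * b →
        SparseAt a b H → e F ≡ ℓ → (∀ {x y} → x ≺ y → ¬ y ≺ x) → Unique Φ → (∀ {φ} → φ ∈ Φ → Embedding F H φ) →
        (∀ {φ ψ} → φ ∈ Φ → ψ ∈ Φ → ∀ {i j} → lookup φ i ≡ lookup ψ j → φ ≡ ψ) →
        (∀ {φ} → φ ∈ Φ → ∀ u → level M (lookup φ u) ≡ lookup t u) →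
        8 * suc Δ * k + Δ ≤ M →
        length Φ * 2 ^ (8 * suc Δ * k * Vec.sum t) * b ^ ℓ ≤ 4 * n * (n * a) ^ ℓ
      level-bound {a} {b} {k} {M} {Φ} t 1≤k 1≤b a≤b na≤kb sparse eF ≺-asym uniq emb disj levels M-large =
        subst (λ z → length Φ * 2 ^ z * b ^ ℓ ≤ 4 * n * (n * a) ^ ℓ) (sum-scaled t)
          (family-bound {k = k} {s = s} 1≤k 1≤b a≤b na≤kb sparse eF sizes
            (starFamily {s} ≺-asym uniq emb disj enough))
        where
        open ≤-Reasoning
        c : ℕ
        c = 8 * suc Δ * k
        s : Vec ℕ (suc ℓ)
        s = Vec.map (c *_) t
        sum-scaled : ∀ {j} (t : Vec ℕ j) → Vec.sum (Vec.map (c *_) t) ≡ c * Vec.sum t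
        sum-scaled []      = ≡.sym (*-zeroʳ c)
        sum-scaled (x ∷ t) = trans (cong (c * x +_) (sum-scaled t)) (≡.sym (*-distribˡ-+ c x (Vec.sum t)))
        sizes : ∀ u → lookup s u ≡ 0 ⊎ 8 * k ≤ lookup s u
        sizes u with lookup t u | VecP.lookup-map u (c *_) t
        ... | zero  | eq = inj₁ (trans eq (*-zeroʳ c))
        ... | suc x | eq = inj₂ (begin
          8 * k            ≤⟨ *-monoˡ-≤ k (m≤m*n 8 (suc Δ)) ⟩
          c                ≤⟨ m≤m*n c (suc x) ⟩
          c * suc x        ≡⟨ eq ⟨
          lookup s u       ∎)
        enough : ∀ {φ} → φ ∈ Φ → ∀ u → lookup s u ≤ length (new φ u)
        enough {φ} φ∈ u with lookup t u | VecP.lookup-map u (c *_) t | levels φ∈ u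
        ... | zero  | eq | _  = ≤-trans (≤-reflexive (trans eq (*-zeroʳ c))) z≤n
        ... | suc x | eq | lv = +-cancelʳ-≤ Δ _ _ (begin
          lookup s u + Δ                        ≡⟨ cong (_+ Δ) eq ⟩
          c * suc x + Δ                         ≤⟨ +-monoʳ-≤ (c * suc x) (m≤m*n Δ (suc x)) ⟩
          c * suc x + Δ * suc x                 ≡⟨ *-distribʳ-+ (suc x) c Δ ⟨
          (c + Δ) * suc x                       ≤⟨ *-monoˡ-≤ (suc x) M-large ⟩
          M * suc x                             ≡⟨ *-comm M (suc x) ⟩
          suc x * M                             ≡⟨ cong (_* M) lv ⟨
          level M (lookup φ u) * M              ≤⟨ level*M≤ M (lookup φ u) ⟩
          length (out (lookup φ u))             ≤⟨ length-new φ u ⟩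
          length (new φ u) + Δ                  ∎)

  -- Greedy families of disjoint embeddings

  Meets : Vec (Fin n) m → Vec (Fin n) m → Set
  Meets f g = ∃ λ i → ∃ λ j → lookup f i ≡ lookup g j

  meets? : ∀ (f g : Vec (Fin n) m) → Dec (Meets f g)
  meets? f g = FinP.any? (λ i → FinP.any? (λ j → lookup f i FinP.≟ lookup g j))

  record MaximalDisjoint {m n} (E : List (Vec (Fin n) m)) : Set where
    field
      family          : List (Vec (Fin n) m)
      family⊆         : ∀ {φ} → φ ∈ family → φ ∈ E
      family-unique   : Unique family
      family-disjoint : ∀ {φ ψ} → φ ∈ family → ψ ∈ family → Meets φ ψ → φ ≡ ψ
      family-maximal  : ∀ {f} → f ∈ E → Any (Meets f) family

  -- Greedy choice. The tree has at least one vertex, so a chosen embedding meets itself and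
  -- maximality covers the chosen members too.
  maximalDisjoint : ∀ (E : List (Vec (Fin n) (suc ℓ))) → MaximalDisjoint E
  maximalDisjoint [] = record
    { family = [] ; family⊆ = λ () ; family-unique = [] ; family-disjoint = λ () ; family-maximal = λ () }
  maximalDisjoint (f ∷ E) with maximalDisjoint E
  ... | rest with any? (meets? f) (MaximalDisjoint.family rest)
  ...   | yes meets = record
          { family = family ; family⊆ = there ∘ family⊆ ; family-unique = family-unique ; family-disjoint = family-disjoint
          ; family-maximal = λ { (here refl) → meets ; (there g∈) → family-maximal g∈ } }
          where open MaximalDisjoint rest
  ...   | no ¬meets = record
          { family = f ∷ family
          ; family⊆ = λ { (here refl) → here refl ; (there φ∈) → there (family⊆ φ∈) }
          ; family-unique = AllP.¬Any⇒All¬ family (λ f∈ → ¬meets (lose f∈ (zero , zero , refl)) ) ∷ family-unique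
          ; family-disjoint = disj
          ; family-maximal = λ { (here refl) → here (zero , zero , refl) ; (there g∈) → there (family-maximal g∈) } }
          where
          open MaximalDisjoint rest
          disj : ∀ {φ ψ} → φ ∈ f ∷ family → ψ ∈ f ∷ family → Meets φ ψ → φ ≡ ψ
          disj (here refl) (here refl) _ = refl
          disj (here refl) (there ψ∈) meets = ⊥-elim (¬meets (lose ψ∈ meets))
          disj (there φ∈) (here refl) (i , j , eq) = ⊥-elim (¬meets (lose φ∈ (j , i , ≡.sym eq)))
          disj (there φ∈) (there ψ∈) meets = family-disjoint φ∈ ψ∈ meets

  -- Disjoint copies have distinct roots. This crude bound controls the factor T^(k-1) when k-th
  -- roots are taken.
  family-length : ∀ {E : List (Vec (Fin n) (suc ℓ))} (d : MaximalDisjoint E) → length (MaximalDisjoint.family d) ≤ n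
  family-length d = ≤-trans (≤-reflexive (≡.sym (length-map (λ φ → lookup φ zero) family)))
    (unique⇒length≤ (unique-map (λ φ∈ ψ∈ eq → family-disjoint φ∈ ψ∈ (zero , zero , eq)) family-unique))
    where open MaximalDisjoint d

  length-pairs : ∀ m → length (pairs m) ≡ m * m
  length-pairs m = trans (length-pairsOf (allFin m) (λ _ → allFin m))
    (trans (∑-const (allFin m) (length (allFin m))) (cong₂ _*_ (length-allFin m) (length-allFin m)))

  -- Every member of E meets the family, in one of m² ways for each member of the family.
  length-via-family : ∀ {E : List (Vec (Fin n) m)} (d : MaximalDisjoint E) → Unique E → ∀ C →
    (∀ i w → length (filter (λ f → lookup f i FinP.≟ w) E) ≤ C) →
    length E ≤ length (MaximalDisjoint.family d) * (m * m) * C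
  length-via-family {m = m} {E} d uniq C bound = begin
    length E                                         ≤⟨ pigeonhole (λ f p → f ≡ proj₂ p) {ys = pairsOf places through} uniq place (λ { _ _ refl refl → refl }) ⟩
    length (pairsOf places through)                  ≡⟨ length-pairsOf places through ⟩
    ∑ places (length ∘ through)                      ≤⟨ ∑-bound places C (λ {p} _ → bound (proj₁ (proj₂ p)) (lookup (proj₁ p) (proj₂ (proj₂ p)))) ⟩
    length places * C                                ≡⟨ cong (_* C) (trans (length-pairsOf family (λ _ → pairs m)) (∑-const family (length (pairs m)))) ⟩
    length family * length (pairs m) * C             ≡⟨ cong (λ z → length family * z * C) (length-pairs m) ⟩
    length family * (m * m) * C                      ∎
    where
    open ≤-Reasoning
    open MaximalDisjoint d
    places : List (Vec (Fin _) m × (Fin m × Fin m))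
    places = pairsOf family (λ _ → pairs m)
    through : Vec (Fin _) m × (Fin m × Fin m) → List (Vec (Fin _) m)
    through p = filter (λ f → lookup f (proj₁ (proj₂ p)) FinP.≟ lookup (proj₁ p) (proj₂ (proj₂ p))) E
    place : ∀ {f} → f ∈ E → ∃ λ p → p ∈ pairsOf places through × f ≡ proj₂ p
    place {f} f∈ with find (family-maximal f∈)
    ... | φ , φ∈ , i , j , eq = ((φ , (i , j)) , f) ,
      ∈-pairsOf⁺ {g = through} (∈-pairsOf⁺ φ∈ (∈-pairs i j)) (∈-filter⁺ (λ g → lookup g i FinP.≟ lookup φ j) f∈ eq) , refl

  -- Classes of embeddings

  -- The two orientations bound T separately, in terms of the upper levels σ or the lower levels τ.
  -- The larger of the two is at least half their sum, and the factor 8 more than covers the half.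
  merge-exponents : ∀ T c σ τ y z → T * 2 ^ (8 * c * σ) * y ≤ z → T * 2 ^ (8 * c * τ) * y ≤ z → T * 2 ^ (c * (σ + τ)) * y ≤ z
  merge-exponents T c σ τ y z hσ hτ with ≤-total σ τ
  ... | inj₁ σ≤τ = ≤-trans (*-monoˡ-≤ y (*-monoʳ-≤ T (^-monoʳ-≤ 2 (exponent≤ (+-monoˡ-≤ τ σ≤τ))))) hτ
    where
    open ≤-Reasoning
    open +-*-Solver
    exponent≤ : σ + τ ≤ τ + τ → c * (σ + τ) ≤ 8 * c * τ
    exponent≤ le = begin
      c * (σ + τ)                  ≤⟨ *-monoʳ-≤ c le ⟩
      c * (τ + τ)                  ≤⟨ m≤m+n _ (6 * c * τ) ⟩
      c * (τ + τ) + 6 * c * τ      ≡⟨ solve 2 (λ c t → c :* (t :+ t) :+ con 6 :* c :* t := con 8 :* c :* t) refl c τ ⟩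
      8 * c * τ                    ∎
  ... | inj₂ τ≤σ = ≤-trans (*-monoˡ-≤ y (*-monoʳ-≤ T (^-monoʳ-≤ 2 (exponent≤ (+-monoʳ-≤ σ τ≤σ))))) hσ
    where
    open ≤-Reasoning
    open +-*-Solver
    exponent≤ : σ + τ ≤ σ + σ → c * (σ + τ) ≤ 8 * c * σ
    exponent≤ le = begin
      c * (σ + τ)                  ≤⟨ *-monoʳ-≤ c le ⟩
      c * (σ + σ)                  ≤⟨ m≤m+n _ (6 * c * σ) ⟩
      c * (σ + σ) + 6 * c * σ      ≡⟨ solve 2 (λ c t → c :* (t :+ t) :+ con 6 :* c :* t := con 8 :* c :* t) refl c σ ⟩
      8 * c * σ                    ∎

  -- For k = 1 the hypothesis is already strong enough. For k ≥ 2 the factor (n a)^ℓ ≤ (k b)^ℓ is absorbed by taking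
  -- k-th roots, since k ≤ 2^k and T ≤ n.
  root-extraction : ∀ {n a b k ℓ} T w → 1 ≤ k → 1 ≤ b → n * a ≤ k * b → k ≡ 1 ⊎ k * b ≤ 2 * (n * a) → T ≤ n →
    T * 2 ^ (k * w) * b ^ ℓ ≤ 4 * n * (n * a) ^ ℓ →
    T * 2 ^ w * (k * b) ^ ℓ ≤ 4 * n * (4 * (n * a)) ^ ℓ
  root-extraction {n} {a} {b} {ℓ = ℓ} T w _ _ _ (inj₁ refl) _ h = begin
    T * 2 ^ w * (1 * b) ^ ℓ          ≡⟨ cong₂ (λ x y → T * 2 ^ x * y ^ ℓ) (≡.sym (*-identityˡ w)) (*-identityˡ b) ⟩
    T * 2 ^ (1 * w) * b ^ ℓ          ≤⟨ h ⟩
    4 * n * (n * a) ^ ℓ              ≤⟨ *-monoʳ-≤ (4 * n) (^-monoˡ-≤ ℓ (m≤n*m (n * a) 4)) ⟩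
    4 * n * (4 * (n * a)) ^ ℓ        ∎
    where open ≤-Reasoning
  root-extraction {n} {a} {b@(suc _)} {k@(suc k′)} {ℓ} T w _ _ na≤kb (inj₂ kb≤2na) T≤n h = begin
    T * 2 ^ w * (k * b) ^ ℓ                    ≤⟨ *-mono-≤ T2^w≤ (^-monoˡ-≤ ℓ kb≤2na) ⟩
    4 * n * 2 ^ ℓ * (2 * (n * a)) ^ ℓ          ≡⟨ *-assoc (4 * n) (2 ^ ℓ) _ ⟩
    4 * n * (2 ^ ℓ * (2 * (n * a)) ^ ℓ)        ≡⟨ cong (4 * n *_) (^-*-distrib 2 (2 * (n * a)) ℓ) ⟨
    4 * n * (2 * (2 * (n * a))) ^ ℓ            ≡⟨ cong (λ z → 4 * n * z ^ ℓ) (*-assoc 2 2 (n * a)) ⟨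
    4 * n * (4 * (n * a)) ^ ℓ                  ∎
    where
    open ≤-Reasoning
    open +-*-Solver
    T2^kw≤ : T * 2 ^ (k * w) ≤ 4 * n * (2 ^ ℓ) ^ k
    T2^kw≤ = *-cancelʳ-≤ _ _ (b ^ ℓ) {{m^n≢0 b ℓ}} (begin
      T * 2 ^ (k * w) * b ^ ℓ          ≤⟨ h ⟩
      4 * n * (n * a) ^ ℓ              ≤⟨ *-monoʳ-≤ (4 * n) (^-monoˡ-≤ ℓ na≤kb) ⟩
      4 * n * (k * b) ^ ℓ              ≤⟨ *-monoʳ-≤ (4 * n) (^-monoˡ-≤ ℓ (*-monoˡ-≤ b (<⇒≤ (n<2^n k)))) ⟩
      4 * n * (2 ^ k * b) ^ ℓ          ≡⟨ cong (4 * n *_) (^-*-distrib (2 ^ k) b ℓ) ⟩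
      4 * n * ((2 ^ k) ^ ℓ * b ^ ℓ)    ≡⟨ cong (λ z → 4 * n * (z * b ^ ℓ)) (trans (^-*-assoc 2 k ℓ) (trans (cong (2 ^_) (*-comm k ℓ)) (≡.sym (^-*-assoc 2 ℓ k)))) ⟩
      4 * n * ((2 ^ ℓ) ^ k * b ^ ℓ)    ≡⟨ *-assoc (4 * n) _ _ ⟨
      4 * n * (2 ^ ℓ) ^ k * b ^ ℓ      ∎)
    T2^w≤ : T * 2 ^ w ≤ 4 * n * 2 ^ ℓ
    T2^w≤ = ^-cancelˡ-≤ k′ _ _ (begin
      (T * 2 ^ w) ^ k                             ≡⟨ ^-*-distrib T (2 ^ w) k ⟩
      T * T ^ k′ * (2 ^ w) ^ k                    ≡⟨ cong (T * T ^ k′ *_) (trans (^-*-assoc 2 w k) (cong (2 ^_) (*-comm w k))) ⟩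
      T * T ^ k′ * 2 ^ (k * w)                    ≡⟨ solve 3 (λ x y z → x :* y :* z := y :* (x :* z)) refl T (T ^ k′) (2 ^ (k * w)) ⟩
      T ^ k′ * (T * 2 ^ (k * w))                  ≤⟨ *-mono-≤ (^-monoˡ-≤ k′ (≤-trans T≤n (m≤n*m n 4))) T2^kw≤ ⟩
      (4 * n) ^ k′ * (4 * n * (2 ^ ℓ) ^ k)        ≡⟨ solve 3 (λ x y z → y :* (x :* z) := x :* y :* z) refl (4 * n) ((4 * n) ^ k′) ((2 ^ ℓ) ^ k) ⟩
      (4 * n) ^ k * (2 ^ ℓ) ^ k                   ≡⟨ ^-*-distrib (4 * n) (2 ^ ℓ) k ⟨
      (4 * n * 2 ^ ℓ) ^ k                         ∎)

  -- 9 = 8 + 1: of M = 9(Δ+1)k neighbours, 8(Δ+1)k serve as leaves and the other (Δ+1)k cover the at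
  -- most Δ excluded ones.
  unit : ℕ → ℕ
  unit Δ = 9 * suc Δ

  module Types {n} (H : Graph n) (Δ k′ : ℕ) where

    private
      module Up = Orientation H Fin._<_ FinP._<?_
      module Down = Orientation H (λ x y → y Fin.< x) (λ x y → y FinP.<? x)
      k M : ℕ
      k = suc k′
      M = unit Δ * k

    up down : Fin n → ℕ
    up x   = Up.level M x
    down x = Down.level M x

    up≤n : ∀ x → up x ≤ n
    up≤n = Up.level≤n M

    down≤n : ∀ x → down x ≤ n
    down≤n = Down.level≤n M

    deg≤levels : ∀ x → deg H x ≤ 2 * M * 2 ^ (up x + down x)
    deg≤levels x = begin
      deg H x                                           ≤⟨ unique-⊆⇒length≤ (neighbours-unique H x) split ⟩
      length (Up.out x ++ Down.out x)                   ≡⟨ length-++ (Up.out x) ⟩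
      length (Up.out x) + length (Down.out x)           ≤⟨ +-mono-≤ (Up.length-out≤ M x) (Down.length-out≤ M x) ⟩
      M * 2 ^ up x + M * 2 ^ down x                     ≤⟨ +-mono-≤ (*-monoʳ-≤ M (^-monoʳ-≤ 2 (m≤m+n (up x) (down x)))) (*-monoʳ-≤ M (^-monoʳ-≤ 2 (m≤n+m (down x) (up x)))) ⟩
      M * 2 ^ (up x + down x) + M * 2 ^ (up x + down x) ≡⟨ solve 2 (λ a b → a :* b :+ a :* b := con 2 :* a :* b) refl M (2 ^ (up x + down x)) ⟩
      2 * M * 2 ^ (up x + down x)                       ∎
      where
      open ≤-Reasoning
      open +-*-Solver
      split : ∀ {y} → y ∈ neighbours H x → y ∈ Up.out x ++ Down.out x
      split {y} y∈ with <-cmp (toℕ x) (toℕ y)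
      ... | tri< x<y _ _ = ∈-++⁺ˡ (∈-filter⁺ (λ z → x FinP.<? z) y∈ x<y)
      ... | tri> _ _ y<x = ∈-++⁺ʳ (Up.out x) (∈-filter⁺ (λ z → z FinP.<? x) y∈ y<x)
      ... | tri≈ _ x≡y _ = ⊥-elim (adj-irr H (subst (λ z → T (adj H z y)) (FinP.toℕ-injective x≡y) (∈-neighbours⁻ H y∈)))

    unit-large : 8 * suc Δ * k + Δ ≤ M
    unit-large = begin
      8 * suc Δ * k + Δ              ≤⟨ +-monoʳ-≤ (8 * suc Δ * k) (≤-trans (n≤1+n Δ) (m≤m*n (suc Δ) k)) ⟩
      8 * suc Δ * k + suc Δ * k      ≡⟨ solve 2 (λ s k → con 8 :* s :* k :+ s :* k := con 9 :* s :* k) refl (suc Δ) k ⟩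
      M                              ∎
      where
      open ≤-Reasoning
      open +-*-Solver

    -- As M is a constant times k, the branching (2M)^ℓ together with b^ℓ becomes a constant power
    -- times (kb)^ℓ, the quantity that `root-extraction` compares with (na)^ℓ. The constant 8 is its
    -- 4 times the 2 from having two orientations.
    type-count : ∀ {ℓ a b} {F : Graph (suc ℓ)} → IsTree F → (∀ x → deg F x ≤ Δ) → 1 ≤ b → a ≤ b → n * a ≤ k * b →
      k ≡ 1 ⊎ k * b ≤ 2 * (n * a) → SparseAt a b H → (t t′ : Vec ℕ (suc ℓ)) → ∀ {E} → Unique E →
      (∀ {f} → f ∈ E → Embedding F H f × (∀ u → up (lookup f u) ≡ lookup t u) × (∀ u → down (lookup f u) ≡ lookup t′ u)) →
      length E * 2 ^ (Vec.sum t + Vec.sum t′) * b ^ ℓ ≤ 4 * n * (suc ℓ * suc ℓ) * (8 * unit Δ * (n * a)) ^ ℓ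
    type-count {ℓ} {a} {b} {F} isTree deg≤ 1≤b a≤b na≤kb k-tight sparse t t′ {E} uniq props = begin
      length E * 2 ^ κ * b ^ ℓ
        ≤⟨ *-monoˡ-≤ (b ^ ℓ) (*-monoˡ-≤ (2 ^ κ) (length-via-family d uniq C through)) ⟩
      Tᶠ * (suc ℓ * suc ℓ) * ((2 * M) ^ ℓ * 2 ^ (Δ * κ)) * 2 ^ κ * b ^ ℓ
        ≡⟨ cong (λ z → Tᶠ * (suc ℓ * suc ℓ) * (z * 2 ^ (Δ * κ)) * 2 ^ κ * b ^ ℓ) (trans (cong (_^ ℓ) (≡.sym (*-assoc 2 (unit Δ) k))) (^-*-distrib (2 * unit Δ) k ℓ)) ⟩
      Tᶠ * (suc ℓ * suc ℓ) * ((2 * unit Δ) ^ ℓ * k ^ ℓ * 2 ^ (Δ * κ)) * 2 ^ κ * b ^ ℓ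
        ≡⟨ solve 7 (λ T m u k x y b → T :* m :* (u :* k :* x) :* y :* b := T :* (y :* x) :* (k :* b) :* m :* u) refl
             Tᶠ (suc ℓ * suc ℓ) ((2 * unit Δ) ^ ℓ) (k ^ ℓ) (2 ^ (Δ * κ)) (2 ^ κ) (b ^ ℓ) ⟩
      Tᶠ * (2 ^ κ * 2 ^ (Δ * κ)) * (k ^ ℓ * b ^ ℓ) * (suc ℓ * suc ℓ) * (2 * unit Δ) ^ ℓ
        ≡⟨ cong₂ (λ x y → Tᶠ * x * y * (suc ℓ * suc ℓ) * (2 * unit Δ) ^ ℓ) (^-distribˡ-+-* 2 κ (Δ * κ)) (^-*-distrib k b ℓ) ⟨
      Tᶠ * 2 ^ (suc Δ * κ) * (k * b) ^ ℓ * (suc ℓ * suc ℓ) * (2 * unit Δ) ^ ℓ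
        ≤⟨ *-monoˡ-≤ ((2 * unit Δ) ^ ℓ) (*-monoˡ-≤ (suc ℓ * suc ℓ) few) ⟩
      4 * n * (4 * (n * a)) ^ ℓ * (suc ℓ * suc ℓ) * (2 * unit Δ) ^ ℓ
        ≡⟨ solve 4 (λ n p m u → con 4 :* n :* p :* m :* u := con 4 :* n :* m :* (p :* u)) refl n ((4 * (n * a)) ^ ℓ) (suc ℓ * suc ℓ) ((2 * unit Δ) ^ ℓ) ⟩
      4 * n * (suc ℓ * suc ℓ) * ((4 * (n * a)) ^ ℓ * (2 * unit Δ) ^ ℓ)
        ≡⟨ cong (4 * n * (suc ℓ * suc ℓ) *_) (^-*-distrib (4 * (n * a)) (2 * unit Δ) ℓ) ⟨
      4 * n * (suc ℓ * suc ℓ) * (4 * (n * a) * (2 * unit Δ)) ^ ℓ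
        ≡⟨ cong (λ z → 4 * n * (suc ℓ * suc ℓ) * z ^ ℓ) (solve 2 (λ x u → con 4 :* x :* (con 2 :* u) := con 8 :* u :* x) refl (n * a) (unit Δ)) ⟩
      4 * n * (suc ℓ * suc ℓ) * (8 * unit Δ * (n * a)) ^ ℓ ∎
      where
      open ≤-Reasoning
      open +-*-Solver
      d : MaximalDisjoint E
      d = maximalDisjoint E
      open MaximalDisjoint d
      κ Tᶠ C : ℕ
      κ  = Vec.sum t + Vec.sum t′
      Tᶠ = length family
      C  = (2 * M) ^ ℓ * 2 ^ (Δ * κ)
      κ-sum : ∑ (allFin (suc ℓ)) (λ u → lookup t u + lookup t′ u) ≡ κ
      κ-sum = trans (∑-+ (allFin (suc ℓ)) (lookup t) (lookup t′)) (cong₂ _+_ (∑-lookup t) (∑-lookup t′))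
      through : ∀ i w → length (filter (λ f → lookup f i FinP.≟ w) E) ≤ C
      through i w = subst (λ z → length (filter (λ f → lookup f i FinP.≟ w) E) ≤ (2 * M) ^ ℓ * 2 ^ (Δ * z)) κ-sum
        (count-rooted {F = F} {H} isTree deg≤ (2 * M) (λ u → lookup t u + lookup t′ u) i w
          (Uniq.filter⁺ _ uniq)
          (λ {f} f∈ → let (f∈E , fi≡w) = ∈-filter⁻ (λ g → lookup g i FinP.≟ w) {xs = E} f∈ ; (emb , ups , downs) = props f∈E in
            emb , fi≡w , λ u → subst (λ z → deg H (lookup f u) ≤ 2 * M * 2 ^ z) (cong₂ _+_ (ups u) (downs u)) (deg≤levels (lookup f u))))
      disjoint′ : ∀ {φ ψ} → φ ∈ family → ψ ∈ family → ∀ {i j} → lookup φ i ≡ lookup ψ j → φ ≡ ψ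
      disjoint′ φ∈ ψ∈ {i} {j} eq = family-disjoint φ∈ ψ∈ (i , j , eq)
      -- Of the saved exponent (Δ+1)κ, Δκ pays for the extensions and κ is kept for the sum over the
      -- classes.
      few : Tᶠ * 2 ^ (suc Δ * κ) * (k * b) ^ ℓ ≤ 4 * n * (4 * (n * a)) ^ ℓ
      few = root-extraction {k = k} {ℓ} Tᶠ (suc Δ * κ) (s≤s z≤n) 1≤b na≤kb k-tight (family-length d)
        (subst (λ z → Tᶠ * 2 ^ z * b ^ ℓ ≤ 4 * n * (n * a) ^ ℓ)
          (solve 3 (λ s k x → s :* k :* x := k :* (s :* x)) refl (suc Δ) k κ)
          (merge-exponents Tᶠ (suc Δ * k) (Vec.sum t) (Vec.sum t′) (b ^ ℓ) (4 * n * (n * a) ^ ℓ)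
            (reassoc (Vec.sum t) (Up.level-bound deg≤ {M = M} t (s≤s z≤n) 1≤b a≤b na≤kb sparse (e-tree isTree)
              FinP.<-asym family-unique (proj₁ ∘ props ∘ family⊆) disjoint′ (proj₁ ∘ proj₂ ∘ props ∘ family⊆) unit-large))
            (reassoc (Vec.sum t′) (Down.level-bound deg≤ {M = M} t′ (s≤s z≤n) 1≤b a≤b na≤kb sparse (e-tree isTree)
              (λ p q → FinP.<-asym p q) family-unique (proj₁ ∘ props ∘ family⊆) disjoint′ (proj₂ ∘ proj₂ ∘ props ∘ family⊆) unit-large))))
        where
        reassoc : ∀ σ → Tᶠ * 2 ^ (8 * suc Δ * k * σ) * b ^ ℓ ≤ 4 * n * (n * a) ^ ℓ → Tᶠ * 2 ^ (8 * (suc Δ * k) * σ) * b ^ ℓ ≤ 4 * n * (n * a) ^ ℓ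
        reassoc σ = subst (λ z → Tᶠ * 2 ^ (z * σ) * b ^ ℓ ≤ 4 * n * (n * a) ^ ℓ) (*-assoc 8 (suc Δ) k)

  -- Summing over the classes

  total : ∀ {N m} → Vec (Fin N) m → ℕ
  total t = Vec.sum (Vec.map toℕ t)

  -- Each coordinate contributes a geometric series bounded by 2, whatever N is.
  ∑-geometric-vec : ∀ N m (g : Vec (Fin N) m → ℕ) X → (∀ t → g t * 2 ^ total t ≤ X) → ∑ (allMaps N m) g ≤ 2 ^ m * X
  ∑-geometric-vec N zero    g X bound = +-monoˡ-≤ 0 (≤-trans (≤-reflexive (≡.sym (*-identityʳ (g [])))) (bound []))
  ∑-geometric-vec N (suc m) g X bound = begin
    ∑ (allMaps N (suc m)) g
      ≡⟨ ∑-concatMap (λ x → map (x ∷_) (allMaps N m)) g (allFin N) ⟩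
    ∑ (allFin N) (λ x → ∑ (map (x ∷_) (allMaps N m)) g)
      ≡⟨ ∑-cong (allFin N) (λ x → ∑-map (x ∷_) g (allMaps N m)) ⟩
    ∑ (allFin N) (λ x → ∑ (allMaps N m) (λ t → g (x ∷ t)))
      ≡⟨ ∑-swap (allFin N) (allMaps N m) (λ x t → g (x ∷ t)) ⟩
    ∑ (allMaps N m) (λ t → ∑ (allFin N) (λ x → g (x ∷ t)))
      ≤⟨ ∑-geometric-vec N m _ (2 * X) (λ t → ≤-trans (≤-reflexive (≡.sym (∑-*ʳ (allFin N) (λ x → g (x ∷ t)) (2 ^ total t))))
           (∑-geometric N (λ x → g (x ∷ t) * 2 ^ total t) X (heads t))) ⟩
    2 ^ m * (2 * X)
      ≡⟨ solve 2 (λ a x → a :* (con 2 :* x) := con 2 :* a :* x) refl (2 ^ m) X ⟩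
    2 ^ suc m * X ∎
    where
    open ≤-Reasoning
    open +-*-Solver
    heads : ∀ t x → g (x ∷ t) * 2 ^ total t * 2 ^ toℕ x ≤ X
    heads t x = begin
      g (x ∷ t) * 2 ^ total t * 2 ^ toℕ x        ≡⟨ solve 3 (λ a b c → a :* b :* c := a :* (c :* b)) refl (g (x ∷ t)) (2 ^ total t) (2 ^ toℕ x) ⟩
      g (x ∷ t) * (2 ^ toℕ x * 2 ^ total t)      ≡⟨ cong (g (x ∷ t) *_) (^-distribˡ-+-* 2 (toℕ x) (total t)) ⟨
      g (x ∷ t) * 2 ^ total (x ∷ t)              ≤⟨ bound (x ∷ t) ⟩
      X                                          ∎

  length-by-class : ∀ {A C : Set} (_≟ᶜ_ : (x y : C) → Dec (x ≡ y)) (class : A → C) (cs : List C) {E : List A} → Unique E →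
    (∀ {f} → f ∈ E → class f ∈ cs) → length E ≤ ∑ cs (λ c → length (filter (λ f → class f ≟ᶜ c) E))
  length-by-class _≟ᶜ_ class cs {E} uniq class∈ = ≤-trans
    (pigeonhole (λ f p → f ≡ proj₂ p) {ys = pairsOf cs members} uniq
      (λ {f} f∈ → (class f , f) , ∈-pairsOf⁺ {g = members} (class∈ f∈) (∈-filter⁺ (λ g → class g ≟ᶜ class f) f∈ refl) , refl)
      (λ { _ _ refl refl → refl }))
    (≤-reflexive (length-pairsOf cs members))
    where
    members : _ → List _
    members c = filter (λ f → class f ≟ᶜ c) E

  fin-bound : ∀ {x} → x ≤ n → Fin (suc n)
  fin-bound x≤n = Fin.fromℕ< (s≤s x≤n)

  module Totals {n} (H : Graph n) (Δ k′ : ℕ) where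

    open Types H Δ k′

    private
      -- No level exceeds n, so levels fit into `Fin (suc n)` and the classes can be listed.
      Level : ℕ → Set
      Level m = Vec (Fin (suc n)) m

      levels : ∀ {m} (h : Fin n → ℕ) → (∀ x → h x ≤ n) → Vec (Fin n) m → Level m
      levels h h≤n f = tabulate (λ u → fin-bound (h≤n (lookup f u)))

      level-lookup : ∀ {m} (h : Fin n → ℕ) (h≤n : ∀ x → h x ≤ n) (f : Vec (Fin n) m) {t} → levels h h≤n f ≡ t →
        ∀ u → h (lookup f u) ≡ lookup (Vec.map toℕ t) u
      level-lookup h h≤n f refl u = ≡.sym (trans (VecP.lookup-map u toℕ (levels h h≤n f))
        (trans (cong toℕ (VecP.lookup∘tabulate (λ u → fin-bound (h≤n (lookup f u))) u)) (FinP.toℕ-fromℕ< _)))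

      _≟ᵗ_ : ∀ {m} (t t′ : Level m × Level m) → Dec (t ≡ t′)
      _≟ᵗ_ = ProdP.≡-dec (VecP.≡-dec FinP._≟_) (VecP.≡-dec FinP._≟_)

    -- The two factors `2 ^ suc ℓ` are the geometric sums over the upper and the lower levels.
    embeddings-bound : ∀ {ℓ a b} {F : Graph (suc ℓ)} → IsTree F → (∀ x → deg F x ≤ Δ) → 1 ≤ b → a ≤ b → n * a ≤ suc k′ * b →
      suc k′ ≡ 1 ⊎ suc k′ * b ≤ 2 * (n * a) → SparseAt a b H →
      length (embeddings F H) * b ^ ℓ ≤ 2 ^ suc ℓ * (2 ^ suc ℓ * (4 * n * (suc ℓ * suc ℓ) * (8 * unit Δ * (n * a)) ^ ℓ))
    embeddings-bound {ℓ} {a} {b} {F} isTree deg≤ 1≤b a≤b na≤kb k-tight sparse = begin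
      length E * b ^ ℓ                                            ≤⟨ *-monoˡ-≤ (b ^ ℓ) (length-by-class _≟ᵗ_ class (pairsOf types (λ _ → types)) (embeddings-unique F H)
                                                                       (λ _ → ∈-pairsOf⁺ (∈-allMaps _) (∈-allMaps _))) ⟩
      ∑ (pairsOf types (λ _ → types)) count * b ^ ℓ               ≡⟨ cong (_* b ^ ℓ) (∑-concatMap (λ t → map (t ,_) types) count types) ⟩
      ∑ types (λ t → ∑ (map (t ,_) types) count) * b ^ ℓ          ≡⟨ cong (_* b ^ ℓ) (∑-cong types (λ t → ∑-map (t ,_) count types)) ⟩
      ∑ types (λ t → ∑ types (λ t′ → count (t , t′))) * b ^ ℓ     ≡⟨ ∑-*ʳ types _ (b ^ ℓ) ⟨
      ∑ types (λ t → ∑ types (λ t′ → count (t , t′)) * b ^ ℓ)     ≤⟨ ∑-geometric-vec (suc n) (suc ℓ) _ (2 ^ suc ℓ * X) outer ⟩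
      2 ^ suc ℓ * (2 ^ suc ℓ * X)                                 ∎
      where
      open ≤-Reasoning
      open +-*-Solver
      X : ℕ
      X = 4 * n * (suc ℓ * suc ℓ) * (8 * unit Δ * (n * a)) ^ ℓ
      E : List (Vec (Fin n) (suc ℓ))
      E = embeddings F H
      types : List (Level (suc ℓ))
      types = allMaps (suc n) (suc ℓ)
      class : Vec (Fin n) (suc ℓ) → Level (suc ℓ) × Level (suc ℓ)
      class f = levels up up≤n f , levels down down≤n f
      count : Level (suc ℓ) × Level (suc ℓ) → ℕ
      count t = length (filter (λ f → class f ≟ᵗ t) E)
      one-type : ∀ t t′ → count (t , t′) * 2 ^ (total t + total t′) * b ^ ℓ ≤ X
      one-type t t′ = type-count isTree deg≤ 1≤b a≤b na≤kb k-tight sparse (Vec.map toℕ t) (Vec.map toℕ t′)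
        (Uniq.filter⁺ _ (embeddings-unique F H))
        (λ {f} f∈ → let (f∈E , eq) = ∈-filter⁻ (λ f → class f ≟ᵗ (t , t′)) {xs = E} f∈ in
          ∈-embeddings⁻ f∈E , level-lookup up up≤n f (cong proj₁ eq) , level-lookup down down≤n f (cong proj₂ eq))
      outer : ∀ t → ∑ types (λ t′ → count (t , t′)) * b ^ ℓ * 2 ^ total t ≤ 2 ^ suc ℓ * X
      outer t = begin
        ∑ types (λ t′ → count (t , t′)) * b ^ ℓ * 2 ^ total t       ≡⟨ *-assoc (∑ types (λ t′ → count (t , t′))) (b ^ ℓ) (2 ^ total t) ⟩
        ∑ types (λ t′ → count (t , t′)) * (b ^ ℓ * 2 ^ total t)     ≡⟨ ∑-*ʳ types _ (b ^ ℓ * 2 ^ total t) ⟨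
        ∑ types (λ t′ → count (t , t′) * (b ^ ℓ * 2 ^ total t))     ≤⟨ ∑-geometric-vec (suc n) (suc ℓ) _ X (λ t′ → ≤-trans (≤-reflexive (inner t′)) (one-type t t′)) ⟩
        2 ^ suc ℓ * X                                               ∎
        where
        inner : ∀ t′ → count (t , t′) * (b ^ ℓ * 2 ^ total t) * 2 ^ total t′ ≡ count (t , t′) * 2 ^ (total t + total t′) * b ^ ℓ
        inner t′ = trans
          (solve 4 (λ c b x y → c :* (b :* x) :* y := c :* (x :* y) :* b) refl (count (t , t′)) (b ^ ℓ) (2 ^ total t) (2 ^ total t′))
          (cong (λ z → count (t , t′) * z * b ^ ℓ) (≡.sym (^-distribˡ-+-* 2 (total t) (total t′))))

  -- 65536 = 512 * 128. The factors of 512 = 8 * 16 * 4, each raised to the power ℓ, are the 8 of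
  -- `type-count`, the 16 from the two geometric sums and (ℓ+1)^2 ≤ 4^ℓ, and the 4 from n^m ≤ 4^m
  -- n(n-1)...(n-m+1). The 128 absorbs the remaining absolute factor 64.
  constant : ℕ → ℕ
  constant Δ = 65536 * unit Δ

  slack : ∀ n ℓ u a p → 1 ≤ ℓ → 1 ≤ u * a → 1 ≤ n → n ^ suc ℓ ≤ 4 ^ suc ℓ * p →
    2 ^ suc ℓ * (2 ^ suc ℓ * (4 * n * (suc ℓ * suc ℓ) * (8 * u * (n * a)) ^ ℓ)) < p * (65536 * u * a) ^ ℓ
  slack n@(suc _) ℓ@(suc ℓ′) u a p _ 1≤ua _ n^m≤ = begin-strict
    2 ^ suc ℓ * (2 ^ suc ℓ * (4 * n * (suc ℓ * suc ℓ) * (8 * u * (n * a)) ^ ℓ))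
      ≤⟨ *-monoʳ-≤ (2 ^ suc ℓ) (*-monoʳ-≤ (2 ^ suc ℓ) (*-monoˡ-≤ ((8 * u * (n * a)) ^ ℓ) (*-monoʳ-≤ (4 * n) (*-mono-≤ (n<2^n ℓ) (n<2^n ℓ))))) ⟩
    2 ^ suc ℓ * (2 ^ suc ℓ * (4 * n * (2 ^ ℓ * 2 ^ ℓ) * (8 * u * (n * a)) ^ ℓ))
      ≡⟨ cong (λ z → 2 ^ suc ℓ * (2 ^ suc ℓ * (4 * n * (2 ^ ℓ * 2 ^ ℓ) * z))) (trans (cong (_^ ℓ) (solve 3 (λ u n a → con 8 :* u :* (n :* a) := n :* (con 8 :* (u :* a))) refl u n a)) (^-*-distrib n (8 * (u * a)) ℓ)) ⟩
    2 ^ suc ℓ * (2 ^ suc ℓ * (4 * n * (2 ^ ℓ * 2 ^ ℓ) * (n ^ ℓ * (8 * (u * a)) ^ ℓ)))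
      ≡⟨ solve 4 (λ t n nl x → con 2 :* t :* (con 2 :* t :* (con 4 :* n :* (t :* t) :* (nl :* x))) := n :* nl :* (con 16 :* ((t :* t) :* (t :* t) :* x))) refl (2 ^ ℓ) n (n ^ ℓ) ((8 * (u * a)) ^ ℓ) ⟩
    n ^ suc ℓ * (16 * ((2 ^ ℓ * 2 ^ ℓ) * (2 ^ ℓ * 2 ^ ℓ) * (8 * (u * a)) ^ ℓ))
      ≤⟨ *-monoˡ-≤ _ n^m≤ ⟩
    4 * 4 ^ ℓ * p * (16 * ((2 ^ ℓ * 2 ^ ℓ) * (2 ^ ℓ * 2 ^ ℓ) * (8 * (u * a)) ^ ℓ))
      ≡⟨ cong (λ z → 4 * 4 ^ ℓ * p * (16 * (z * (8 * (u * a)) ^ ℓ))) (trans (cong₂ _*_ (≡.sym (^-*-distrib 2 2 ℓ)) (≡.sym (^-*-distrib 2 2 ℓ))) (≡.sym (^-*-distrib 4 4 ℓ))) ⟩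
    4 * 4 ^ ℓ * p * (16 * (16 ^ ℓ * (8 * (u * a)) ^ ℓ))
      ≡⟨ solve 4 (λ f p s x → con 4 :* f :* p :* (con 16 :* (s :* x)) := con 64 :* (p :* (f :* (s :* x)))) refl (4 ^ ℓ) p (16 ^ ℓ) ((8 * (u * a)) ^ ℓ) ⟩
    64 * (p * (4 ^ ℓ * (16 ^ ℓ * (8 * (u * a)) ^ ℓ)))
      ≡⟨ cong (λ z → 64 * (p * z)) (trans (cong (4 ^ ℓ *_) (≡.sym (^-*-distrib 16 (8 * (u * a)) ℓ))) (≡.sym (^-*-distrib 4 (16 * (8 * (u * a))) ℓ))) ⟩
    64 * (p * (4 * (16 * (8 * (u * a)))) ^ ℓ)
      ≡⟨ cong (λ z → 64 * (p * z ^ ℓ)) (collect (u * a)) ⟩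
    64 * (p * (512 * (u * a)) ^ ℓ)
      -- The only strict step: 64 < 128 ≤ 128^ℓ because ℓ ≥ 1. It also needs a positive right
      -- factor, hence a ≥ 1 and a nonzero p.
      <⟨ *-monoˡ-< (p * (512 * (u * a)) ^ ℓ) {{positive-target}} 64<128^ℓ ⟩
    128 ^ ℓ * (p * (512 * (u * a)) ^ ℓ)
      ≡⟨ trans (solve 3 (λ x y z → x :* (y :* z) := y :* (x :* z)) refl (128 ^ ℓ) p ((512 * (u * a)) ^ ℓ)) (cong (p *_) (≡.sym (^-*-distrib 128 (512 * (u * a)) ℓ))) ⟩
    p * (128 * (512 * (u * a))) ^ ℓ
      ≡⟨ cong (λ z → p * z ^ ℓ) (trans (≡.sym (*-assoc 128 512 (u * a))) (≡.sym (*-assoc 65536 u a))) ⟩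
    p * (65536 * u * a) ^ ℓ ∎
    where
    open ≤-Reasoning
    open +-*-Solver
    collect : ∀ x → 4 * (16 * (8 * x)) ≡ 512 * x
    collect x = trans (cong (4 *_) (≡.sym (*-assoc 16 8 x))) (≡.sym (*-assoc 4 128 x))
    64<128^ℓ : 64 < 128 ^ ℓ
    64<128^ℓ = ≤-trans (≤ᵇ⇒≤ 65 128 tt) (m≤m*n 128 (128 ^ ℓ′) {{m^n≢0 128 ℓ′}})
    p≢0 : NonZero p
    p≢0 = ≢-nonZero (λ { refl → <⇒≱ (m^n>0 n (suc ℓ)) (≤-trans n^m≤ (≤-reflexive (*-zeroʳ (4 ^ suc ℓ)))) })
    positive-target : NonZero (p * (512 * (u * a)) ^ ℓ)
    positive-target = m*n≢0 p _ {{p≢0}} {{m^n≢0 (512 * (u * a)) ℓ {{m*n≢0 512 (u * a) {{_}} {{>-nonZero 1≤ua}}}}}}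

  tree-copies< : ∀ {Δ a b} {H : Graph n} {F : Graph (suc ℓ)} → IsTree F → (∀ x → deg F x ≤ Δ) → 1 ≤ ℓ → suc ℓ ≤ n →
    1 ≤ a → 1 ≤ b → a ≤ b → SparseAt a b H →
    N H F * b ^ ℓ < N (K n) F * (constant Δ * a) ^ ℓ
  tree-copies< {n} {ℓ} {Δ} {a} {b@(suc _)} {H} {F} isTree deg≤ 1≤ℓ m≤n 1≤a 1≤b a≤b sparse =
    *-cancelʳ-< (aut F) _ _ (begin-strict
      N H F * b ^ ℓ * aut F                        ≡⟨ solve 3 (λ x y z → x :* y :* z := x :* z :* y) refl (N H F) (b ^ ℓ) (aut F) ⟩
      N H F * aut F * b ^ ℓ                        ≡⟨ cong (_* b ^ ℓ) (N*aut F H) ⟩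
      length (embeddings F H) * b ^ ℓ              ≤⟨ Totals.embeddings-bound H Δ k′ isTree deg≤ 1≤b a≤b na≤kb k-tight sparse ⟩
      _                                            <⟨ slack n ℓ (unit Δ) a (n P′ suc ℓ) 1≤ℓ (*-mono-≤ {1} {unit Δ} (s≤s z≤n) 1≤a) (≤-trans (s≤s z≤n) m≤n) (n^m≤4^m*nP′m n (suc ℓ) m≤n) ⟩
      (n P′ suc ℓ) * (constant Δ * a) ^ ℓ          ≤⟨ *-monoˡ-≤ ((constant Δ * a) ^ ℓ) (embeddings-complete F) ⟩
      length (embeddings F (K n)) * (constant Δ * a) ^ ℓ   ≡⟨ cong (_* (constant Δ * a) ^ ℓ) (N*aut F (K n)) ⟨
      N (K n) F * aut F * (constant Δ * a) ^ ℓ     ≡⟨ solve 3 (λ x y z → x :* z :* y := x :* y :* z) refl (N (K n) F) ((constant Δ * a) ^ ℓ) (aut F) ⟩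
      N (K n) F * (constant Δ * a) ^ ℓ * aut F     ∎)
    where
    open ≤-Reasoning
    open +-*-Solver
    -- `k′` is the integer part of d = na/b, so that k = k′ + 1 gives d ≤ k.
    k′ : ℕ
    k′ = n * a / b
    na≤kb : n * a ≤ suc k′ * b
    na≤kb = begin
      n * a                       ≡⟨ m≡m%n+[m/n]*n (n * a) b ⟩
      n * a % b + k′ * b          ≤⟨ +-monoˡ-≤ (k′ * b) (<⇒≤ (m%n<n (n * a) b)) ⟩
      suc k′ * b                  ∎
    -- If d ≥ 1, its integer part is at least 1, so k is at most twice that integer part and hence
    -- at most 2d.
    k-tight : suc k′ ≡ 1 ⊎ suc k′ * b ≤ 2 * (n * a)
    k-tight with k′ | m/n*n≤m (n * a) b
    ... | zero  | _  = inj₁ refl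
    ... | suc j | le = inj₂ (begin
      b + suc j * b               ≤⟨ +-mono-≤ (≤-trans (m≤n*m b (suc j)) le) le ⟩
      n * a + n * a               ≡⟨ cong (n * a +_) (+-identityʳ (n * a)) ⟨
      2 * (n * a)                 ∎)

  -- Rational expectations

  private
    toℚᵘ-ι : ∀ k → Q.toℚᵘ (ℕ→ℚ k) Qᵘ.≃ Qᵘ.mkℚᵘ (ℤ.+ k) 0
    toℚᵘ-ι k = QP.toℚᵘ-fromℚᵘ (Qᵘ.mkℚᵘ (ℤ.+ k) 0)

  ℕ→ℚ-* : ∀ x y → ℕ→ℚ (x * y) ≡ ℕ→ℚ x Q.* ℕ→ℚ y
  ℕ→ℚ-* x y = QP.toℚᵘ-injective (QᵘP.≃-trans (toℚᵘ-ι (x * y)) (QᵘP.≃-sym (QᵘP.≃-trans (QP.toℚᵘ-homo-* (ℕ→ℚ x) (ℕ→ℚ y))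
    (QᵘP.≃-trans (QᵘP.*-cong (toℚᵘ-ι x) (toℚᵘ-ι y)) (Qᵘ.*≡* (cong (ℤ._* ℤ.+ 1) (≡.sym (ℤP.pos-* x y))))))))

  ℕ→ℚ-mono-< : ∀ {x y} → x < y → ℕ→ℚ x Q.< ℕ→ℚ y
  ℕ→ℚ-mono-< {x} {y} x<y = QP.toℚᵘ-cancel-< (QᵘP.<-respˡ-≃ (QᵘP.≃-sym (toℚᵘ-ι x)) (QᵘP.<-respʳ-≃ (QᵘP.≃-sym (toℚᵘ-ι y))
    (Qᵘ.*<* (≡.subst₂ ℤ._<_ (≡.sym (ℤP.*-identityʳ (ℤ.+ x))) (≡.sym (ℤP.*-identityʳ (ℤ.+ y))) (ℤ.+<+ x<y)))))

  ℕ→ℚ-cancel-≤ : ∀ {x y} → ℕ→ℚ x Q.≤ ℕ→ℚ y → x ≤ y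
  ℕ→ℚ-cancel-≤ x≤y = ≮⇒≥ (λ y<x → QP.<-irrefl refl (QP.<-≤-trans (ℕ→ℚ-mono-< y<x) x≤y))

  ℕ→ℚ-nonNeg : ∀ k → Q.NonNegative (ℕ→ℚ k)
  ℕ→ℚ-nonNeg k = QP.normalize-nonNeg k 1

  ^ℚ-*-distrib : ∀ x y k → (x Q.* y) ^ℚ k ≡ (x ^ℚ k) Q.* (y ^ℚ k)
  ^ℚ-*-distrib x y zero    = refl
  ^ℚ-*-distrib x y (suc k) = trans (cong (x Q.* y Q.*_) (^ℚ-*-distrib x y k)) (begin
    x Q.* y Q.* (x ^ℚ k Q.* y ^ℚ k)      ≡⟨ QP.*-assoc x y _ ⟩
    x Q.* (y Q.* (x ^ℚ k Q.* y ^ℚ k))    ≡⟨ cong (x Q.*_) (QP.*-assoc y _ _) ⟨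
    x Q.* (y Q.* x ^ℚ k Q.* y ^ℚ k)      ≡⟨ cong (λ z → x Q.* (z Q.* y ^ℚ k)) (QP.*-comm y (x ^ℚ k)) ⟩
    x Q.* (x ^ℚ k Q.* y Q.* y ^ℚ k)      ≡⟨ cong (x Q.*_) (QP.*-assoc (x ^ℚ k) y _) ⟩
    x Q.* (x ^ℚ k Q.* (y Q.* y ^ℚ k))    ≡⟨ QP.*-assoc x _ _ ⟨
    x Q.* x ^ℚ k Q.* (y Q.* y ^ℚ k)      ∎)
    where open ≡.≡-Reasoning

  ℕ→ℚ-^ : ∀ x k → ℕ→ℚ (x ^ k) ≡ ℕ→ℚ x ^ℚ k
  ℕ→ℚ-^ x zero    = refl
  ℕ→ℚ-^ x (suc k) = trans (ℕ→ℚ-* x (x ^ k)) (cong (ℕ→ℚ x Q.*_) (ℕ→ℚ-^ x k))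

  -- The condition `num≥1` keeps the expectation positive; if it vanished, the strict inequality
  -- would fail.
  record Fraction (q : ℚ) : Set where
    field
      num den : ℕ
      num≥1   : 1 ≤ num
      den≥1   : 1 ≤ den
      num≤den : num ≤ den
      q*den   : q Q.* ℕ→ℚ den ≡ ℕ→ℚ num

  fraction : ∀ q → 0ℚ Q.< q → q Q.≤ 1ℚ → Fraction q
  fraction (Q.mkℚ (ℤ.+ zero) d-1 c) 0<q _ = ⊥-elim (ℤP.<-irrefl refl (QP.drop-*<* 0<q))
  fraction (Q.mkℚ (ℤ.-[1+ k ]) d-1 c) 0<q _ with QP.drop-*<* 0<q
  ... | ()
  fraction q@(Q.mkℚ (ℤ.+ suc k) d-1 c) 0<q q≤1 = record
    { num = suc k ; den = suc d-1 ; num≥1 = s≤s z≤n ; den≥1 = s≤s z≤n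
    ; num≤den = ℤP.drop‿+≤+ (≡.subst₂ ℤ._≤_ (ℤP.*-identityʳ (ℤ.+ suc k)) (ℤP.*-identityˡ (ℤ.+ suc d-1)) (QP.drop-*≤* q≤1))
    ; q*den = QP.toℚᵘ-injective (QᵘP.≃-trans (QP.toℚᵘ-homo-* q (ℕ→ℚ (suc d-1)))
        (QᵘP.≃-trans (QᵘP.*-congˡ {Q.toℚᵘ q} (toℚᵘ-ι (suc d-1))) (QᵘP.≃-trans (Qᵘ.*≡* cross) (QᵘP.≃-sym (toℚᵘ-ι (suc k))))))
    }
    where
    cross : ℤ.+ suc k ℤ.* ℤ.+ suc d-1 ℤ.* ℤ.+ 1 ≡ ℤ.+ suc k ℤ.* (ℤ.+ suc d-1 ℤ.* ℤ.+ 1)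
    cross = ℤP.*-assoc (ℤ.+ suc k) (ℤ.+ suc d-1) (ℤ.+ 1)

  module _ {q} (fr : Fraction q) where

    open Fraction fr

    scaled-power : ∀ c k → (ℕ→ℚ c Q.* q) ^ℚ k Q.* ℕ→ℚ (den ^ k) ≡ ℕ→ℚ ((c * num) ^ k)
    scaled-power c k = begin
      (ℕ→ℚ c Q.* q) ^ℚ k Q.* ℕ→ℚ (den ^ k)        ≡⟨ cong ((ℕ→ℚ c Q.* q) ^ℚ k Q.*_) (ℕ→ℚ-^ den k) ⟩
      (ℕ→ℚ c Q.* q) ^ℚ k Q.* ℕ→ℚ den ^ℚ k         ≡⟨ ^ℚ-*-distrib (ℕ→ℚ c Q.* q) (ℕ→ℚ den) k ⟨
      (ℕ→ℚ c Q.* q Q.* ℕ→ℚ den) ^ℚ k              ≡⟨ cong (_^ℚ k) (trans (QP.*-assoc (ℕ→ℚ c) q (ℕ→ℚ den)) (trans (cong (ℕ→ℚ c Q.*_) q*den) (≡.sym (ℕ→ℚ-* c num)))) ⟩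
      ℕ→ℚ (c * num) ^ℚ k                          ≡⟨ ℕ→ℚ-^ (c * num) k ⟨
      ℕ→ℚ ((c * num) ^ k)                         ∎
      where open ≡.≡-Reasoning

    sparseAt : ∀ {H : Graph n} → Sparse q H → SparseAt num den H
    sparseAt {n} sparse I I⊆H = ℕ→ℚ-cancel-≤ (begin
      ℕ→ℚ (den ^ e I)                                       ≡⟨ QP.*-identityˡ _ ⟨
      1ℚ Q.* ℕ→ℚ (den ^ e I)                                ≤⟨ QP.*-monoʳ-≤-nonNeg (ℕ→ℚ (den ^ e I)) {{ℕ→ℚ-nonNeg (den ^ e I)}} (sparse I I⊆H) ⟩
      ℕ→ℚ (N (K n) I) Q.* q ^ℚ e I Q.* ℕ→ℚ (den ^ e I)      ≡⟨ QP.*-assoc (ℕ→ℚ (N (K n) I)) _ _ ⟩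
      ℕ→ℚ (N (K n) I) Q.* (q ^ℚ e I Q.* ℕ→ℚ (den ^ e I))    ≡⟨ cong (λ z → ℕ→ℚ (N (K n) I) Q.* (z ^ℚ e I Q.* ℕ→ℚ (den ^ e I))) (QP.*-identityˡ q) ⟨
      ℕ→ℚ (N (K n) I) Q.* ((1ℚ Q.* q) ^ℚ e I Q.* ℕ→ℚ (den ^ e I))  ≡⟨ cong (ℕ→ℚ (N (K n) I) Q.*_) (trans (scaled-power 1 (e I)) (cong (λ z → ℕ→ℚ (z ^ e I)) (*-identityˡ num))) ⟩
      ℕ→ℚ (N (K n) I) Q.* ℕ→ℚ (num ^ e I)                   ≡⟨ ℕ→ℚ-* (N (K n) I) (num ^ e I) ⟨
      ℕ→ℚ (N (K n) I * num ^ e I)                           ∎)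
      where open QP.≤-Reasoning

    expectation< : ∀ c {x y k} → x * den ^ k < y * (c * num) ^ k → ℕ→ℚ x Q.< ℕ→ℚ y Q.* (ℕ→ℚ c Q.* q) ^ℚ k
    expectation< c {x} {y} {k} lt = QP.*-cancelʳ-<-nonNeg (ℕ→ℚ (den ^ k)) {{ℕ→ℚ-nonNeg (den ^ k)}} (begin-strict
      ℕ→ℚ x Q.* ℕ→ℚ (den ^ k)                                ≡⟨ ℕ→ℚ-* x (den ^ k) ⟨
      ℕ→ℚ (x * den ^ k)                                      <⟨ ℕ→ℚ-mono-< lt ⟩
      ℕ→ℚ (y * (c * num) ^ k)                                ≡⟨ ℕ→ℚ-* y ((c * num) ^ k) ⟩
      ℕ→ℚ y Q.* ℕ→ℚ ((c * num) ^ k)                          ≡⟨ cong (ℕ→ℚ y Q.*_) (scaled-power c k) ⟨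
      ℕ→ℚ y Q.* ((ℕ→ℚ c Q.* q) ^ℚ k Q.* ℕ→ℚ (den ^ k))       ≡⟨ QP.*-assoc (ℕ→ℚ y) _ _ ⟨
      ℕ→ℚ y Q.* (ℕ→ℚ c Q.* q) ^ℚ k Q.* ℕ→ℚ (den ^ k)         ∎)
      where open QP.≤-Reasoning

  edgeless-singleton : ∀ (F : Graph 1) x → deg F x ≡ 0
  edgeless-singleton F x with neighbours F x in eq
  ... | []    = refl
  ... | y ∷ _ with x | y | ∈-neighbours⁻ F {x} {y} (subst (y ∈_) (≡.sym eq) (here refl))
  ...   | zero | zero | xx = ⊥-elim (adj-irr F xx)

  tree-copies<expectation : ∀ Δ → 1 ≤ Δ → ∀ n q → 0ℚ Q.< q → q Q.≤ 1ℚ → (H : Graph n) → Sparse q H →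
    ∀ m (F : Graph m) → IsTree F → HasMaxDegree F Δ → m ≤ n → ℕ→ℚ (N H F) Q.< EX n (ℕ→ℚ (constant Δ) Q.* q) F
  tree-copies<expectation Δ 1≤Δ n q 0<q q≤1 H sparse zero F (() , _) _ m≤n
  -- A single vertex has as many copies in `H` as in `K n`, so strictness would fail; Δ ≥ 1 excludes
  -- it.
  tree-copies<expectation Δ 1≤Δ n q 0<q q≤1 H sparse (suc zero) F isTree (_ , x , deg≡Δ) m≤n =
    ⊥-elim (<⇒≱ 1≤Δ (≤-reflexive (trans (≡.sym deg≡Δ) (edgeless-singleton F x))))
  tree-copies<expectation Δ 1≤Δ n q 0<q q≤1 H sparse (suc ℓ@(suc _)) F isTree (deg≤ , _) m≤n =
    subst (λ k → ℕ→ℚ (N H F) Q.< ℕ→ℚ (N (K n) F) Q.* (ℕ→ℚ (constant Δ) Q.* q) ^ℚ k) (≡.sym (e-tree isTree))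
      (expectation< fr (constant Δ) {N H F} {N (K n) F} {ℓ}
        (tree-copies< {H = H} isTree deg≤ (s≤s z≤n) m≤n num≥1 den≥1 num≤den (sparseAt fr {H = H} sparse)))
    where
    fr : Fraction q
    fr = fraction q 0<q q≤1
    open Fraction fr

open import Data.Rational using (ℚ; 0ℚ; 1ℚ; _<_; _*_)

theorem1p5 : (Δ : ℕ) → 1 ≤ Δ → Σ ℕ λ L → (n : ℕ) → (q : ℚ) → 0ℚ < q → q Q.≤ 1ℚ →
    (H : Graph n) → Sparse q H → (m : ℕ) → (F : Graph m) → IsTree F → HasMaxDegree F Δ →
    m ≤ n → ℕ→ℚ (N H F) < EX n (ℕ→ℚ L * q) F
theorem1p5 Δ 1≤Δ = TreeCopies.constant Δ , TreeCopies.tree-copies<expectation Δ 1≤Δ
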